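{- The following hold (with $t$ an integer): \begin{itemize} \item $n_3(5,2;13t)=121t$ for $t\ge 1$; \item $n_3(5,2;13t-1)=121t-10$ for $t\ge 1$; \item $n_3(5,2;13t-2)=121t-20$ for $t\ge 1$; \item $n_3(5,2;13t-3)=121t-30$ for $t\ge 1$; \item $n_3(5,2;13t-4)=121t-40$ for $t\ge 1$; \item $n_3(5,2;13t-5)=121t-50$ for $t\ge 1$; \item $n_3(5,2;13t-6)=121t-60$ for $t\ge 1$; \item $n_3(5,2;13t-7)=121t-67$ for $t\ge 1$; \item $n_3(5,2;13t-8)=121t-77$ for $t\ge 1$; \item $n_3(5,2;13t-9)=121t-87$ for $t\ge 1$; \item $n_3(5,2;13t-10)=121t-94$ for $t\ge 1$; \item $n_3(5,2;13t-11)=121t-104$ for $t\ge 2$, and $n_3(5,2;2)=12$; \item $n_3(5,2;13t-12)=121t-114$ for $t\ge 2$, and $n_3(5,2;1)=1$. \end{itemize}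
   Context: All dimensions are vector-space dimensions; a hyperplane of $\mathbb{F}_q^r$ is an $(r-1)$-dimensional subspace. A projective $h-(n,r,s)_q$ system is a multiset of $n$ subspaces of $\mathbb{F}_q^r$, each of dimension at most $h$, such that each hyperplane contains at most $s$ of these subspaces (counted with multiplicity) and some hyperplane contains exactly $s$ of them. $n_q(r,h;s)$ denotes the maximum $n$ such that a projective $h-(n,r,s)_q$ system exists. -}

module Defs where

open import Algebra.Core using (Op₁; Op₂)
open import Algebra.Structures using (IsCommutativeRing)
open import Data.Fin.Base using (Fin; toℕ)
open import Data.Fin.Patterns using (0F; 1F)
import Data.Fin.Properties as Fin
open import Data.Nat.Base as ℕ using (ℕ; zero; suc; _≤_)
open import Data.Nat.DivMod using (_mod_)
open import Data.Product.Base using (∃; _×_; _,_)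
open import Data.Vec.Base using (Vec; []; _∷_; map; zipWith; replicate; foldr′; count)
open import Data.Vec.Relation.Unary.All using (All)
open import Level using (0ℓ)
open import Relation.Binary.PropositionalEquality
  using (_≡_; _≢_; refl; cong₂; isEquivalence)
open import Relation.Nullary.Decidable using (Dec; map′; from-yes; _→-dec_; ¬?)
import Relation.Unary as U
open U using (Pred)

-- A field with q elements, presented (up to isomorphism) on the carrier Fin q.
record FiniteField (q : ℕ) : Set where
  infix  8 -_
  infixl 7 _*_
  infixl 6 _+_
  field
    _+_ _*_           : Op₂ (Fin q)
    -_                : Op₁ (Fin q)
    0# 1#             : Fin q
    isCommutativeRing : IsCommutativeRing _≡_ _+_ _*_ -_ 0# 1#
    0≢1               : 0# ≢ 1#
    inverse           : ∀ x → x ≢ 0# → ∃ λ y → x * y ≡ 1#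

all-vec? : ∀ {q} r {P : Pred (Vec (Fin q) r) 0ℓ} → U.Decidable P → Dec (∀ v → P v)
all-vec? zero    P? = map′ (λ { p [] → p }) (λ f → f []) (P? [])
all-vec? (suc r) P? =
  map′ (λ { f (x ∷ v) → f x v }) (λ f x v → f (x ∷ v))
       (Fin.all? λ x → all-vec? r λ v → P? (x ∷ v))

module _ {q : ℕ} (F : FiniteField q) where
  open FiniteField F

  Vector : ℕ → Set
  Vector r = Vec (Fin q) r

  0ᵥ : ∀ {r} → Vector r
  0ᵥ = replicate _ 0#

  infixl 6 _+ᵥ_
  _+ᵥ_ : ∀ {r} → Op₂ (Vector r)
  _+ᵥ_ = zipWith _+_

  infixr 7 _·ᵥ_
  _·ᵥ_ : ∀ {r} → Fin q → Vector r → Vector r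
  c ·ᵥ v = map (c *_) v

  linearCombination : ∀ {r k} → Vec (Fin q) k → Vec (Vector r) k → Vector r
  linearCombination cs vs = foldr′ _+ᵥ_ 0ᵥ (zipWith _·ᵥ_ cs vs)

  -- Classically every subset of the finite set 𝔽_q^r is decidable; decidability is
  -- recorded so that the subspaces contained in a hyperplane can be counted.
  record Subspace (r : ℕ) : Set₁ where
    field
      Mem       : Pred (Vector r) 0ℓ
      mem?      : U.Decidable Mem
      0-closed  : Mem 0ᵥ
      +-closed  : ∀ {u v} → Mem u → Mem v → Mem (u +ᵥ v)
      ·-closed  : ∀ c {v} → Mem v → Mem (c ·ᵥ v)

  open Subspace

  infix 4 _⊆_ _⊆?_
  _⊆_ : ∀ {r} → Subspace r → Subspace r → Set
  V ⊆ W = ∀ v → Mem V v → Mem W v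

  _⊆?_ : ∀ {r} (V W : Subspace r) → Dec (V ⊆ W)
  V ⊆? W = all-vec? _ λ v → mem? V v →-dec mem? W v

  record IsBasis {r k} (W : Subspace r) (vs : Vec (Vector r) k) : Set where
    field
      members     : All (Mem W) vs
      independent : ∀ cs → linearCombination cs vs ≡ 0ᵥ → cs ≡ 0ᵥ
      spanning    : ∀ w → Mem W w → ∃ λ cs → linearCombination cs vs ≡ w

  HasDimension : ∀ {r} → Subspace r → ℕ → Set
  HasDimension {r} W k = ∃ λ (vs : Vec (Vector r) k) → IsBasis W vs

  HasDimensionAtMost : ∀ {r} → Subspace r → ℕ → Set
  HasDimensionAtMost W h = ∃ λ k → k ≤ h × HasDimension W k

  IsHyperplane : ∀ {r} → Subspace r → Set
  IsHyperplane {r} H = ∃ λ d → suc d ≡ r × HasDimension H d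

  numberContainedIn : ∀ {r n} → Subspace r → Vec (Subspace r) n → ℕ
  numberContainedIn H Ws = count (_⊆? H) Ws

  -- A multiset of n subspaces is represented by a listing of length n with
  -- repetitions; none of the conditions depends on the order.
  record IsProjectiveSystem (h : ℕ) {n r : ℕ} (s : ℕ) (Ws : Vec (Subspace r) n) : Set₁ where
    field
      dimension : All (λ W → HasDimensionAtMost W h) Ws
      at-most   : ∀ H → IsHyperplane H → numberContainedIn H Ws ≤ s
      attained  : ∃ λ H → IsHyperplane H × numberContainedIn H Ws ≡ s

  ProjectiveSystemExists : (h n r s : ℕ) → Set₁
  ProjectiveSystemExists h n r s =
    ∃ λ (Ws : Vec (Subspace r) n) → IsProjectiveSystem h s Ws

  -- IsMaxSize r h s N expresses n_q(r,h;s) = N.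
  IsMaxSize : (r h s N : ℕ) → Set₁
  IsMaxSize r h s N =
    ProjectiveSystemExists h N r s ×
    (∀ n → ProjectiveSystemExists h n r s → n ≤ N)

module 𝔽₃-Arithmetic where
  infix  8 -_
  infixl 7 _*_
  infixl 6 _+_

  _+_ _*_ : Op₂ (Fin 3)
  x + y = (toℕ x ℕ.+ toℕ y) mod 3
  x * y = (toℕ x ℕ.* toℕ y) mod 3

  -_ : Op₁ (Fin 3)
  - x = (3 ℕ.∸ toℕ x) mod 3

  isCommutativeRing : IsCommutativeRing _≡_ _+_ _*_ -_ 0F 1F
  isCommutativeRing = record
    { isRing = record
      { +-isAbelianGroup = record
        { isGroup = record
          { isMonoid = record
            { isSemigroup = record
              { isMagma = record { isEquivalence = isEquivalence ; ∙-cong = cong₂ _+_ }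
              ; assoc = from-yes (Fin.all? λ x → Fin.all? λ y → Fin.all? λ z →
                          (x + y) + z Fin.≟ x + (y + z))
              }
            ; identity = from-yes (Fin.all? λ x → 0F + x Fin.≟ x)
                       , from-yes (Fin.all? λ x → x + 0F Fin.≟ x)
            }
          ; inverse = from-yes (Fin.all? λ x → - x + x Fin.≟ 0F)
                    , from-yes (Fin.all? λ x → x + - x Fin.≟ 0F)
          ; ⁻¹-cong = λ { refl → refl }
          }
        ; comm = from-yes (Fin.all? λ x → Fin.all? λ y → x + y Fin.≟ y + x)
        }
      ; *-cong = cong₂ _*_
      ; *-assoc = from-yes (Fin.all? λ x → Fin.all? λ y → Fin.all? λ z →
                    (x * y) * z Fin.≟ x * (y * z))
      ; *-identity = from-yes (Fin.all? λ x → 1F * x Fin.≟ x)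
                   , from-yes (Fin.all? λ x → x * 1F Fin.≟ x)
      ; distrib = from-yes (Fin.all? λ x → Fin.all? λ y → Fin.all? λ z →
                    x * (y + z) Fin.≟ x * y + x * z)
                , from-yes (Fin.all? λ x → Fin.all? λ y → Fin.all? λ z →
                    (y + z) * x Fin.≟ y * x + z * x)
      }
    ; *-comm = from-yes (Fin.all? λ x → Fin.all? λ y → x * y Fin.≟ y * x)
    }

𝔽₃ : FiniteField 3
𝔽₃ = record
  { _+_ = _+_
  ; _*_ = _*_
  ; -_ = -_
  ; 0# = 0F
  ; 1# = 1F
  ; isCommutativeRing = isCommutativeRing
  ; 0≢1 = λ ()
  ; inverse = from-yes (Fin.all? λ x → ¬? (x Fin.≟ 0F) →-dec
                         Fin.any? λ y → x * y Fin.≟ 1F)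
  }
  where open 𝔽₃-Arithmetic

{-# OPTIONS --safe #-}
module Submission where

-- Replace each subspace by a pair of generators, so that a hyperplane, given by a functional h ≠ 0,
-- contains it iff h kills both. The points of n lines of PG(4,3), at most s in a hyperplane, are the columns
-- of a ternary code of length 4n, dimension 5 and minimum weight at least 3(n − s); the Griesmer bound for
-- it gives all upper bounds except those for s = 1 and s = 2. They are attained by adding copies of a
-- system of 121 lines, 13 in each hyperplane, to a few explicit systems.
--
-- For s = 1 two lines always lie in a common hyperplane. For s = 2 suppose there were 13 lines. Dually they
-- are 13 planes covering each point at most twice. Then any two of the planes meet in exactly one point,
-- and each has exactly one point that is covered only once. Fix one plane π. The points outside π fall into
-- four affine spaces AG(3,3), one for each solid through π, and the other 12 planes cut each of them in
-- lines of 12 distinct directions, the same in all four, covering every point at most twice. Only 12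
-- outside points are covered once, so in some space there are at most three of them, hence none or two by
-- parity. Parity moreover restricts how the lines lie in the planes of that space. After normalising
-- coordinates few families of 12 lines are left, and none extends to the other three spaces, in which the
-- lines are determined by those of the first and one further space: an exhaustive search.

-- The Griesmer bound still allows 7 lines for s = 1 and 17 lines for s = 2, the values of the
-- formulas at t = 1, and from t = 2 on these formulas are attained; so only two small cases escape
-- it. For s = 1 elementary geometry closes the gap, for s = 2 it does not.
--
-- Two planes in PG(4,3) always meet, and a point of π has room for one plane besides π. The other
-- 12 planes therefore cut π in disjoint subspaces of 1, 4 or 13 points; among 13 points this forces
-- 12 single points and leaves one point over. These single points are the directions, and the point
-- left over is the one missing direction, the vector `e₃`. A plane has 13 points, of which one lies
-- in π and 11 lie on the remaining planes; this is where the one singly covered point comes from.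
--
-- The space with few singles has to be enumerated first, because parity conditions on whole planes
-- are available only where the singles are known. In the other three spaces nothing but the bound
-- two is used; there one choice of a line fixes the parallel lines in two further spaces, so three
-- capacities are consumed at once.

open import Defs
open import Algebra.Structures using (IsCommutativeRing)
open import Data.Bool.Base using (Bool; true; false; _∧_; _xor_; not; if_then_else_)
import Data.Bool.Properties as Bool
open import Data.Empty using (⊥; ⊥-elim)
open import Data.Fin.Base using (Fin; zero; suc)
open import Data.Fin.Patterns using (0F; 1F; 2F; 3F; 4F; 5F; 6F; 7F; 8F; 9F)
import Data.Fin.Properties as Fin
open import Data.Fin using (#_)
open import Data.List.Base as List using (List; []; _∷_; _++_; length; filter; concatMap; allFin)
open import Data.List.Membership.Propositional using (_∈_)
open import Data.List.Membership.Propositional.Properties using (∈-map⁺; ∈-map⁻; ∈-filter⁺)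
import Data.List.Properties as Listₚ
open import Data.List.Relation.Binary.Pointwise.Base using (Pointwise; []; _∷_)
open import Data.List.Relation.Unary.All as All using (All; []; _∷_)
import Data.List.Relation.Unary.All.Properties as Allₚ
open import Data.List.Relation.Unary.Any as Any using (Any; here; there; any?)
open import Data.Maybe.Base using (Maybe; just; nothing; fromMaybe; is-just)
open import Data.Nat.Base using (ℕ; zero; suc; _+_; _*_; _∸_; _/_; _%_; _≤_; _<_; z≤n; s≤s; s≤s⁻¹)
import Data.Nat.Properties as ℕ
open import Data.Nat.Tactic.RingSolver using (solve-∀)
open import Data.Product.Base using (∃; _×_; _,_; proj₁; proj₂)
open import Data.Product.Properties using (≡-dec)
open import Data.Sum.Base using (_⊎_; inj₁; inj₂)
open import Data.Vec.Base as Vec using (Vec; []; _∷_; map; lookup; head; tail; insertAt; removeAt; count; toList)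
import Data.Vec.Properties as Vecₚ
open import Data.Vec.Relation.Unary.All as VecAll using ([]; _∷_)
import Data.Vec.Relation.Unary.All.Properties as VecAllₚ
open import Function.Base using (_∘_; const)
open import Relation.Binary.PropositionalEquality
open import Relation.Nullary.Decidable using (Dec; yes; no; does; True; toWitness; from-yes; map′; _→-dec_; _×-dec_; _⊎-dec_; ¬?; dec-true; dec-false)
open import Relation.Nullary.Negation using (¬_; contradiction)

open import Algebra.Properties.CommutativeSemigroup ℕ.+-commutativeSemigroup using (interchange)
open Subspace
open 𝔽₃-Arithmetic using () renaming (_+_ to infixl 6 _⊕_; _*_ to infixl 7 _⊗_; -_ to infix 8 ⊖_)
open IsCommutativeRing 𝔽₃-Arithmetic.isCommutativeRing using ()
  renaming ( +-assoc to ⊕-assoc; +-identityˡ to ⊕-identityˡ; +-identityʳ to ⊕-identityʳ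
           ; *-assoc to ⊗-assoc; *-comm to ⊗-comm; *-identityˡ to ⊗-identityˡ
           ; distribˡ to ⊗-distribˡ; zeroˡ to ⊗-zeroˡ; zeroʳ to ⊗-zeroʳ)

-- Linear algebra over 𝔽₃

F : Set
F = Fin 3

V : ℕ → Set
V = Vec F

infixl 6 _⊞_
_⊞_ : ∀ {n} → V n → V n → V n
_⊞_ = _+ᵥ_ 𝔽₃

infixr 7 _·_
_·_ : ∀ {n} → F → V n → V n
_·_ = _·ᵥ_ 𝔽₃

𝟘 : ∀ {n} → V n
𝟘 = 0ᵥ 𝔽₃

lincomb : ∀ {r k} → V k → Vec (V r) k → V r
lincomb = linearCombination 𝔽₃

dot : ∀ {n} → V n → V n → F
dot []      []      = 0F
dot (x ∷ u) (y ∷ v) = x ⊗ y ⊕ dot u v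

infix 4 _≟F_ _≟V_
_≟F_ : (x y : F) → Dec (x ≡ y)
_≟F_ = Fin._≟_

_≟V_ : ∀ {n} (u v : V n) → Dec (u ≡ v)
_≟V_ = Vecₚ.≡-dec Fin._≟_

⊕-interchange : ∀ a b c d → (a ⊕ b) ⊕ (c ⊕ d) ≡ (a ⊕ c) ⊕ (b ⊕ d)
⊕-interchange = from-yes (Fin.all? λ a → Fin.all? λ b → Fin.all? λ c → Fin.all? λ d →
  (a ⊕ b) ⊕ (c ⊕ d) Fin.≟ (a ⊕ c) ⊕ (b ⊕ d))

⊗-distribʳ : ∀ x a b → (a ⊕ b) ⊗ x ≡ a ⊗ x ⊕ b ⊗ x
⊗-distribʳ = proj₂ (IsCommutativeRing.distrib 𝔽₃-Arithmetic.isCommutativeRing)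

dot-comm : ∀ {n} (u v : V n) → dot u v ≡ dot v u
dot-comm []      []      = refl
dot-comm (x ∷ u) (y ∷ v) = cong₂ _⊕_ (⊗-comm x y) (dot-comm u v)

dot-⊞ˡ : ∀ {n} (u v w : V n) → dot (u ⊞ v) w ≡ dot u w ⊕ dot v w
dot-⊞ˡ []      []      []      = refl
dot-⊞ˡ (x ∷ u) (y ∷ v) (z ∷ w) = begin
  (x ⊕ y) ⊗ z ⊕ dot (u ⊞ v) w                  ≡⟨ cong₂ _⊕_ (⊗-distribʳ z x y) (dot-⊞ˡ u v w) ⟩
  (x ⊗ z ⊕ y ⊗ z) ⊕ (dot u w ⊕ dot v w)        ≡⟨ ⊕-interchange (x ⊗ z) (y ⊗ z) (dot u w) (dot v w) ⟩
  (x ⊗ z ⊕ dot u w) ⊕ (y ⊗ z ⊕ dot v w)        ∎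
  where open ≡-Reasoning

dot-·ˡ : ∀ {n} c (u w : V n) → dot (c · u) w ≡ c ⊗ dot u w
dot-·ˡ c []      []      = sym (⊗-zeroʳ c)
dot-·ˡ c (x ∷ u) (z ∷ w) = begin
  c ⊗ x ⊗ z ⊕ dot (c · u) w      ≡⟨ cong₂ _⊕_ (⊗-assoc c x z) (dot-·ˡ c u w) ⟩
  c ⊗ (x ⊗ z) ⊕ c ⊗ dot u w      ≡⟨ sym (⊗-distribˡ c (x ⊗ z) (dot u w)) ⟩
  c ⊗ (x ⊗ z ⊕ dot u w)          ∎
  where open ≡-Reasoning

dot-⊞ʳ : ∀ {n} (u v w : V n) → dot u (v ⊞ w) ≡ dot u v ⊕ dot u w
dot-⊞ʳ u v w = trans (dot-comm u (v ⊞ w))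
                     (trans (dot-⊞ˡ v w u) (cong₂ _⊕_ (dot-comm v u) (dot-comm w u)))

dot-·ʳ : ∀ {n} c (u w : V n) → dot u (c · w) ≡ c ⊗ dot u w
dot-·ʳ c u w = trans (dot-comm u (c · w)) (trans (dot-·ˡ c w u) (cong (c ⊗_) (dot-comm w u)))

dot-𝟘ˡ : ∀ {n} (w : V n) → dot 𝟘 w ≡ 0F
dot-𝟘ˡ []      = refl
dot-𝟘ˡ (z ∷ w) = trans (cong₂ _⊕_ (⊗-zeroˡ z) (dot-𝟘ˡ w)) refl

dot-𝟘ʳ : ∀ {n} (w : V n) → dot w 𝟘 ≡ 0F
dot-𝟘ʳ w = trans (dot-comm w 𝟘) (dot-𝟘ˡ w)

dot-lincomb : ∀ {r k} (cs : V k) (vs : Vec (V r) k) w →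
              dot (lincomb cs vs) w ≡ dot cs (map (λ v → dot v w) vs)
dot-lincomb []       []       w = dot-𝟘ˡ w
dot-lincomb (c ∷ cs) (v ∷ vs) w =
  trans (dot-⊞ˡ (c · v) (lincomb cs vs) w) (cong₂ _⊕_ (dot-·ˡ c v w) (dot-lincomb cs vs w))

unit : ∀ {n} → Fin n → V n
unit Fin.zero    = 1F ∷ 𝟘
unit (Fin.suc i) = 0F ∷ unit i

dot-unit : ∀ {n} (v : V n) i → dot v (unit i) ≡ lookup v i
dot-unit (x ∷ v) Fin.zero    = trans (cong₂ _⊕_ (trans (⊗-comm x 1F) (⊗-identityˡ x)) (dot-𝟘ʳ v)) (⊕-identityʳ x)
dot-unit (x ∷ v) (Fin.suc i) = trans (cong₂ _⊕_ (⊗-zeroʳ x) (dot-unit v i)) (⊕-identityˡ (lookup v i))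

≢𝟘⇒nonzero-entry : ∀ {n} (v : V n) → v ≢ 𝟘 → ∃ λ i → lookup v i ≢ 0F
≢𝟘⇒nonzero-entry []      v≢0 = ⊥-elim (v≢0 refl)
≢𝟘⇒nonzero-entry (x ∷ v) v≢0 with x ≟F 0F
... | no x≢0   = Fin.zero , x≢0
... | yes refl with ≢𝟘⇒nonzero-entry v (λ { refl → v≢0 refl })
...   | i , p = Fin.suc i , p

lookup-𝟘 : ∀ {n} (i : Fin n) → lookup 𝟘 i ≡ 0F
lookup-𝟘 Fin.zero    = refl
lookup-𝟘 (Fin.suc i) = lookup-𝟘 i

entry⇒≢𝟘 : ∀ {n} (v : V n) i → lookup v i ≢ 0F → v ≢ 𝟘
entry⇒≢𝟘 _ i p refl = p (lookup-𝟘 i)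

private
  findPivot : ∀ {r} (vs : List (V (suc r))) → All (λ v → head v ≡ 0F) vs ⊎
              ∃ λ xs → ∃ λ v → ∃ λ ys → vs ≡ xs ++ v ∷ ys × head v ≢ 0F
  findPivot []       = inj₁ []
  findPivot (v ∷ vs) with head v ≟F 0F | findPivot vs
  ... | no p  | _      = inj₂ ([] , v , vs , refl , p)
  ... | yes p | inj₁ q = inj₁ (p ∷ q)
  ... | yes p | inj₂ (xs , u , ys , refl , q) = inj₂ (v ∷ xs , u , ys , refl , q)

  pivot-cancel : ∀ x → x ≢ 0F → ∀ D → ⊖ (x ⊗ D) ⊗ x ⊕ D ≡ 0F
  pivot-cancel = from-yes (Fin.all? λ x → ¬? (x Fin.≟ 0F) →-dec
                   Fin.all? λ D → ⊖ (x ⊗ D) ⊗ x ⊕ D Fin.≟ 0F)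

  eliminated : ∀ x y D E → ⊖ (x ⊗ D) ⊗ y ⊕ E ≡ E ⊕ ⊖ (y ⊗ x) ⊗ D
  eliminated = from-yes (Fin.all? λ x → Fin.all? λ y → Fin.all? λ D → Fin.all? λ E →
                 ⊖ (x ⊗ D) ⊗ y ⊕ E Fin.≟ E ⊕ ⊖ (y ⊗ x) ⊗ D)

Orthogonal : ∀ {r} → V r → List (V r) → Set
Orthogonal h = All (λ v → dot h v ≡ 0F)

-- Gaussian elimination: a vector with nonzero first entry determines the first entry of `h` and
-- clears that entry in all others, which leaves one vector fewer in one dimension less.
orthogonal-exists : ∀ {r} (vs : List (V r)) → List.length vs < r → ∃ λ h → h ≢ 𝟘 × Orthogonal h vs
orthogonal-exists {suc r} vs d<r with findPivot vs
... | inj₁ zeros = unit Fin.zero , (λ ()) , All.map (λ {v} → ortho {v}) zeros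
  where
  ortho : ∀ {v} → head v ≡ 0F → dot (unit Fin.zero) v ≡ 0F
  ortho {x ∷ v} refl = trans (⊕-identityˡ (dot 𝟘 v)) (dot-𝟘ˡ v)
... | inj₂ (xs , x ∷ v , ys , refl , x≢0) = h , h≢0 , Allₚ.++⁺ (proj₁ both) (at-pivot ∷ proj₂ both)
  where
  reduce : V (suc r) → V r
  -- A nonzero element of 𝔽₃ is its own inverse, so `y ⊗ x` is the quotient of the two first
  -- entries.
  reduce (y ∷ u) = u ⊞ (⊖ (y ⊗ x)) · v
  us = xs ++ ys
  size : List.length (List.map reduce us) < r
  size = subst (_< r) (sym (Listₚ.length-map reduce us))
    (s≤s⁻¹ (subst (_< suc r)
      (trans (Listₚ.length-++ xs) (trans (ℕ.+-suc (List.length xs) (List.length ys)) (cong suc (sym (Listₚ.length-++ xs))))) d<r))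
  rec = orthogonal-exists (List.map reduce us) size
  h' = proj₁ rec
  h = ⊖ (x ⊗ dot h' v) ∷ h'
  h≢0 : h ≢ 𝟘
  h≢0 eq = proj₁ (proj₂ rec) (cong tail eq)
  at-pivot : dot h (x ∷ v) ≡ 0F
  at-pivot = pivot-cancel x x≢0 (dot h' v)
  elsewhere : ∀ {u} → dot h' (reduce u) ≡ 0F → dot h u ≡ 0F
  elsewhere {y ∷ u} eq = begin
    ⊖ (x ⊗ dot h' v) ⊗ y ⊕ dot h' u            ≡⟨ eliminated x y (dot h' v) (dot h' u) ⟩
    dot h' u ⊕ ⊖ (y ⊗ x) ⊗ dot h' v            ≡⟨ cong (dot h' u ⊕_) (sym (dot-·ʳ (⊖ (y ⊗ x)) h' v)) ⟩
    dot h' u ⊕ dot h' ((⊖ (y ⊗ x)) · v)        ≡⟨ sym (dot-⊞ʳ h' u ((⊖ (y ⊗ x)) · v)) ⟩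
    dot h' (reduce (y ∷ u))                    ≡⟨ eq ⟩
    0F                                         ∎
    where open ≡-Reasoning
  both = Allₚ.++⁻ xs (All.map (λ {u} → elsewhere {u}) (Allₚ.map⁻ (proj₂ (proj₂ rec))))

-- Subspaces and pairs of generators

χ : ∀ {a} {A : Set a} → Dec A → ℕ
χ d = if does d then 1 else 0

χ-mono : ∀ {a b} {A : Set a} {B : Set b} (A? : Dec A) (B? : Dec B) → (A → B) → χ A? ≤ χ B?
χ-mono (no _)  _       _ = z≤n
χ-mono (yes _) (yes _) _ = ℕ.≤-refl
χ-mono (yes a) (no ¬b) f = contradiction (f a) ¬b

∑ : ∀ {a} {A : Set a} → List A → (A → ℕ) → ℕ
∑ []       f = 0
∑ (x ∷ xs) f = f x + ∑ xs f

Pair : ℕ → Set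
Pair r = V r × V r

record Killed {r} (h : V r) (p : Pair r) : Set where
  constructor _,_
  field
    kills₁ : dot h (proj₁ p) ≡ 0F
    kills₂ : dot h (proj₂ p) ≡ 0F

killed? : ∀ {r} (h : V r) p → Dec (Killed h p)
killed? h (a , b) = map′ (λ (p , q) → p , q) (λ (p , q) → p , q) ((dot h a ≟F 0F) ×-dec (dot h b ≟F 0F))

κ : ∀ {r} → V r → Pair r → ℕ
κ h p = χ (killed? h p)

killedIn : ∀ {r} → List (Pair r) → V r → ℕ
killedIn L h = ∑ L (κ h)

⊞-identityˡ : ∀ {n} (v : V n) → 𝟘 ⊞ v ≡ v
⊞-identityˡ []      = refl
⊞-identityˡ (x ∷ v) = cong₂ _∷_ (⊕-identityˡ x) (⊞-identityˡ v)

⊞-identityʳ : ∀ {n} (v : V n) → v ⊞ 𝟘 ≡ v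
⊞-identityʳ []      = refl
⊞-identityʳ (x ∷ v) = cong₂ _∷_ (⊕-identityʳ x) (⊞-identityʳ v)

⊞-interchange : ∀ {n} (a b c d : V n) → (a ⊞ b) ⊞ (c ⊞ d) ≡ (a ⊞ c) ⊞ (b ⊞ d)
⊞-interchange [] [] [] [] = refl
⊞-interchange (a ∷ as) (b ∷ bs) (c ∷ cs) (d ∷ ds) =
  cong₂ _∷_ (⊕-interchange a b c d) (⊞-interchange as bs cs ds)

·-𝟘 : ∀ {n} c → c · 𝟘 {n} ≡ 𝟘
·-𝟘 {zero}  c = refl
·-𝟘 {suc n} c = cong₂ _∷_ (⊗-zeroʳ c) (·-𝟘 c)

·-zeroˡ : ∀ {n} (v : V n) → 0F · v ≡ 𝟘
·-zeroˡ []      = refl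
·-zeroˡ (x ∷ v) = cong (0F ∷_) (·-zeroˡ v)

·-identityˡ : ∀ {n} (v : V n) → 1F · v ≡ v
·-identityˡ []      = refl
·-identityˡ (x ∷ v) = cong₂ _∷_ (⊗-identityˡ x) (·-identityˡ v)

·-distribˡ : ∀ {n} c (u v : V n) → c · (u ⊞ v) ≡ c · u ⊞ c · v
·-distribˡ c []      []      = refl
·-distribˡ c (x ∷ u) (y ∷ v) = cong₂ _∷_ (⊗-distribˡ c x y) (·-distribˡ c u v)

·-distribʳ : ∀ {n} (v : V n) c d → (c ⊕ d) · v ≡ c · v ⊞ d · v
·-distribʳ []      c d = refl
·-distribʳ (x ∷ v) c d = cong₂ _∷_ (⊗-distribʳ x c d) (·-distribʳ v c d)

·-assoc : ∀ {n} c d (v : V n) → (c ⊗ d) · v ≡ c · (d · v)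
·-assoc c d []      = refl
·-assoc c d (x ∷ v) = cong₂ _∷_ (⊗-assoc c d x) (·-assoc c d v)

lincomb-⊞ : ∀ {r k} (cs ds : V k) (vs : Vec (V r) k) → lincomb (cs ⊞ ds) vs ≡ lincomb cs vs ⊞ lincomb ds vs
lincomb-⊞ []       []       []       = sym (⊞-identityˡ 𝟘)
lincomb-⊞ (c ∷ cs) (d ∷ ds) (v ∷ vs) =
  trans (cong₂ _⊞_ (·-distribʳ v c d) (lincomb-⊞ cs ds vs))
        (⊞-interchange (c · v) (d · v) (lincomb cs vs) (lincomb ds vs))

lincomb-· : ∀ {r k} e (cs : V k) (vs : Vec (V r) k) → lincomb (e · cs) vs ≡ e · lincomb cs vs
lincomb-· e []       []       = sym (·-𝟘 e)
lincomb-· e (c ∷ cs) (v ∷ vs) =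
  trans (cong₂ _⊞_ (·-assoc e c v) (lincomb-· e cs vs)) (sym (·-distribˡ e (c · v) (lincomb cs vs)))

lincomb-𝟘 : ∀ {r k} (vs : Vec (V r) k) → lincomb 𝟘 vs ≡ 𝟘
lincomb-𝟘 []       = refl
lincomb-𝟘 (v ∷ vs) = trans (cong₂ _⊞_ (·-zeroˡ v) (lincomb-𝟘 vs)) (⊞-identityˡ 𝟘)

lincomb-∷ : ∀ {r k} (f : V r → F) (cs : V k) (us : Vec (V r) k) →
            lincomb cs (map (λ u → f u ∷ u) us) ≡ dot cs (map f us) ∷ lincomb cs us
lincomb-∷ f []       []       = refl
lincomb-∷ f (c ∷ cs) (u ∷ us) = cong (c · (f u ∷ u) ⊞_) (lincomb-∷ f cs us)

lincomb-0∷ : ∀ {r k} (cs : V k) (us : Vec (V r) k) → lincomb cs (map (0F ∷_) us) ≡ 0F ∷ lincomb cs us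
lincomb-0∷ cs us = trans (lincomb-∷ (const 0F) cs us) (cong (_∷ lincomb cs us) (zeros cs us))
  where
  zeros : ∀ {r k} (cs : V k) (us : Vec (V r) k) → dot cs (map (const 0F) us) ≡ 0F
  zeros []       []       = refl
  zeros (c ∷ cs) (_ ∷ us) = trans (cong₂ _⊕_ (⊗-zeroʳ c) (zeros cs us)) refl

dot-lincomb-zero : ∀ {r k} h (cs : V k) {vs : Vec (V r) k} →
                   VecAll.All (λ v → dot h v ≡ 0F) vs → dot h (lincomb cs vs) ≡ 0F
dot-lincomb-zero h []       []       = dot-𝟘ʳ h
dot-lincomb-zero h (c ∷ cs) {v ∷ vs} (p ∷ ps) = begin
  dot h (c · v ⊞ lincomb cs vs)            ≡⟨ dot-⊞ʳ h (c · v) (lincomb cs vs) ⟩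
  dot h (c · v) ⊕ dot h (lincomb cs vs)    ≡⟨ cong₂ _⊕_ (trans (dot-·ʳ c h v) (trans (cong (c ⊗_) p) (⊗-zeroʳ c))) (dot-lincomb-zero h cs ps) ⟩
  0F                                       ∎
  where open ≡-Reasoning

units : ∀ {n} → Vec (V n) n
units {zero}  = []
units {suc n} = (1F ∷ 𝟘) ∷ map (0F ∷_) units

lincomb-e₀ : ∀ {r k} c (cs : V k) (us : Vec (V r) k) →
             lincomb (c ∷ cs) ((1F ∷ 𝟘) ∷ map (0F ∷_) us) ≡ c ∷ lincomb cs us
lincomb-e₀ c cs us = trans (cong (c · (1F ∷ 𝟘) ⊞_) (lincomb-0∷ cs us))
  (cong₂ _∷_ (trans (⊕-identityʳ (c ⊗ 1F)) (trans (⊗-comm c 1F) (⊗-identityˡ c)))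
             (trans (cong (_⊞ lincomb cs us) (·-𝟘 c)) (⊞-identityˡ (lincomb cs us))))

lincomb-units : ∀ {n} (cs : V n) → lincomb cs units ≡ cs
lincomb-units []       = refl
lincomb-units (c ∷ cs) = trans (lincomb-e₀ c cs units) (cong (c ∷_) (lincomb-units cs))

ker : ∀ {r} → V r → Subspace 𝔽₃ r
ker h .Mem v      = dot h v ≡ 0F
ker h .mem? v     = dot h v ≟F 0F
ker h .0-closed   = dot-𝟘ʳ h
ker h .+-closed {u} {v} p q = trans (dot-⊞ʳ h u v) (cong₂ _⊕_ p q)
ker h .·-closed c {v} p     = trans (dot-·ʳ c h v) (trans (cong (c ⊗_) p) (⊗-zeroʳ c))

private
  cancel-head : ∀ x → x ≢ 0F → ∀ y z D → x ⊗ y ⊕ D ≡ 0F → x ⊗ z ⊕ D ≡ 0F → y ≡ z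
  cancel-head = from-yes (Fin.all? λ x → ¬? (x Fin.≟ 0F) →-dec Fin.all? λ y → Fin.all? λ z → Fin.all? λ D →
    (x ⊗ y ⊕ D Fin.≟ 0F) →-dec ((x ⊗ z ⊕ D Fin.≟ 0F) →-dec (y Fin.≟ z)))

  solved-head : ∀ x → x ≢ 0F → ∀ D → x ⊗ ⊖ (x ⊗ D) ⊕ D ≡ 0F
  solved-head = from-yes (Fin.all? λ x → ¬? (x Fin.≟ 0F) →-dec Fin.all? λ D → x ⊗ ⊖ (x ⊗ D) ⊕ D Fin.≟ 0F)

-- If the first entry of `h` is nonzero, the kernel is the graph of a linear map on the other
-- coordinates; otherwise it splits off the first unit vector.
ker-dimension : ∀ {r} (h : V (suc r)) → h ≢ 𝟘 → HasDimension 𝔽₃ (ker h) r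
ker-dimension (x ∷ h) h≢0 with x ≟F 0F
... | no x≢0 = vs , record { members = mem ; independent = ind ; spanning = span }
  where
  f = λ u → ⊖ (x ⊗ dot h u)
  vs = map (λ u → f u ∷ u) units
  mem : VecAll.All (λ v → dot (x ∷ h) v ≡ 0F) vs
  mem = VecAllₚ.map⁺ (VecAll.universal (λ u → solved-head x x≢0 (dot h u)) units)
  ind : ∀ cs → lincomb cs vs ≡ 𝟘 → cs ≡ 𝟘
  ind cs eq = trans (sym (lincomb-units cs)) (cong tail (trans (sym (lincomb-∷ f cs units)) eq))
  span : ∀ w → dot (x ∷ h) w ≡ 0F → ∃ λ cs → lincomb cs vs ≡ w
  span (y ∷ w) p = w , trans lc (cong (_∷ w) (cancel-head x x≢0 (dot w (map f units)) y (dot h w) q p))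
    where
    lc : lincomb w vs ≡ dot w (map f units) ∷ w
    lc = trans (lincomb-∷ f w units) (cong (dot w (map f units) ∷_) (lincomb-units w))
    q : x ⊗ dot w (map f units) ⊕ dot h w ≡ 0F
    q = subst (λ u → dot (x ∷ h) u ≡ 0F) lc (dot-lincomb-zero (x ∷ h) w mem)
ker-dimension {zero}  (.0F ∷ []) h≢0 | yes refl = ⊥-elim (h≢0 refl)
ker-dimension {suc r} (.0F ∷ h) h≢0 | yes refl with ker-dimension h (λ { refl → h≢0 refl })
... | us , b = (1F ∷ 𝟘) ∷ map (0F ∷_) us , record { members = mem ; independent = ind ; spanning = span }
  where
  module B = IsBasis b
  mem : VecAll.All (λ v → dot (0F ∷ h) v ≡ 0F) ((1F ∷ 𝟘) ∷ map (0F ∷_) us)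
  mem = trans (⊕-identityˡ (dot h 𝟘)) (dot-𝟘ʳ h)
      ∷ VecAllₚ.map⁺ (VecAll.map (λ {u} p → trans (⊕-identityˡ (dot h u)) p) B.members)
  ind : ∀ cs → lincomb cs ((1F ∷ 𝟘) ∷ map (0F ∷_) us) ≡ 𝟘 → cs ≡ 𝟘
  ind (c ∷ cs) eq with trans (sym (lincomb-e₀ c cs us)) eq
  ... | eq' = cong₂ _∷_ (cong head eq') (B.independent cs (cong tail eq'))
  span : ∀ w → dot (0F ∷ h) w ≡ 0F → ∃ λ cs → lincomb cs ((1F ∷ 𝟘) ∷ map (0F ∷_) us) ≡ w
  span (y ∷ w) p with B.spanning w (trans (sym (trans (cong (_⊕ dot h w) (⊗-zeroˡ y)) (⊕-identityˡ (dot h w)))) p)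
  ... | cs , eq = y ∷ cs , trans (lincomb-e₀ y cs us) (cong (y ∷_) eq)

ker-hyperplane : ∀ {r} (h : V (suc r)) → h ≢ 𝟘 → IsHyperplane 𝔽₃ (ker h)
ker-hyperplane h h≢0 = _ , refl , ker-dimension h h≢0

-- The d basis vectors leave a nonzero functional in dimension d + 1. An inclusion suffices for
-- upper bounds: the kernel contains every subspace that `H` contains.
hyperplane⊆ker : ∀ {r} (H : Subspace 𝔽₃ r) → IsHyperplane 𝔽₃ H → ∃ λ h → h ≢ 𝟘 × (∀ v → Mem H v → dot h v ≡ 0F)
hyperplane⊆ker H (d , refl , vs , b) with orthogonal-exists (toList vs) (s≤s (ℕ.≤-reflexive (Vecₚ.length-toList vs)))
... | h , h≢0 , orth = h , h≢0 , λ v v∈H → let cs , eq = IsBasis.spanning b v v∈H in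
  subst (λ u → dot h u ≡ 0F) eq (dot-lincomb-zero h cs (fromToList vs orth))
  where
  fromToList : ∀ {k} (us : Vec (V _) k) → All.All (λ v → dot h v ≡ 0F) (toList us) → VecAll.All (λ v → dot h v ≡ 0F) us
  fromToList []       _                    = []
  fromToList (_ ∷ us) (p All.∷ ps) = p ∷ fromToList us ps

record Bounded {r} (s : ℕ) (L : List (Pair r)) : Set where
  constructor bounded
  field bound : ∀ h → h ≢ 𝟘 → killedIn L h ≤ s
open Bounded public

-- Points are represented by a repeated vector and the zero space by zero vectors, so that subspaces
-- of every dimension up to two become pairs and are treated alike.
generators : ∀ {r} (W : Subspace 𝔽₃ r) → HasDimensionAtMost 𝔽₃ W 2 →
             ∃ λ (p : Pair r) → ∀ h → Killed h p → ∀ v → Mem W v → dot h v ≡ 0F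
generators W (0 , _ , [] , b) = (𝟘 , 𝟘) , λ h _ v v∈W → contained h v v∈W []
  where
  contained : ∀ h v → Mem W v → VecAll.All (λ u → dot h u ≡ 0F) [] → dot h v ≡ 0F
  contained h v v∈W ps = let cs , eq = IsBasis.spanning b v v∈W in subst (λ u → dot h u ≡ 0F) eq (dot-lincomb-zero h cs ps)
generators W (1 , _ , a ∷ [] , b) = (a , a) , λ { h (p , _) v v∈W →
  let cs , eq = IsBasis.spanning b v v∈W in subst (λ u → dot h u ≡ 0F) eq (dot-lincomb-zero h cs (p ∷ [])) }
generators W (2 , _ , a₁ ∷ a₂ ∷ [] , b) = (a₁ , a₂) , λ { h (p , q) v v∈W →
  let cs , eq = IsBasis.spanning b v v∈W in subst (λ u → dot h u ≡ 0F) eq (dot-lincomb-zero h cs (p ∷ q ∷ [])) }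
generators W (suc (suc (suc _)) , s≤s (s≤s ()) , _)

count-∷ : ∀ {a p n} {A : Set a} {P : A → Set p} (P? : ∀ x → Dec (P x)) x (xs : Vec A n) →
          count P? (x ∷ xs) ≡ χ (P? x) + count P? xs
count-∷ P? x xs with does (P? x)
... | true  = refl
... | false = refl

system⇒pairs : ∀ {n s r} → ProjectiveSystemExists 𝔽₃ 2 n (suc r) s →
               ∃ λ (L : List (Pair (suc r))) → List.length L ≡ n × Bounded s L
system⇒pairs {s = s} {r} (Ws , sys) = L , len Ws S.dimension ,
  bounded λ h h≢0 → ℕ.≤-trans (below Ws S.dimension h) (S.at-most (ker h) (ker-hyperplane h h≢0))
  where
  module S = IsProjectiveSystem sys
  pairs : ∀ {n} (Ws : Vec (Subspace 𝔽₃ (suc r)) n) → VecAll.All (λ W → HasDimensionAtMost 𝔽₃ W 2) Ws → List (Pair (suc r))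
  pairs []       []       = []
  pairs (W ∷ Ws) (d ∷ ds) = proj₁ (generators W d) ∷ pairs Ws ds
  L = pairs Ws S.dimension
  len : ∀ {n} (Ws : Vec (Subspace 𝔽₃ (suc r)) n) ds → List.length (pairs Ws ds) ≡ n
  len []       []       = refl
  len (W ∷ Ws) (d ∷ ds) = cong suc (len Ws ds)
  below : ∀ {n} (Ws : Vec (Subspace 𝔽₃ (suc r)) n) ds h → killedIn (pairs Ws ds) h ≤ numberContainedIn 𝔽₃ (ker h) Ws
  below []       []       h = z≤n
  below (W ∷ Ws) (d ∷ ds) h = subst (killedIn (pairs (W ∷ Ws) (d ∷ ds)) h ≤_) (sym (count-∷ (λ U → _⊆?_ 𝔽₃ U (ker h)) W Ws))
    (ℕ.+-mono-≤ (χ-mono (killed? h (proj₁ (generators W d))) (_⊆?_ 𝔽₃ W (ker h)) (proj₂ (generators W d) h)) (below Ws ds h))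

∃-vec? : ∀ {p} n {P : V n → Set p} → (∀ v → Dec (P v)) → Dec (∃ P)
∃-vec? zero    P? = map′ (λ p → [] , p) (λ { ([] , p) → p }) (P? [])
∃-vec? (suc n) P? = map′ (λ { (x , v , p) → x ∷ v , p }) (λ { (x ∷ v , p) → x , v , p })
                         (Fin.any? λ x → ∃-vec? n λ v → P? (x ∷ v))

∷₂ : ∀ {r} → Pair r → Vec (V r) 2
∷₂ (a , b) = a ∷ b ∷ []

span : ∀ {r} → Pair r → Subspace 𝔽₃ r
span p .Mem v    = ∃ λ cs → lincomb cs (∷₂ p) ≡ v
span p .mem? v   = ∃-vec? 2 λ cs → lincomb cs (∷₂ p) ≟V v
span p .0-closed = 𝟘 , lincomb-𝟘 (∷₂ p)
span p .+-closed (cs , refl) (ds , refl) = cs ⊞ ds , lincomb-⊞ cs ds (∷₂ p)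
span p .·-closed c (cs , refl)           = c · cs , lincomb-· c cs (∷₂ p)

killed⇒span⊆ker : ∀ {r} h (p : Pair r) → Killed h p → ∀ v → Mem (span p) v → dot h v ≡ 0F
killed⇒span⊆ker h (a , b) (p , q) _ (cs , refl) = dot-lincomb-zero h cs (p ∷ q ∷ [])

∈span : ∀ {r} (p : Pair r) → Mem (span p) (proj₁ p) × Mem (span p) (proj₂ p)
∈span (a , b) = (1F ∷ 0F ∷ [] , l) , (0F ∷ 1F ∷ [] , r)
  where
  l : lincomb (1F ∷ 0F ∷ []) (a ∷ b ∷ []) ≡ a
  l = trans (cong₂ _⊞_ (·-identityˡ a) (trans (cong (_⊞ 𝟘) (·-zeroˡ b)) (⊞-identityʳ 𝟘))) (⊞-identityʳ a)
  r : lincomb (0F ∷ 1F ∷ []) (a ∷ b ∷ []) ≡ b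
  r = trans (cong₂ _⊞_ (·-zeroˡ a) (trans (cong (_⊞ 𝟘) (·-identityˡ b)) (⊞-identityʳ b))) (⊞-identityˡ b)

span⊆⇒killed : ∀ {r} h (p : Pair r) → (∀ v → Mem (span p) v → dot h v ≡ 0F) → Killed h p
span⊆⇒killed h p f = f _ (proj₁ (∈span p)) , f _ (proj₂ (∈span p))

Independent : ∀ {r} → Pair r → Set
Independent p = ∀ cs → lincomb cs (∷₂ p) ≡ 𝟘 → cs ≡ 𝟘

independent? : ∀ {r} (p : Pair r) → Dec (Independent p)
independent? p = all-vec? 2 λ cs → (lincomb cs (∷₂ p) ≟V 𝟘) →-dec (cs ≟V 𝟘)

pairs⇒system : ∀ {s r} (L : List (Pair (suc r))) → All.All Independent L → Bounded s L →
               (∃ λ h → h ≢ 𝟘 × killedIn L h ≡ s) → ProjectiveSystemExists 𝔽₃ 2 (List.length L) (suc r) s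
pairs⇒system {s} {r} L ind bd (h₀ , h₀≢0 , eq) = spans L , record
  { dimension = dims L ind
  ; at-most   = λ H hyp → let h , h≢0 , H⊆ = hyperplane⊆ker H hyp in
                  ℕ.≤-trans (above H h H⊆ L) (bound bd h h≢0)
  ; attained  = ker h₀ , ker-hyperplane h₀ h₀≢0 ,
                  trans (ℕ.≤-antisym (above (ker h₀) h₀ (λ _ p → p) L) (below L)) eq
  }
  where
  spans : (L : List (Pair (suc r))) → Vec (Subspace 𝔽₃ (suc r)) (List.length L)
  spans []      = []
  spans (p ∷ L) = span p ∷ spans L
  dims : ∀ L → All.All Independent L → VecAll.All (λ W → HasDimensionAtMost 𝔽₃ W 2) (spans L)
  dims []      _                = []
  dims (p ∷ L) (i All.∷ is) =
    (2 , ℕ.≤-refl , ∷₂ p , record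
      { members     = proj₁ (∈span p) ∷ proj₂ (∈span p) ∷ []
      ; independent = i
      ; spanning    = λ _ w∈ → w∈ }) ∷ dims L is
  above : ∀ H h → (∀ v → Mem H v → dot h v ≡ 0F) → ∀ L → numberContainedIn 𝔽₃ H (spans L) ≤ killedIn L h
  above H h H⊆ []      = z≤n
  above H h H⊆ (p ∷ L) = subst (_≤ killedIn (p ∷ L) h) (sym (count-∷ (λ U → _⊆?_ 𝔽₃ U H) (span p) (spans L)))
    (ℕ.+-mono-≤ (χ-mono (_⊆?_ 𝔽₃ (span p) H) (killed? h p) (λ s⊆H → span⊆⇒killed h p λ v v∈ → H⊆ v (s⊆H v v∈))) (above H h H⊆ L))
  below : ∀ L → killedIn L h₀ ≤ numberContainedIn 𝔽₃ (ker h₀) (spans L)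
  below []      = z≤n
  below (p ∷ L) = subst (killedIn (p ∷ L) h₀ ≤_) (sym (count-∷ (λ U → _⊆?_ 𝔽₃ U (ker h₀)) (span p) (spans L)))
    (ℕ.+-mono-≤ (χ-mono (killed? h₀ p) (_⊆?_ 𝔽₃ (span p) (ker h₀)) (killed⇒span⊆ker h₀ p)) (below L))

-- The Griesmer bound

⌈_/3⌉ : ℕ → ℕ
⌈ 0 /3⌉ = 0
⌈ 1 /3⌉ = 1
⌈ 2 /3⌉ = 1
⌈ suc (suc (suc n)) /3⌉ = suc ⌈ n /3⌉

⌈/3⌉-mono : ∀ {m n} → m ≤ n → ⌈ m /3⌉ ≤ ⌈ n /3⌉
⌈/3⌉-mono {0} _ = z≤n
⌈/3⌉-mono {1} {1} _ = ℕ.≤-refl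
⌈/3⌉-mono {1} {2} _ = ℕ.≤-refl
⌈/3⌉-mono {1} {suc (suc (suc n))} _ = s≤s z≤n
⌈/3⌉-mono {2} {1} (s≤s ())
⌈/3⌉-mono {2} {2} _ = ℕ.≤-refl
⌈/3⌉-mono {2} {suc (suc (suc n))} _ = s≤s z≤n
⌈/3⌉-mono {suc (suc (suc m))} {suc (suc (suc n))} (s≤s (s≤s (s≤s p))) = s≤s (⌈/3⌉-mono p)

⌈3*m+n/3⌉ : ∀ m n → ⌈ 3 * m + n /3⌉ ≡ m + ⌈ n /3⌉
⌈3*m+n/3⌉ zero    n = refl
⌈3*m+n/3⌉ (suc m) n = trans (cong (λ k → ⌈ k + n /3⌉) (ℕ.*-suc 3 m)) (cong suc (⌈3*m+n/3⌉ m n))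

⌈3*m/3⌉ : ∀ m → ⌈ 3 * m /3⌉ ≡ m
⌈3*m/3⌉ m = trans (cong ⌈_/3⌉ (sym (ℕ.+-identityʳ (3 * m)))) (trans (⌈3*m+n/3⌉ m 0) (ℕ.+-identityʳ m))

-- Iterated ceilings of thirds are the ceilings of d / 3^i, so this is the usual Griesmer sum over i
-- < k.
griesmer : ℕ → ℕ → ℕ
griesmer zero    d = 0
griesmer (suc k) d = d + griesmer k ⌈ d /3⌉

griesmer-mono : ∀ k {d e} → d ≤ e → griesmer k d ≤ griesmer k e
griesmer-mono zero    p = z≤n
griesmer-mono (suc k) p = ℕ.+-mono-≤ p (griesmer-mono k (⌈/3⌉-mono p))

nonzero? : ∀ x → Dec (x ≢ 0F)
nonzero? x = ¬? (x ≟F 0F)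

weight : ∀ {k} → List (V k) → V k → ℕ
weight C h = ∑ C λ v → χ (nonzero? (dot h v))

zeroColumns : ∀ {k} → List (V k) → V k → List (V k)
zeroColumns C h = filter (λ v → dot h v ≟F 0F) C

length-weight : ∀ {k} (C : List (V k)) h → length C ≡ weight C h + length (zeroColumns C h)
length-weight []      h = refl
length-weight (v ∷ C) h with dot h v ≟F 0F
... | yes _ = trans (cong suc (length-weight C h)) (sym (ℕ.+-suc (weight C h) _))
... | no  _ = cong suc (length-weight C h)

minimal : ∀ {k} (f : V k → ℕ) n h → h ≢ 𝟘 → f h ≤ n → ∃ λ m → m ≢ 𝟘 × (∀ h' → h' ≢ 𝟘 → f m ≤ f h')
minimal {k} f n h h≢0 fh≤n with ∃-vec? k (λ h' → ¬? (h' ≟V 𝟘) ×-dec (suc (f h') ℕ.≤? f h))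
... | no none = h , h≢0 , λ h' h'≢0 → ℕ.≮⇒≥ λ lt → none (h' , h'≢0 , lt)
minimal f zero    h h≢0 fh≤n | yes (h' , h'≢0 , lt) = contradiction (ℕ.≤-trans lt fh≤n) λ ()
minimal f (suc n) h h≢0 fh≤n | yes (h' , h'≢0 , lt) = minimal f n h' h'≢0 (s≤s⁻¹ (ℕ.≤-trans lt fh≤n))

dot-insertAt : ∀ {n} (h : V n) i (v : V (suc n)) → dot (insertAt h i 0F) v ≡ dot h (removeAt v i)
dot-insertAt h       zero    (x ∷ v)     = trans (cong (_⊕ dot h v) (⊗-zeroˡ x)) (⊕-identityˡ (dot h v))
dot-insertAt (y ∷ h) (suc i) (x ∷ v@(_ ∷ _)) = cong (y ⊗ x ⊕_) (dot-insertAt h i v)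

lookup-insertAt : ∀ {n} (h : V n) i → lookup (insertAt h i 0F) i ≡ 0F
lookup-insertAt h       zero    = refl
lookup-insertAt (y ∷ h) (suc i) = lookup-insertAt h i

insertAt-𝟘 : ∀ {n} (h : V n) i → insertAt h i 0F ≡ 𝟘 → h ≡ 𝟘
insertAt-𝟘 h       zero    refl = refl
insertAt-𝟘 (y ∷ h) (suc i) eq with insertAt-𝟘 h i (cong tail eq) | cong head eq
... | refl | refl = refl

lookup-⊞ : ∀ {n} (u v : V n) i → lookup (u ⊞ v) i ≡ lookup u i ⊕ lookup v i
lookup-⊞ (x ∷ u) (y ∷ v) zero    = refl
lookup-⊞ (x ∷ u) (y ∷ v) (suc i) = lookup-⊞ u v i

lookup-· : ∀ {n} c (v : V n) i → lookup (c · v) i ≡ c ⊗ lookup v i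
lookup-· c (y ∷ v) zero    = refl
lookup-· c (y ∷ v) (suc i) = lookup-· c v i

private
  scaled-entry : ∀ x y → x ≡ 0F → y ≢ 0F → x ⊕ 1F ⊗ y ≢ 0F × x ⊕ 2F ⊗ y ≢ 0F
  scaled-entry _ 0F _    p = ⊥-elim (p refl)
  scaled-entry _ 1F refl _ = (λ ()) , (λ ())
  scaled-entry _ 2F refl _ = (λ ()) , (λ ())

  nz : F → ℕ
  nz x = χ (nonzero? x)

  -- For y ≠ 0 exactly one of x, x + y, x + 2y vanishes.
  pencil : ∀ x y → y ≢ 0F → nz x + nz (x ⊕ 1F ⊗ y) + nz (x ⊕ 2F ⊗ y) ≡ 2
  pencil = from-yes (Fin.all? λ x → Fin.all? λ y → ¬? (y Fin.≟ 0F) →-dec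
             (nz x + nz (x ⊕ 1F ⊗ y) + nz (x ⊕ 2F ⊗ y) ℕ.≟ 2))

  pencil₀ : ∀ x → nz x + nz (x ⊕ 1F ⊗ 0F) + nz (x ⊕ 2F ⊗ 0F) ≡ 3 * nz x
  pencil₀ = from-yes (Fin.all? λ x → (nz x + nz (x ⊕ 1F ⊗ 0F) + nz (x ⊕ 2F ⊗ 0F) ℕ.≟ 3 * nz x))

  regroup₂ : ∀ a b c x y z w m → a + b + c ≡ 2 → x + y + z ≡ 2 * w + m →
             (a + x) + (b + y) + (c + z) ≡ 2 * (1 + w) + m
  regroup₂ a b c x y z w m p q = trans (shuffle a b c x y z) (trans (cong₂ _+_ p q) (arith w m))
    where
    shuffle : ∀ a b c x y z → (a + x) + (b + y) + (c + z) ≡ (a + b + c) + (x + y + z)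
    shuffle = solve-∀
    arith : ∀ w m → 2 + (2 * w + m) ≡ 2 * (1 + w) + m
    arith = solve-∀

  regroup₃ : ∀ a b c e x y z w m → a + b + c ≡ 3 * e → x + y + z ≡ 2 * w + 3 * m →
             (a + x) + (b + y) + (c + z) ≡ 2 * (0 + w) + 3 * (e + m)
  regroup₃ a b c e x y z w m p q = trans (shuffle a b c x y z) (trans (cong₂ _+_ p q) (arith e w m))
    where
    shuffle : ∀ a b c x y z → (a + x) + (b + y) + (c + z) ≡ (a + b + c) + (x + y + z)
    shuffle = solve-∀
    arith : ∀ e w m → 3 * e + (2 * w + 3 * m) ≡ 2 * (0 + w) + 3 * (e + m)
    arith = solve-∀

-- The residual code of `h`. If `h` is nonzero at `i`, each class of functionals modulo `h` has one
-- member with entry 0 at `i`, so deleting that coordinate is passing to the quotient.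
residual : ∀ {k} → List (V (suc k)) → V (suc k) → Fin (suc k) → List (V k)
residual C h i = List.map (λ v → removeAt v i) (zeroColumns C h)

-- Column by column: where `h` is nonzero, the three words run through all of 𝔽₃ and two of the
-- values are nonzero; where `h` vanishes, all three agree with `h'` on the shortened column.
residual-weight : ∀ {k} (C : List (V (suc k))) h i h' → let g = insertAt h' i 0F in
  weight C g + weight C (g ⊞ 1F · h) + weight C (g ⊞ 2F · h) ≡ 2 * weight C h + 3 * weight (residual C h i) h'
residual-weight []      h i h' = refl
residual-weight (v ∷ C) h i h'
  rewrite dot-⊞ˡ (insertAt h' i 0F) (1F · h) v | dot-⊞ˡ (insertAt h' i 0F) (2F · h) v
        | dot-·ˡ 1F h v | dot-·ˡ 2F h v
  with dot h v ≟F 0F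
... | no  p = regroup₂ (nz x) (nz (x ⊕ 1F ⊗ dot h v)) _ (weight C g) (weight C (g ⊞ 1F · h)) (weight C (g ⊞ 2F · h)) (weight C h) _
                (pencil x (dot h v) p) (residual-weight C h i h')
  where g = insertAt h' i 0F ; x = dot g v
... | yes p rewrite p | sym (dot-insertAt h' i v) =
  regroup₃ (nz x) (nz (x ⊕ 1F ⊗ 0F)) (nz (x ⊕ 2F ⊗ 0F)) (nz x) (weight C g) (weight C (g ⊞ 1F · h)) (weight C (g ⊞ 2F · h)) (weight C h) _
    (pencil₀ x) (residual-weight C h i h')
  where g = insertAt h' i 0F ; x = dot g v

-- Induction on the residual code of a word `h` of least weight w. The words g, g + h and g + 2h
-- each have weight at least w, so 3w ≤ 2w + 3m for the residual weight m, whence m ≥ w / 3.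
griesmer-bound : ∀ k (C : List (V k)) d → (∀ h → h ≢ 𝟘 → d ≤ weight C h) → griesmer k d ≤ length C
griesmer-bound zero    C d min = z≤n
griesmer-bound (suc k) C d min with minimal (weight C) _ (unit zero) (λ ()) ℕ.≤-refl
... | h , h≢0 , least with ≢𝟘⇒nonzero-entry h h≢0
...   | i , hᵢ≢0 = begin
  d + griesmer k ⌈ d /3⌉            ≤⟨ ℕ.+-mono-≤ (min h h≢0) (griesmer-mono k (⌈/3⌉-mono (min h h≢0))) ⟩
  w + griesmer k ⌈ w /3⌉            ≤⟨ ℕ.+-monoʳ-≤ w (griesmer-bound k (residual C h i) ⌈ w /3⌉ residual-min) ⟩
  w + length (residual C h i)       ≡⟨ cong (w +_) (Listₚ.length-map _ (zeroColumns C h)) ⟩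
  w + length (zeroColumns C h)      ≡⟨ length-weight C h ⟨
  length C                          ∎
  where
  open ℕ.≤-Reasoning
  w = weight C h
  residual-min : ∀ h' → h' ≢ 𝟘 → ⌈ w /3⌉ ≤ weight (residual C h i) h'
  residual-min h' h'≢0 = subst (⌈ w /3⌉ ≤_) (⌈3*m/3⌉ m) (⌈/3⌉-mono (ℕ.+-cancelˡ-≤ (2 * w) w (3 * m) (begin
    2 * w + w                                                   ≡⟨ shuffle w ⟩
    w + w + w                                                   ≤⟨ ℕ.+-mono-≤ (ℕ.+-mono-≤ (least g g≢0) (least _ g₁≢0)) (least _ g₂≢0) ⟩
    weight C g + weight C (g ⊞ 1F · h) + weight C (g ⊞ 2F · h)  ≡⟨ residual-weight C h i h' ⟩
    2 * w + 3 * m                                               ∎)))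
    where
    m = weight (residual C h i) h'
    g = insertAt h' i 0F
    shuffle : ∀ w → 2 * w + w ≡ w + w + w
    shuffle = solve-∀
    g≢0 : g ≢ 𝟘
    g≢0 eq = h'≢0 (insertAt-𝟘 h' i eq)
    shifted = scaled-entry _ _ (lookup-insertAt h' i) hᵢ≢0
    entry : ∀ c → lookup (g ⊞ c · h) i ≡ lookup g i ⊕ c ⊗ lookup h i
    entry c = trans (lookup-⊞ g (c · h) i) (cong (lookup g i ⊕_) (lookup-· c h i))
    g₁≢0 : g ⊞ 1F · h ≢ 𝟘
    g₁≢0 = entry⇒≢𝟘 _ i λ eq → proj₁ shifted (trans (sym (entry 1F)) eq)
    g₂≢0 : g ⊞ 2F · h ≢ 𝟘
    g₂≢0 = entry⇒≢𝟘 _ i λ eq → proj₂ shifted (trans (sym (entry 2F)) eq)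

-- The points of the subspaces, as columns of a generator matrix; each line of PG(4,3) has four.
columns : ∀ {r} → List (Pair r) → List (V r)
columns []            = []
columns ((a , b) ∷ L) = a ∷ b ∷ (a ⊞ b) ∷ (a ⊞ 2F · b) ∷ columns L

private
  four : ∀ x y → nz x + (nz y + (nz (x ⊕ y) + nz (x ⊕ 2F ⊗ y))) + 3 * χ ((x ≟F 0F) ×-dec (y ≟F 0F)) ≡ 3
  four = from-yes (Fin.all? λ x → Fin.all? λ y →
    (nz x + (nz y + (nz (x ⊕ y) + nz (x ⊕ 2F ⊗ y))) + 3 * χ ((x ≟F 0F) ×-dec (y ≟F 0F)) ℕ.≟ 3))

-- A functional that does not kill the pair vanishes on exactly one of its four columns. This holds
-- for a dependent pair such as (a, a) as well, one of whose columns is zero.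
columns-weight : ∀ {r} (L : List (Pair r)) h → weight (columns L) h + 3 * killedIn L h ≡ 3 * length L
columns-weight []            h = refl
columns-weight ((a , b) ∷ L) h
  rewrite dot-⊞ʳ h a b | dot-⊞ʳ h a (2F · b) | dot-·ʳ 2F h b =
  trans (shuffle (nz x) (nz y) (nz (x ⊕ y)) (nz (x ⊕ 2F ⊗ y)) (weight (columns L) h) (κ h (a , b)) (killedIn L h))
        (trans (cong₂ _+_ (four x y) (columns-weight L h)) (sym (ℕ.*-suc 3 (length L))))
  where
  x = dot h a
  y = dot h b
  shuffle : ∀ p q r s w k m → p + (q + (r + (s + w))) + 3 * (k + m) ≡ (p + (q + (r + s)) + 3 * k) + (w + 3 * m)
  shuffle = solve-∀

length-columns : ∀ {r} (L : List (Pair r)) → length (columns L) ≡ 4 * length L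
length-columns []      = refl
length-columns (p ∷ L) = trans (cong (4 +_) (length-columns L)) (sym (ℕ.*-suc 4 (length L)))

system-griesmer : ∀ {r s} (L : List (Pair r)) → Bounded s L → griesmer r (3 * (length L ∸ s)) ≤ 4 * length L
system-griesmer {r} {s} L bd = subst (griesmer r (3 * (length L ∸ s)) ≤_) (length-columns L)
  (griesmer-bound r (columns L) _ λ h h≢0 → ℕ.+-cancelʳ-≤ (3 * killedIn L h) _ _ (begin
    3 * (length L ∸ s) + 3 * killedIn L h   ≡⟨ ℕ.*-distribˡ-+ 3 (length L ∸ s) (killedIn L h) ⟨
    3 * (length L ∸ s + killedIn L h)       ≤⟨ ℕ.*-monoʳ-≤ 3 (enough h (bound bd h h≢0)) ⟩
    3 * length L                            ≡⟨ columns-weight L h ⟨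
    weight (columns L) h + 3 * killedIn L h ∎))
  where
  open ℕ.≤-Reasoning
  killed≤length : ∀ (L : List (Pair r)) h → killedIn L h ≤ length L
  killed≤length []      h = z≤n
  killed≤length (p ∷ L) h = ℕ.+-mono-≤ (χ≤1 (killed? h p)) (killed≤length L h)
    where
    χ≤1 : ∀ {A : Set} (d : Dec A) → χ d ≤ 1
    χ≤1 (yes _) = ℕ.≤-refl
    χ≤1 (no _)  = z≤n
  enough : ∀ h → killedIn L h ≤ s → length L ∸ s + killedIn L h ≤ length L
  enough h k≤s = ℕ.≤-trans (ℕ.+-monoˡ-≤ (killedIn L h) (ℕ.∸-monoʳ-≤ (length L) k≤s))
                           (ℕ.≤-reflexive (ℕ.m∸n+n≡m (killed≤length L h)))

-- s = 13t + s₀ and N = 121t + N₀, where n = N + 1 subspaces would violate the Griesmer bound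
-- already for t = 0.
griesmer-upper : ∀ t s₀ N₀ → let D = suc N₀ ∸ s₀ in s₀ ≤ N₀ →
                 4 * s₀ < ⌈ D /3⌉ + (⌈ ⌈ D /3⌉ /3⌉ + ⌈ ⌈ ⌈ D /3⌉ /3⌉ /3⌉) →
                 ∀ (L : List (Pair 5)) → Bounded (13 * t + s₀) L → length L ≤ 121 * t + N₀
griesmer-upper t s₀ N₀ s₀≤N₀ violated L bd with length L ℕ.≤? 121 * t + N₀
... | yes p = p
... | no ¬p = contradiction (begin-strict
  4 * s₀ + 52 * t                                               <⟨ ℕ.+-monoˡ-< (52 * t) violated ⟩
  (c₁ + (c₂ + c₃)) + 52 * t                                     ≡⟨ collect t c₁ c₂ c₃ ⟩
  (36 * t + c₁) + ((12 * t + c₂) + (4 * t + c₃))                ≡⟨ cong₂ _+_ e₁ (cong₂ _+_ e₂ e₃) ⟨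
  ⌈ E /3⌉ + (⌈ ⌈ E /3⌉ /3⌉ + ⌈ ⌈ ⌈ E /3⌉ /3⌉ /3⌉)              ≤⟨ ceil-mono ⟩
  ⌈ m /3⌉ + (⌈ ⌈ m /3⌉ /3⌉ + ⌈ ⌈ ⌈ m /3⌉ /3⌉ /3⌉)              ≤⟨ ℕ.+-cancelˡ-≤ (4 * m) _ _ total ⟩
  4 * s                                                         ≡⟨ four-s t s₀ ⟩
  4 * s₀ + 52 * t                                               ∎) (ℕ.<-irrefl refl)
  where
  open ℕ.≤-Reasoning
  s = 13 * t + s₀
  D = suc N₀ ∸ s₀
  -- A period adds 121 - 13 = 108 = 4 · 27 to n - s, so the three ceilings grow by exactly 36 t, 12
  -- t and 4 t, in sum by 52 t = 4 · 13 t, which is what the right-hand side 4s gains.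
  E = 108 * t + D
  m = length L ∸ s
  c₁ = ⌈ D /3⌉
  c₂ = ⌈ c₁ /3⌉
  c₃ = ⌈ c₂ /3⌉
  four-s : ∀ t s₀ → 4 * (13 * t + s₀) ≡ 4 * s₀ + 52 * t
  four-s = solve-∀
  collect : ∀ t a b c → (a + (b + c)) + 52 * t ≡ (36 * t + a) + ((12 * t + b) + (4 * t + c))
  collect = solve-∀
  step : ∀ a b → 3 * a ≡ b → ∀ d → ⌈ b + d /3⌉ ≡ a + ⌈ d /3⌉
  step a _ refl d = ⌈3*m+n/3⌉ a d
  t₁ : ∀ t → 3 * (36 * t) ≡ 108 * t
  t₁ = solve-∀
  t₂ : ∀ t → 3 * (12 * t) ≡ 36 * t
  t₂ = solve-∀
  t₃ : ∀ t → 3 * (4 * t) ≡ 12 * t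
  t₃ = solve-∀
  e₁ : ⌈ E /3⌉ ≡ 36 * t + c₁
  e₁ = step (36 * t) (108 * t) (t₁ t) D
  e₂ : ⌈ ⌈ E /3⌉ /3⌉ ≡ 12 * t + c₂
  e₂ = trans (cong ⌈_/3⌉ e₁) (step (12 * t) (36 * t) (t₂ t) c₁)
  e₃ : ⌈ ⌈ ⌈ E /3⌉ /3⌉ /3⌉ ≡ 4 * t + c₃
  e₃ = trans (cong ⌈_/3⌉ e₂) (step (4 * t) (12 * t) (t₃ t) c₂)
  E+s : E + s ≡ suc (121 * t + N₀)
  E+s = trans (rearrange t D s₀) (trans (cong (121 * t +_) (ℕ.m∸n+n≡m (ℕ.m≤n⇒m≤1+n s₀≤N₀))) (ℕ.+-suc (121 * t) N₀))
    where
    rearrange : ∀ t d s → (108 * t + d) + (13 * t + s) ≡ 121 * t + (d + s)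
    rearrange = solve-∀
  E+s≤length : E + s ≤ length L
  E+s≤length = subst (_≤ length L) (sym E+s) (ℕ.≰⇒> ¬p)
  E≤m : E ≤ m
  E≤m = subst (_≤ m) (ℕ.m+n∸n≡m E s) (ℕ.∸-monoˡ-≤ s E+s≤length)
  ceil-mono = ℕ.+-mono-≤ (⌈/3⌉-mono E≤m) (ℕ.+-mono-≤ (⌈/3⌉-mono (⌈/3⌉-mono E≤m)) (⌈/3⌉-mono (⌈/3⌉-mono (⌈/3⌉-mono E≤m))))
  total : 4 * m + (⌈ m /3⌉ + (⌈ ⌈ m /3⌉ /3⌉ + ⌈ ⌈ ⌈ m /3⌉ /3⌉ /3⌉)) ≤ 4 * m + 4 * s
  total = begin
    4 * m + (⌈ m /3⌉ + (⌈ ⌈ m /3⌉ /3⌉ + ⌈ ⌈ ⌈ m /3⌉ /3⌉ /3⌉))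
      ≡⟨ regroup m ⌈ m /3⌉ ⌈ ⌈ m /3⌉ /3⌉ ⌈ ⌈ ⌈ m /3⌉ /3⌉ /3⌉ ⟩
    3 * m + (m + (⌈ m /3⌉ + (⌈ ⌈ m /3⌉ /3⌉ + (⌈ ⌈ ⌈ m /3⌉ /3⌉ /3⌉ + 0))))
      ≡⟨ cong (λ k → 3 * m + (k + (⌈ k /3⌉ + (⌈ ⌈ k /3⌉ /3⌉ + (⌈ ⌈ ⌈ k /3⌉ /3⌉ /3⌉ + 0))))) (⌈3*m/3⌉ m) ⟨
    griesmer 5 (3 * m)
      ≤⟨ system-griesmer L bd ⟩
    4 * length L
      ≡⟨ cong (4 *_) (ℕ.m∸n+n≡m (ℕ.≤-trans (ℕ.m≤n+m s E) E+s≤length)) ⟨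
    4 * (m + s)
      ≡⟨ ℕ.*-distribˡ-+ 4 m s ⟩
    4 * m + 4 * s ∎
    where
    regroup : ∀ m a b c → 4 * m + (a + (b + c)) ≡ 3 * m + (m + (a + (b + (c + 0))))
    regroup = solve-∀

-- Constructions

∑-++ : ∀ {a} {A : Set a} (xs ys : List A) f → ∑ (xs ++ ys) f ≡ ∑ xs f + ∑ ys f
∑-++ []       ys f = refl
∑-++ (x ∷ xs) ys f = trans (cong (f x +_) (∑-++ xs ys f)) (sym (ℕ.+-assoc (f x) _ _))

killedIn-3+1 : ∀ (L M : List (Pair 5)) h → killedIn (L ++ L ++ L ++ M) h ≡ 3 * killedIn L h + killedIn M h
killedIn-3+1 L M h rewrite ∑-++ L (L ++ L ++ M) (κ h) | ∑-++ L (L ++ M) (κ h) | ∑-++ L M (κ h) =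
  collect (killedIn L h) (killedIn M h)
  where
  collect : ∀ a b → a + (a + (a + b)) ≡ 3 * a + b
  collect = solve-∀

killedIn-1+1+1 : ∀ (K L M : List (Pair 5)) h → killedIn ((K ++ L) ++ M) h ≡ killedIn K h + killedIn L h + killedIn M h
killedIn-1+1+1 K L M h = trans (∑-++ (K ++ L) M (κ h)) (cong (_+ killedIn M h) (∑-++ K L (κ h)))

-- Base-3 digits, least significant first; a pair of vectors is coded by its ten coordinates.
digits : ∀ k → ℕ → V k
digits zero    n = []
digits (suc k) n = digit (n % 3) ∷ digits k (n / 3)
  where
  digit : ℕ → F
  digit 0 = 0F
  digit 1 = 1F
  digit _ = 2F

decode : ℕ → Pair 5
decode n = Vec.take 5 v , Vec.drop 5 v
  where v = digits 10 n

-- The 27 lines {(u, uM)}, M in an additive code of 2 × 3 matrices with minimum rank 2: three of them lie in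
-- each hyperplane not containing the plane E : x₁ = x₂ = 0, and none in the other hyperplanes.
lifted : List (Pair 5)
lifted = List.map decode
  (246 ∷ 19974 ∷ 39675 ∷ 6888 ∷ 26616 ∷ 46317 ∷ 13530 ∷ 33258 ∷ 52959 ∷ 2460 ∷ 22188 ∷ 41808 ∷ 9102 ∷
   28830 ∷ 48450 ∷ 15744 ∷ 35472 ∷ 55092 ∷ 4674 ∷ 24321 ∷ 44022 ∷ 11316 ∷ 30963 ∷ 50664 ∷ 17958 ∷
   37605 ∷ 57306 ∷ [])

-- Ten of the 13 lines of E; a hyperplane contains either one or all lines of E.
tenLines : List (Pair 5)
tenLines = List.map decode
  (6642 ∷ 2268 ∷ 8829 ∷ 15390 ∷ 2214 ∷ 21897 ∷ 41580 ∷ 2295 ∷ 21978 ∷ 41661 ∷ [])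

-- Four translates of lifted by 2 × 3 matrices together with the lines of E have 13 lines in every
-- hyperplane; spread₁ and spread₂ are disjoint line spreads of two solids taken from this system, and a
-- spread of a solid has a line in every hyperplane.
lines₁₀₁ : List (Pair 5)
lines₁₀₁ = List.map decode
  (6642 ∷ 2268 ∷ 8829 ∷ 2214 ∷ 21897 ∷ 2295 ∷ 21978 ∷ 41661 ∷ 2376 ∷ 22059 ∷ 41742 ∷ 246 ∷ 19974 ∷
   39675 ∷ 6888 ∷ 26616 ∷ 13530 ∷ 33258 ∷ 52959 ∷ 9102 ∷ 28830 ∷ 48450 ∷ 15744 ∷ 35472 ∷ 55092 ∷
   4674 ∷ 24321 ∷ 44022 ∷ 11316 ∷ 30963 ∷ 50664 ∷ 37605 ∷ 57306 ∷ 33222 ∷ 13602 ∷ 19938 ∷ 39639 ∷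
   318 ∷ 35436 ∷ 55137 ∷ 15735 ∷ 22152 ∷ 41853 ∷ 2451 ∷ 48495 ∷ 9093 ∷ 37650 ∷ 57270 ∷ 17949 ∷ 24366 ∷
   43986 ∷ 31008 ∷ 50628 ∷ 11307 ∷ 46272 ∷ 6924 ∷ 26625 ∷ 52914 ∷ 13566 ∷ 33267 ∷ 282 ∷ 19983 ∷
   48486 ∷ 9138 ∷ 28758 ∷ 55128 ∷ 15780 ∷ 41844 ∷ 2496 ∷ 22116 ∷ 50700 ∷ 30972 ∷ 44058 ∷ 4629 ∷
   24330 ∷ 41808 ∷ 2460 ∷ 48450 ∷ 9102 ∷ 28830 ∷ 55092 ∷ 15744 ∷ 35472 ∷ 44022 ∷ 4674 ∷ 24321 ∷
   50664 ∷ 11316 ∷ 30963 ∷ 57306 ∷ 17958 ∷ 37605 ∷ 39675 ∷ 246 ∷ 19974 ∷ 46317 ∷ 6888 ∷ 26616 ∷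
   52959 ∷ 13530 ∷ 33258 ∷ [])

spread₁ : List (Pair 5)
spread₁ = List.map decode
  (15390 ∷ 2460 ∷ 46281 ∷ 37614 ∷ 41808 ∷ 26580 ∷ 17913 ∷ 22188 ∷ 6960 ∷ 57342 ∷ [])

spread₂ : List (Pair 5)
spread₂ = List.map decode
  (41580 ∷ 35400 ∷ 52923 ∷ 17958 ∷ 11271 ∷ 28794 ∷ 46317 ∷ 39630 ∷ 4665 ∷ 22188 ∷ [])

-- The number of these lines through a point is (8 − β)/3, where β is the number of hyperplanes through it
-- among the 14 that contain only one of the lines; those form a ternary [14,5] code of weights 6, 9, 12.
lines₃₄ : List (Pair 5)
lines₃₄ = List.map decode
  (27171 ∷ 33057 ∷ 52794 ∷ 20799 ∷ 41952 ∷ 40158 ∷ 33651 ∷ 21411 ∷ 33867 ∷ 47799 ∷ 39801 ∷ 15048 ∷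
   20118 ∷ 6933 ∷ 47043 ∷ 30945 ∷ 24489 ∷ 50682 ∷ 2523 ∷ 54939 ∷ 26553 ∷ 30963 ∷ 13446 ∷ 15699 ∷
   41817 ∷ 42633 ∷ 22152 ∷ 7380 ∷ 28911 ∷ 1710 ∷ 4836 ∷ 6897 ∷ 46245 ∷ 426 ∷ [])

-- Four orbits of a group of order 11.
lines₄₄ : List (Pair 5)
lines₄₄ = List.map decode
  (6642 ∷ 57315 ∷ 33078 ∷ 46881 ∷ 17958 ∷ 41817 ∷ 37425 ∷ 46281 ∷ 28740 ∷ 22269 ∷ 6852 ∷ 2997 ∷ 8460 ∷
   41979 ∷ 954 ∷ 20145 ∷ 52797 ∷ 53550 ∷ 48477 ∷ 25218 ∷ 11334 ∷ 7299 ∷ 23598 ∷ 57342 ∷ 33249 ∷ 9066 ∷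
   17886 ∷ 26625 ∷ 41184 ∷ 46206 ∷ 34677 ∷ 50709 ∷ 15609 ∷ 46935 ∷ 35319 ∷ 387 ∷ 39753 ∷ 39711 ∷
   24402 ∷ 13566 ∷ 13428 ∷ 4764 ∷ 2568 ∷ 7650 ∷ [])

lines₁₂ : List (Pair 5)
lines₁₂ = List.map decode
  (9219 ∷ 46272 ∷ 40239 ∷ 54921 ∷ 20601 ∷ 33168 ∷ 53631 ∷ 50736 ∷ 6867 ∷ 20082 ∷ 981 ∷ 54225 ∷ [])

h₀ : V 5
h₀ = 0F ∷ 0F ∷ 1F ∷ 1F ∷ 0F ∷ []

private
  -- All bounds are bundled so that the functionals are enumerated once. In `3 * a + b ≤ 10` a
  -- hyperplane not containing E contributes at most 9 + 1, and one containing E contributes 0 + 10.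
  Profile : (a b c d e f g h : ℕ) → Set
  Profile a b c d e f g h =
    a ≤ 3 × 3 * a + b ≤ 10 × c ≤ 11 × c + d ≤ 12 × c + d + e ≡ 13 × f ≤ 4 × g ≤ 5 × h ≤ 2

  profile? : ∀ a b c d e f g h → Dec (Profile a b c d e f g h)
  profile? a b c d e f g h =
    (a ℕ.≤? 3) ×-dec (3 * a + b ℕ.≤? 10) ×-dec (c ℕ.≤? 11) ×-dec (c + d ℕ.≤? 12) ×-dec
    (c + d + e ℕ.≟ 13) ×-dec (f ℕ.≤? 4) ×-dec (g ℕ.≤? 5) ×-dec (h ℕ.≤? 2)

  ProfileAt : V 5 → Set
  ProfileAt h = Profile (killedIn lifted h) (killedIn tenLines h) (killedIn lines₁₀₁ h) (killedIn spread₁ h)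
                        (killedIn spread₂ h) (killedIn lines₃₄ h) (killedIn lines₄₄ h) (killedIn lines₁₂ h)

  profile : ∀ h → h ≢ 𝟘 → ProfileAt h
  profile = from-yes (all-vec? 5 λ h → ¬? (h ≟V 𝟘) →-dec
    profile? (killedIn lifted h) (killedIn tenLines h) (killedIn lines₁₀₁ h) (killedIn spread₁ h)
             (killedIn spread₂ h) (killedIn lines₃₄ h) (killedIn lines₄₄ h) (killedIn lines₁₂ h))

-- All systems attain their bound at the common hyperplane h₀, so that they can be superposed.
record Construction (s N : ℕ) : Set where
  constructor construction
  field
    pairs    : List (Pair 5)
    size     : length pairs ≡ N
    lines    : All Independent pairs
    at-most  : ∀ h → h ≢ 𝟘 → killedIn pairs h ≤ s
    attained : killedIn pairs h₀ ≡ s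

exists : ∀ {s N} → Construction s N → ProjectiveSystemExists 𝔽₃ 2 N 5 s
exists (construction L refl ls le at) = pairs⇒system L ls (bounded le) (h₀ , (λ ()) , at)

infixl 6 _⊎ᶜ_
_⊎ᶜ_ : ∀ {s N s' N'} → Construction s N → Construction s' N' → Construction (s + s') (N + N')
construction L refl i le at ⊎ᶜ construction L' refl i' le' at' = construction (L ++ L') (Listₚ.length-++ L)
  (Allₚ.++⁺ i i')
  (λ h h≢0 → ℕ.≤-trans (ℕ.≤-reflexive (∑-++ L L' (κ h))) (ℕ.+-mono-≤ (le h h≢0) (le' h h≢0)))
  (trans (∑-++ L L' (κ h₀)) (cong₂ _+_ at at'))

private
  lines? : (L : List (Pair 5)) → Dec (All Independent L)
  lines? = All.all? independent?

c₂ : Construction 2 12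
c₂ = construction lines₁₂ refl (from-yes (lines? lines₁₂))
       (λ h p → let _ , _ , _ , _ , _ , _ , _ , q = profile h p in q) refl

c₃ : Construction 3 27
c₃ = construction lifted refl (from-yes (lines? lifted)) (λ h p → proj₁ (profile h p)) refl

c₄ : Construction 4 34
c₄ = construction lines₃₄ refl (from-yes (lines? lines₃₄))
       (λ h p → let _ , _ , _ , _ , _ , q , _ = profile h p in q) refl

c₅ : Construction 5 44
c₅ = construction lines₄₄ refl (from-yes (lines? lines₄₄))
       (λ h p → let _ , _ , _ , _ , _ , _ , q , _ = profile h p in q) refl

c₁₀ : Construction 10 91
c₁₀ = construction (lifted ++ lifted ++ lifted ++ tenLines) refl
        (from-yes (lines? (lifted ++ lifted ++ lifted ++ tenLines)))
        (λ h p → let _ , q , _ = profile h p in ℕ.≤-trans (ℕ.≤-reflexive (killedIn-3+1 lifted tenLines h)) q) refl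

c₁₁ : Construction 11 101
c₁₁ = construction lines₁₀₁ refl (from-yes (lines? lines₁₀₁))
        (λ h p → let _ , _ , q , _ = profile h p in q) refl

c₁₂ : Construction 12 111
c₁₂ = construction (lines₁₀₁ ++ spread₁) refl (from-yes (lines? (lines₁₀₁ ++ spread₁)))
        (λ h p → let _ , _ , _ , q , _ = profile h p in ℕ.≤-trans (ℕ.≤-reflexive (∑-++ lines₁₀₁ spread₁ (κ h))) q) refl

c₁₃ : Construction 13 121
c₁₃ = construction ((lines₁₀₁ ++ spread₁) ++ spread₂) refl (from-yes (lines? ((lines₁₀₁ ++ spread₁) ++ spread₂)))
        (λ h p → let _ , _ , _ , _ , q , _ = profile h p in ℕ.≤-reflexive (trans (killedIn-1+1+1 lines₁₀₁ spread₁ spread₂ h) q)) refl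

periodic : ∀ t {s N} → Construction s N → Construction (13 * t + s) (121 * t + N)
periodic zero    c = c
periodic (suc t) {s} {N} c = subst₂ Construction (shift 13 t s) (shift 121 t N) (c₁₃ ⊎ᶜ periodic t c)
  where
  shift : ∀ m t s → m + (m * t + s) ≡ m * suc t + s
  shift = solve-∀

-- Finite sums

module _ {a} {A : Set a} where

  ∑-cong : ∀ (xs : List A) {f g} → (∀ x → f x ≡ g x) → ∑ xs f ≡ ∑ xs g
  ∑-cong []       eq = refl
  ∑-cong (x ∷ xs) eq = cong₂ _+_ (eq x) (∑-cong xs eq)

  ∑-cong-∈ : ∀ (xs : List A) {f g} → (∀ {x} → x ∈ xs → f x ≡ g x) → ∑ xs f ≡ ∑ xs g
  ∑-cong-∈ []       eq = refl
  ∑-cong-∈ (x ∷ xs) eq = cong₂ _+_ (eq (here refl)) (∑-cong-∈ xs λ x∈ → eq (there x∈))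

  ∑-mono : ∀ (xs : List A) {f g} → (∀ {x} → x ∈ xs → f x ≤ g x) → ∑ xs f ≤ ∑ xs g
  ∑-mono []       le = z≤n
  ∑-mono (x ∷ xs) le = ℕ.+-mono-≤ (le (here refl)) (∑-mono xs λ x∈ → le (there x∈))

  ∑-+ : ∀ (xs : List A) f g → ∑ xs (λ x → f x + g x) ≡ ∑ xs f + ∑ xs g
  ∑-+ []       f g = refl
  ∑-+ (x ∷ xs) f g = trans (cong (f x + g x +_) (∑-+ xs f g)) (interchange (f x) (g x) (∑ xs f) (∑ xs g))

  ∑-*ˡ : ∀ c (xs : List A) f → ∑ xs (λ x → c * f x) ≡ c * ∑ xs f
  ∑-*ˡ c []       f = sym (ℕ.*-zeroʳ c)
  ∑-*ˡ c (x ∷ xs) f = trans (cong (c * f x +_) (∑-*ˡ c xs f)) (sym (ℕ.*-distribˡ-+ c (f x) (∑ xs f)))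

  ∑-*ʳ : ∀ c (xs : List A) f → ∑ xs (λ x → f x * c) ≡ ∑ xs f * c
  ∑-*ʳ c xs f = trans (∑-cong xs λ x → ℕ.*-comm (f x) c) (trans (∑-*ˡ c xs f) (ℕ.*-comm c _))

  ∑-const : ∀ c (xs : List A) → ∑ xs (λ _ → c) ≡ length xs * c
  ∑-const c []       = refl
  ∑-const c (x ∷ xs) = cong (c +_) (∑-const c xs)

  ∑-zero : ∀ (xs : List A) → ∑ xs (λ _ → 0) ≡ 0
  ∑-zero []       = refl
  ∑-zero (x ∷ xs) = ∑-zero xs

  term≤∑ : ∀ {xs : List A} {x} f → x ∈ xs → f x ≤ ∑ xs f
  term≤∑ f (here refl) = ℕ.m≤m+n _ _
  term≤∑ f (there x∈)  = ℕ.≤-trans (term≤∑ f x∈) (ℕ.m≤n+m _ _)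

  ∑<∑⇒∃ : ∀ (xs : List A) f g → ∑ xs f < ∑ xs g → ∃ λ x → x ∈ xs × f x < g x
  ∑<∑⇒∃ (x ∷ xs) f g lt with f x ℕ.<? g x
  ... | yes p = x , here refl , p
  ... | no ¬p with ∑<∑⇒∃ xs f g (ℕ.+-cancelˡ-< (f x) _ _ (ℕ.<-≤-trans lt (ℕ.+-monoˡ-≤ _ (ℕ.≮⇒≥ ¬p))))
  ...   | y , y∈ , q = y , there y∈ , q

  ∑≥1⇒∃ : ∀ (xs : List A) f → 1 ≤ ∑ xs f → ∃ λ x → x ∈ xs × 1 ≤ f x
  ∑≥1⇒∃ xs f le = ∑<∑⇒∃ xs (λ _ → 0) f (subst (_< ∑ xs f) (sym (∑-zero xs)) le)

  ∑-squeeze : ∀ (xs : List A) {f g} → (∀ {x} → x ∈ xs → f x ≤ g x) → ∑ xs g ≤ ∑ xs f → ∀ {x} → x ∈ xs → f x ≡ g x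
  ∑-squeeze xs {f} {g} le ge {x} x∈ with f x ℕ.<? g x
  ... | no ¬p = ℕ.≤-antisym (le x∈) (ℕ.≮⇒≥ ¬p)
  ... | yes p = contradiction (ℕ.<-≤-trans (strict xs le x∈ p) ge) (ℕ.<-irrefl refl)
    where
    strict : ∀ (xs : List A) → (∀ {x} → x ∈ xs → f x ≤ g x) → ∀ {x} → x ∈ xs → f x < g x → ∑ xs f < ∑ xs g
    strict (_ ∷ xs) le (here refl) p = ℕ.+-mono-<-≤ p (∑-mono xs λ x∈ → le (there x∈))
    strict (_ ∷ xs) le (there x∈)  p = ℕ.+-mono-≤-< (le (here refl)) (strict xs (λ x∈ → le (there x∈)) x∈ p)

∑-map : ∀ {a b} {A : Set a} {B : Set b} (φ : A → B) (xs : List A) f → ∑ (List.map φ xs) f ≡ ∑ xs (λ x → f (φ x))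
∑-map φ []       f = refl
∑-map φ (x ∷ xs) f = cong (f (φ x) +_) (∑-map φ xs f)

∑-swap : ∀ {a b} {A : Set a} {B : Set b} (xs : List A) (ys : List B) (f : A → B → ℕ) →
         ∑ xs (λ x → ∑ ys (f x)) ≡ ∑ ys (λ y → ∑ xs (λ x → f x y))
∑-swap []       ys f = sym (∑-zero ys)
∑-swap (x ∷ xs) ys f = trans (cong (∑ ys (f x) +_) (∑-swap xs ys f)) (sym (∑-+ ys (f x) (λ y → ∑ xs (λ x → f x y))))

χ-yes : ∀ {a} {A : Set a} (d : Dec A) → A → χ d ≡ 1
χ-yes (yes _) _ = refl
χ-yes (no ¬a) a = contradiction a ¬a

χ-no : ∀ {a} {A : Set a} (d : Dec A) → ¬ A → χ d ≡ 0
χ-no (yes a) ¬a = contradiction a ¬a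
χ-no (no _)  _  = refl

χ≥1 : ∀ {a} {A : Set a} (d : Dec A) → 1 ≤ χ d → A
χ≥1 (yes a) _ = a

χ≤1 : ∀ {a} {A : Set a} (d : Dec A) → χ d ≤ 1
χ≤1 (yes _) = ℕ.≤-refl
χ≤1 (no _)  = z≤n

χ-cong : ∀ {a b} {A : Set a} {B : Set b} (A? : Dec A) (B? : Dec B) → (A → B) → (B → A) → χ A? ≡ χ B?
χ-cong A? B? f g = ℕ.≤-antisym (χ-mono A? B? f) (χ-mono B? A? g)

module Indicator {a} {A : Set a} (_≟_ : (x y : A) → Dec (x ≡ y)) where

  Once : List A → A → Set
  Once xs x = ∑ xs (λ y → χ (x ≟ y)) ≡ 1

  ∑-pick : ∀ xs x (f : A → ℕ) → Once xs x → ∑ xs (λ y → χ (x ≟ y) * f y) ≡ f x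
  ∑-pick xs x f once = trans (∑-cong xs replace) (trans (∑-*ʳ (f x) xs _) (trans (cong (_* f x) once) (ℕ.*-identityˡ (f x))))
    where
    replace : ∀ y → χ (x ≟ y) * f y ≡ χ (x ≟ y) * f x
    replace y with x ≟ y
    ... | yes refl = refl
    ... | no _     = refl

  once⇒∈ : ∀ xs x → Once xs x → x ∈ xs
  once⇒∈ xs x once with ∑≥1⇒∃ xs _ (ℕ.≤-reflexive (sym once))
  ... | y , y∈ , p = subst (_∈ xs) (sym (χ≥1 (x ≟ y) p)) y∈

  -- The double sum of `χ (x ≟ y) * f y` collapses along either list; this takes the place of a
  -- permutation between the two enumerations.
  ∑-reindex : ∀ xs ys (f : A → ℕ) → (∀ x → Once xs x) → (∀ x → Once ys x) → ∑ xs f ≡ ∑ ys f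
  ∑-reindex xs ys f onceˣ onceʸ = begin
    ∑ xs f                                              ≡⟨ ∑-cong xs (λ x → sym (∑-pick ys x f (onceʸ x))) ⟩
    ∑ xs (λ x → ∑ ys λ y → χ (x ≟ y) * f y)             ≡⟨ ∑-swap xs ys _ ⟩
    ∑ ys (λ y → ∑ xs λ x → χ (x ≟ y) * f y)             ≡⟨ ∑-cong ys (λ y → ∑-*ʳ (f y) xs _) ⟩
    ∑ ys (λ y → ∑ xs (λ x → χ (x ≟ y)) * f y)           ≡⟨ ∑-cong ys (λ y → cong (_* f y) (trans (∑-cong xs λ x → χ-cong (x ≟ y) (y ≟ x) sym sym) (onceˣ y))) ⟩
    ∑ ys (λ y → 1 * f y)                                ≡⟨ ∑-cong ys (λ y → ℕ.*-identityˡ (f y)) ⟩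
    ∑ ys f                                              ∎
    where open ≡-Reasoning

-- A verified exhaustive search

-- The points of PG(2,3) other than `e₃`. The four directions of the plane w₃ = 0 come first,
-- followed by two that complete the plane of (1, 1, 0) and `e₃`, so that plane checks become
-- decidable early.
dir : Fin 12 → V 3
dir = lookup
  ( (1F ∷ 0F ∷ 0F ∷ []) ∷ (0F ∷ 1F ∷ 0F ∷ []) ∷ (1F ∷ 2F ∷ 0F ∷ []) ∷ (1F ∷ 1F ∷ 0F ∷ [])
  ∷ (1F ∷ 1F ∷ 2F ∷ []) ∷ (1F ∷ 1F ∷ 1F ∷ []) ∷ (1F ∷ 2F ∷ 2F ∷ []) ∷ (1F ∷ 0F ∷ 2F ∷ [])
  ∷ (0F ∷ 1F ∷ 1F ∷ []) ∷ (1F ∷ 2F ∷ 1F ∷ []) ∷ (1F ∷ 0F ∷ 1F ∷ []) ∷ (0F ∷ 1F ∷ 2F ∷ []) ∷ [])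

e₃ : V 3
e₃ = 0F ∷ 0F ∷ 1F ∷ []

fins : List (Fin 12)
fins = allFin 12

-- One vector for each of the 13 points of PG(2,3); the same list serves dually as the list of plane
-- normals.
directions : List (V 3)
directions = e₃ ∷ List.map dir fins

-- Table lookup evaluates much faster than arithmetic modulo 3.
infixl 6 _⊕′_ _⊞′_
_⊕′_ : F → F → F
0F ⊕′ y  = y
1F ⊕′ 0F = 1F
1F ⊕′ 1F = 2F
1F ⊕′ 2F = 0F
2F ⊕′ 0F = 2F
2F ⊕′ 1F = 0F
2F ⊕′ 2F = 1F

infixl 7 _⊗′_
_⊗′_ : F → F → F
0F ⊗′ y  = 0F
1F ⊗′ y  = y
2F ⊗′ 0F = 0F
2F ⊗′ 1F = 2F
2F ⊗′ 2F = 1F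

⊕′≡⊕ : ∀ x y → x ⊕′ y ≡ x ⊕ y
⊕′≡⊕ = from-yes (Fin.all? λ x → Fin.all? λ y → x ⊕′ y Fin.≟ x ⊕ y)

⊗′≡⊗ : ∀ x y → x ⊗′ y ≡ x ⊗ y
⊗′≡⊗ = from-yes (Fin.all? λ x → Fin.all? λ y → x ⊗′ y Fin.≟ x ⊗ y)

_⊞′_ : ∀ {n} → V n → V n → V n
[]      ⊞′ []      = []
(x ∷ u) ⊞′ (y ∷ v) = x ⊕′ y ∷ u ⊞′ v

⊞′≡⊞ : ∀ {n} (u v : V n) → u ⊞′ v ≡ u ⊞ v
⊞′≡⊞ []      []      = refl
⊞′≡⊞ (x ∷ u) (y ∷ v) = cong₂ _∷_ (⊕′≡⊕ x y) (⊞′≡⊞ u v)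

dot′ : ∀ {n} → V n → V n → F
dot′ []      []      = 0F
dot′ (x ∷ u) (y ∷ v) = x ⊗′ y ⊕′ dot′ u v

dot′≡dot : ∀ {n} (u v : V n) → dot′ u v ≡ dot u v
dot′≡dot []      []      = refl
dot′≡dot (x ∷ u) (y ∷ v) = trans (⊕′≡⊕ (x ⊗′ y) (dot′ u v)) (cong₂ _⊕_ (⊗′≡⊗ x y) (dot′≡dot u v))

line : V 3 → V 3 → List (V 3)
line d z = z ∷ z ⊞′ d ∷ z ⊞′ d ⊞′ d ∷ []

-- Every line has exactly one point at which the pivot coordinate of its direction vanishes.
pivot : Fin 12 → Fin 3
pivot i with lookup (dir i) 0F
... | 0F = 1F
... | _  = 0F

points : List (V 3)
points = concatMap (λ a → concatMap (λ b → List.map (λ c → a ∷ b ∷ c ∷ []) coords) coords) coords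
  where coords = 0F ∷ 1F ∷ 2F ∷ []

reps : Fin 12 → List (V 3)
reps i = filter (λ z → lookup z (pivot i) ≟F 0F) points

occ : V 3 → List (V 3) → ℕ
occ w R = ∑ R λ v → χ (w ≟V v)

odd : ℕ → Bool
odd zero    = false
odd (suc n) = not (odd n)

every : ∀ {a} {A : Set a} → (A → Bool) → List A → Bool
every p []       = true
every p (x ∷ xs) = p x ∧ every p xs

every-∈ : ∀ {a} {A : Set a} (p : A → Bool) {xs x} → every p xs ≡ true → x ∈ xs → p x ≡ true
every-∈ p {x ∷ xs} eq (here refl) with p x
... | true = refl
every-∈ p {y ∷ xs} eq (there x∈) with p y
... | true = every-∈ p eq x∈

∧-true : ∀ {a b} → a ∧ b ≡ true → a ≡ true × b ≡ true
∧-true {true} {true} _ = refl , refl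

record Ternary (A : Set) : Set where
  constructor ⟨_,_,_⟩
  field at₀ at₁ at₂ : A
open Ternary

sel : ∀ {A} → F → Ternary A → A
sel 0F = at₀
sel 1F = at₁
sel 2F = at₂

put : ∀ {A} → F → A → Ternary A → Ternary A
put 0F x t = ⟨ x , at₁ t , at₂ t ⟩
put 1F x t = ⟨ at₀ t , x , at₂ t ⟩
put 2F x t = ⟨ at₀ t , at₁ t , x ⟩

sel-put : ∀ {A} i (x : A) t → sel i (put i x t) ≡ x
sel-put 0F x t = refl
sel-put 1F x t = refl
sel-put 2F x t = refl

sel-put-≢ : ∀ {A} {i j} (x : A) t → j ≢ i → sel j (put i x t) ≡ sel j t
sel-put-≢ {i = 0F} {0F} x t p = contradiction refl p
sel-put-≢ {i = 0F} {1F} x t p = refl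
sel-put-≢ {i = 0F} {2F} x t p = refl
sel-put-≢ {i = 1F} {0F} x t p = refl
sel-put-≢ {i = 1F} {1F} x t p = contradiction refl p
sel-put-≢ {i = 1F} {2F} x t p = refl
sel-put-≢ {i = 2F} {0F} x t p = refl
sel-put-≢ {i = 2F} {1F} x t p = refl
sel-put-≢ {i = 2F} {2F} x t p = contradiction refl p

Grid : Set
Grid = Ternary (Ternary (Ternary ℕ))

get : V 3 → Grid → ℕ
get (a ∷ b ∷ c ∷ []) t = sel c (sel b (sel a t))

set : V 3 → ℕ → Grid → Grid
set (a ∷ b ∷ c ∷ []) n t = put a (put b (put c n (sel b (sel a t))) (sel a t)) t

get-set : ∀ v n t → get v (set v n t) ≡ n
get-set (a ∷ b ∷ c ∷ []) n t rewrite sel-put a (put b (put c n (sel b (sel a t))) (sel a t)) t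
  | sel-put b (put c n (sel b (sel a t))) (sel a t) = sel-put c n (sel b (sel a t))

get-set-≢ : ∀ w v n t → w ≢ v → get w (set v n t) ≡ get w t
get-set-≢ (a' ∷ b' ∷ c' ∷ []) (a ∷ b ∷ c ∷ []) n t w≢v with a' ≟F a
... | no a'≢a = cong (λ s → sel c' (sel b' s)) (sel-put-≢ _ t a'≢a)
... | yes refl rewrite sel-put a (put b (put c n (sel b (sel a t))) (sel a t)) t with b' ≟F b
...   | no b'≢b = cong (sel c') (sel-put-≢ _ (sel a t) b'≢b)
...   | yes refl rewrite sel-put b (put c n (sel b (sel a t))) (sel a t) =
        sel-put-≢ {i = c} {c'} n (sel b (sel a t)) λ { refl → w≢v refl }

tabulate₃ : ∀ {A} → (F → A) → Ternary A
tabulate₃ f = ⟨ f 0F , f 1F , f 2F ⟩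

sel-tabulate₃ : ∀ {A} (f : F → A) i → sel i (tabulate₃ f) ≡ f i
sel-tabulate₃ f 0F = refl
sel-tabulate₃ f 1F = refl
sel-tabulate₃ f 2F = refl

grid : (V 3 → ℕ) → Grid
grid f = tabulate₃ λ a → tabulate₃ λ b → tabulate₃ λ c → f (a ∷ b ∷ c ∷ [])

get-grid : ∀ f v → get v (grid f) ≡ f v
get-grid f (a ∷ b ∷ c ∷ []) =
  trans (cong (λ s → sel c (sel b s)) (sel-tabulate₃ (λ a → tabulate₃ λ b → tabulate₃ λ c → f (a ∷ b ∷ c ∷ [])) a))
  (trans (cong (sel c) (sel-tabulate₃ (λ b → tabulate₃ λ c → f (a ∷ b ∷ c ∷ [])) b))
         (sel-tabulate₃ (λ c → f (a ∷ b ∷ c ∷ [])) c))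

update : ∀ {A} → F → (A → Maybe A) → Ternary A → Maybe (Ternary A)
update 0F f ⟨ x , y , z ⟩ with f x
... | just x' = just ⟨ x' , y , z ⟩
... | nothing = nothing
update 1F f ⟨ x , y , z ⟩ with f y
... | just y' = just ⟨ x , y' , z ⟩
... | nothing = nothing
update 2F f ⟨ x , y , z ⟩ with f z
... | just z' = just ⟨ x , y , z' ⟩
... | nothing = nothing

update-just : ∀ {A} i (f : A → Maybe A) t {y} → f (sel i t) ≡ just y → update i f t ≡ just (put i y t)
update-just 0F f ⟨ x , y , z ⟩ eq rewrite eq = refl
update-just 1F f ⟨ x , y , z ⟩ eq rewrite eq = refl
update-just 2F f ⟨ x , y , z ⟩ eq rewrite eq = refl

decrement : ℕ → Maybe ℕ
decrement zero    = nothing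
decrement (suc n) = just n

take₁ : V 3 → Grid → Maybe Grid
take₁ (a ∷ b ∷ c ∷ []) = update a (update b (update c decrement))

take₁-just : ∀ v t {n} → get v t ≡ suc n → take₁ v t ≡ just (set v n t)
take₁-just (a ∷ b ∷ c ∷ []) t eq =
  update-just a _ t (update-just b _ (sel a t) (update-just c _ (sel b (sel a t)) (cong decrement eq)))

takes : List (V 3) → Grid → Maybe Grid
takes []       t = just t
takes (v ∷ vs) t with take₁ v t
... | nothing = nothing
... | just t' = takes vs t'

-- A grid records the remaining capacity of every point: the still unplaced points R of the real
-- configuration, plus a slack that never changes.
Fits : (V 3 → ℕ) → List (V 3) → Grid → Set
Fits slack R t = ∀ w → get w t ≡ occ w R + slack w

takes-sound : ∀ {slack} vs R t → Fits slack (vs ++ R) t → ∃ λ t' → takes vs t ≡ just t' × Fits slack R t'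
takes-sound []       R t fits = t , refl , fits
takes-sound {slack} (v ∷ vs) R t fits with get v t in eq
... | zero  = contradiction (trans (sym eq) (trans (fits v) (cong (λ k → k + occ v (vs ++ R) + slack v) (χ-yes (v ≟V v) refl)))) λ ()
... | suc n rewrite take₁-just v t eq = takes-sound vs R (set v n t) fits'
  where
  fits' : Fits slack (vs ++ R) (set v n t)
  fits' w with w ≟V v | fits w
  ... | yes refl | p = trans (get-set w n t) (ℕ.suc-injective (trans (sym eq) p))
  ... | no w≢v   | p = trans (get-set-≢ w v n t w≢v) p

Option : Set
Option = List (V 3) × List (V 3) × List (V 3)

-- The subspace with direction `d` has the lines through `x`, `y`, `x + y` and `x + 2y` in the four
-- affine spaces; once `x` is fixed, a choice of `y` settles the last three together.
option : V 3 → V 3 → V 3 → Option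
option d x y = line d y , line d (x ⊞′ y) , line d (x ⊞′ y ⊞′ y)

-- The value true means that no completion exists.
ysearch : List (List Option) → Grid → Grid → Grid → Bool
ytry    : List (List Option) → Option → Grid → Grid → Grid → Bool
ysearch []       a b c = false
ysearch (os ∷ r) a b c = every (λ o → ytry r o a b c) os
ytry r (l , m , n) a b c with takes l a
... | nothing = true
... | just a' with takes m b
...   | nothing = true
...   | just b' with takes n c
...     | nothing = true
...     | just c' = ysearch r a' b' c'

-- The true choices `os` label a branch on which no capacity is ever exceeded. It ends at the empty
-- list, where the search answers `false`.
ysearch-sound : ∀ {s₁ s₂ s₃} r (os : List Option) → Pointwise _∈_ os r → ∀ a b c →
  Fits s₁ (concatMap proj₁ os) a → Fits s₂ (concatMap (proj₁ ∘ proj₂) os) b → Fits s₃ (concatMap (proj₂ ∘ proj₂) os) c →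
  ysearch r a b c ≡ true → ⊥
ysearch-sound [] [] _ a b c f g h ()
ysearch-sound (r ∷ rs) ((l , m , n) ∷ os) (o∈ ∷ os∈) a b c f g h eq with every-∈ (λ o → ytry rs o a b c) eq o∈
... | eq' with takes-sound l (concatMap proj₁ os) a f
...   | a' , ea , f' with takes-sound m (concatMap (proj₁ ∘ proj₂) os) b g
...     | b' , eb , g' with takes-sound n (concatMap (proj₂ ∘ proj₂) os) c h
...       | c' , ec , h' rewrite ea | eb | ec = ysearch-sound rs os os∈ a' b' c' f' g' h' eq'

Prefix : Set
Prefix = List (Fin 12 × V 3)

find : Prefix → Fin 12 → Maybe (V 3)
find []            i = nothing
find ((j , v) ∷ p) i = if does (i Fin.≟ j) then just v else find p i

-- A line parallel to the plane dot normal w ≡ v has three or no points in it, any other line has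
-- one; as every point off the list of singles is covered an even number of times, the number of
-- singles in the plane (its parity is the target) constrains the lines parallel to it.
record PlaneCheck : Set where
  constructor planeCheck
  field
    normal   : V 3
    parallel : List (Fin 12)
    others   : ℕ
    targets  : Ternary Bool
open PlaneCheck

dots : Prefix → V 3 → List (Fin 12) → Maybe (List F)
dots pre p []       = just []
dots pre p (j ∷ js) with find pre j | dots pre p js
... | just v | just as = just (dot′ p v ∷ as)
... | _      | _       = nothing

coordinates : List F
coordinates = 0F ∷ 1F ∷ 2F ∷ []

passes : Prefix → PlaneCheck → Bool
passes pre c with dots pre (normal c) (parallel c)
... | nothing = true
... | just as = every (λ v → not (odd (∑ as (λ a → χ (a ≟F v)) + others c) xor sel v (targets c))) coordinates

record Step : Set where
  constructor step
  field
    index   : Fin 12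
    choices : List (V 3 × List (V 3))
    checks  : List PlaneCheck
open Step

-- Off the singles every point starts with capacity two and is covered never or twice; on them
-- capacity one is used up. So a complete family leaves no point with remaining capacity one.
noOnes : Grid → Bool
noOnes t = every (λ w → not (does (get w t ℕ.≟ 1))) points

-- Again `true` means refuted. A branch closes at an exhausted point, at a failed plane check, or at
-- an unlisted single in the end; a complete family that survives is judged by `leaf`.
xsearch : (Prefix → Bool) → List Step → Prefix → Grid → Bool
xtry    : (Prefix → Bool) → List Step → Prefix → Grid → Step → V 3 × List (V 3) → Bool
xsearch leaf []       pre t = if noOnes t then leaf pre else true
xsearch leaf (s ∷ ss) pre t = every (xtry leaf ss pre t s) (choices s)
xtry leaf ss pre t s (x , l) with takes l t
... | nothing = true
... | just t' = if every (passes ((index s , x) ∷ pre)) (checks s) then xsearch leaf ss ((index s , x) ∷ pre) t' else true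

_∥?_ : (p : V 3) (i : Fin 12) → Dec (dot p (dir i) ≡ 0F)
p ∥? i = dot p (dir i) ≟F 0F

planeCheckOf : List (V 3) → V 3 → PlaneCheck
planeCheckOf S p = planeCheck p (filter (p ∥?_) fins) (∑ fins λ i → χ (¬? (p ∥? i)))
                              (tabulate₃ λ v → odd (∑ S λ s → χ (dot p s ≟F v)))

-- A plane check is attached to the last of its parallel directions in the given order, the first
-- moment at which it can be decided.
completed : (done : List (Fin 12)) (i : Fin 12) (p : V 3) →
            Dec (dot p (dir i) ≡ 0F × All (λ j → Any (j ≡_) (i ∷ done)) (filter (p ∥?_) fins))
completed done i p = (p ∥? i) ×-dec All.all? (λ j → Any.any? (λ k → j Fin.≟ k) (i ∷ done)) (filter (p ∥?_) fins)

Incidences : Set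
Incidences = List (Fin 12 × V 3)

meets? : (Q : Incidences) (i : Fin 12) (x : V 3) →
         Dec (All (λ q → proj₁ q ≡ i → Any (proj₂ q ≡_) (line (dir i) x)) Q)
meets? Q i x = All.all? (λ q → (proj₁ q Fin.≟ i) →-dec Any.any? (λ v → proj₂ q ≟V v) (line (dir i) x)) Q

steps : List (V 3) → Incidences → List (Fin 12) → List (Fin 12) → List Step
steps S Q done []       = []
steps S Q done (i ∷ is) =
  step i (List.map (λ x → x , line (dir i) x) (filter (meets? Q i) (reps i))) (List.map (planeCheckOf S) (filter (completed done i) directions))
  ∷ steps S Q (i ∷ done) is

capacity : List (V 3) → V 3 → ℕ
capacity S w = if does (Any.any? (w ≟V_) S) then 1 else 2

disjoint? : (u v : List (V 3)) → Dec (All (λ a → ¬ Any (a ≡_) v) u)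
disjoint? u v = All.all? (λ a → ¬? (Any.any? (a ≟V_) v)) u

half : List (V 3)
half = (0F ∷ 0F ∷ 0F ∷ []) ∷ (0F ∷ 0F ∷ 1F ∷ []) ∷ (0F ∷ 1F ∷ 0F ∷ []) ∷ (0F ∷ 1F ∷ 1F ∷ []) ∷ (0F ∷ 1F ∷ 2F ∷ []) ∷ []

-- After normalisation the first two lines of the second family pass through 𝟘, and the third
-- does so up to sign.
record YOrder : Set where
  constructor yorder
  field
    i₁ i₂ i₃ : Fin 12
    others   : List (Fin 12)

ychoices : YOrder → List (Fin 12 × List (V 3))
ychoices (yorder i₁ i₂ i₃ is) = (i₁ , 𝟘 ∷ []) ∷ (i₂ , 𝟘 ∷ []) ∷ (i₃ , half) ∷ List.map (λ i → i , reps i) is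

yoptions : YOrder → (Fin 12 → V 3) → List (List Option)
yoptions o x = List.map (λ (i , ys) → List.map (option (dir i) (x i)) ys) (ychoices o)

full : Grid
full = grid λ _ → 2

-- A leaf at which the lines `i₁` and `i₂` meet is answered `false`. So a successful run establishes
-- that they are disjoint at every surviving leaf, hence meet in another space, where their common
-- point may serve as the origin.
leaf : YOrder → Prefix → Bool
leaf o pre = every (is-just ∘ find pre) fins ∧
  (does (disjoint? (line (dir i₁) (x i₁)) (line (dir i₂) (x i₂))) ∧ ysearch (yoptions o x) full full full)
  where
  open YOrder o
  x : Fin 12 → V 3
  x i = fromMaybe 𝟘 (find pre i)

refute : List (Fin 12) → YOrder → List (V 3) → Incidences → Bool
refute order o S Q = xsearch (leaf o) (steps S Q [] order) [] (grid (capacity S))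

-- `order₂` begins with the three directions in the plane of `e₁` and the missing `e₃`; it serves
-- the cases in which the second known line has such a direction, and lets the check of that plane
-- come third.
order₁ order₂ : List (Fin 12)
order₁ = fins
order₂ = 0F ∷ (# 10) ∷ 7F ∷ 1F ∷ 2F ∷ 3F ∷ 4F ∷ 5F ∷ 6F ∷ 8F ∷ 9F ∷ (# 11) ∷ []

-- The first two directions belong to lines that are disjoint in every first family surviving the
-- runs with this order. The third has pivot coordinate `0F`, for which `half` lists the candidates
-- up to sign.
yorder₁ yorder₂ : YOrder
yorder₁ = yorder 0F 7F (# 10) (3F ∷ 4F ∷ 5F ∷ 6F ∷ 9F ∷ 2F ∷ 1F ∷ (# 11) ∷ 8F ∷ [])
yorder₂ = yorder (# 11) 1F 0F (8F ∷ 9F ∷ 4F ∷ 6F ∷ 5F ∷ 2F ∷ 7F ∷ 3F ∷ (# 10) ∷ [])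

e₁ e₂ : V 3
e₁ = 1F ∷ 0F ∷ 0F ∷ []
e₂ = 0F ∷ 1F ∷ 0F ∷ []

-- Soundness of the search

open Indicator {A = Fin 12} Fin._≟_

points-complete : ∀ v → v ∈ points
points-complete = from-yes (all-vec? 3 λ v → any? (v ≟V_) points)

∑-concatMap : ∀ {a b} {A : Set a} {B : Set b} (f : A → List B) (xs : List A) g →
              ∑ (concatMap f xs) g ≡ ∑ xs (λ x → ∑ (f x) g)
∑-concatMap f []       g = refl
∑-concatMap f (x ∷ xs) g = trans (∑-++ (f x) (concatMap f xs) g) (cong (∑ (f x) g +_) (∑-concatMap f xs g))

∑-filter : ∀ {a p} {A : Set a} {P : A → Set p} (P? : ∀ x → Dec (P x)) (xs : List A) f →
           ∑ xs (λ x → if does (P? x) then f x else 1) ≡ ∑ (filter P? xs) f + ∑ xs (λ x → χ (¬? (P? x)))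
∑-filter P? []       f = refl
∑-filter P? (x ∷ xs) f with P? x
... | yes _ = trans (cong (f x +_) (∑-filter P? xs f)) (sym (ℕ.+-assoc (f x) _ _))
... | no _  = trans (cong suc (∑-filter P? xs f)) (sym (ℕ.+-suc (∑ (filter P? xs) f) _))

every⁺ : ∀ {a} {A : Set a} (p : A → Bool) xs → (∀ {x} → x ∈ xs → p x ≡ true) → every p xs ≡ true
every⁺ p []       h = refl
every⁺ p (x ∷ xs) h rewrite h (here refl) = every⁺ p xs (λ x∈ → h (there x∈))

does⇒ : ∀ {a} {A : Set a} (d : Dec A) → does d ≡ true → A
does⇒ (yes a) _ = a

Once? : ∀ xs → Dec (∀ i → Once xs i)
Once? xs = Fin.all? λ i → _ ℕ.≟ 1

fins-once : ∀ i → Once fins i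
fins-once = from-yes (Once? fins)

notOne : ∀ {n} → n ≢ 1 → not (does (n ℕ.≟ 1)) ≡ true
notOne {n} n≢1 = cong not (dec-false (n ℕ.≟ 1) n≢1)

xtry-continues : ∀ leaf ss pre t s v l {t′} → takes l t ≡ just t′ → every (passes ((index s , v) ∷ pre)) (checks s) ≡ true →
                 xtry leaf ss pre t s (v , l) ≡ xsearch leaf ss ((index s , v) ∷ pre) t′
xtry-continues leaf ss pre t s v l taken passed rewrite taken | passed = refl

module Real (x : Fin 12 → V 3) where

  lineOf : Fin 12 → List (V 3)
  lineOf i = line (dir i) (x i)

  Agrees : Prefix → Set
  Agrees = All λ (i , v) → v ≡ x i

  PlaneOK : PlaneCheck → Set
  PlaneOK c = ∀ v → odd (∑ (parallel c) (λ j → χ (dot (normal c) (x j) ≟F v)) + others c) ≡ sel v (targets c)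

  StepOK : Step → Set
  StepOK s = (x (index s) , lineOf (index s)) ∈ choices s × All PlaneOK (checks s)

  find-agrees : ∀ {pre i v} → Agrees pre → find pre i ≡ just v → v ≡ x i
  find-agrees {(j , u) ∷ pre} {i} (p ∷ ps) eq with i Fin.≟ j
  find-agrees {(j , u) ∷ pre} {.j} (p ∷ ps) refl | yes refl = p
  ... | no _ = find-agrees ps eq

  dots-agrees : ∀ {pre} p js {as} → Agrees pre → dots pre p js ≡ just as → ∀ (f : F → ℕ) → ∑ as f ≡ ∑ js (λ j → f (dot p (x j)))
  dots-agrees p [] ag refl f = refl
  dots-agrees {pre} p (j ∷ js) ag eq f with find pre j in e₁ | dots pre p js in e₂ | eq
  ... | just v  | just as | refl = cong₂ _+_ (cong f (trans (dot′≡dot p v) (cong (dot p) (find-agrees ag e₁)))) (dots-agrees p js ag e₂ f)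
  ... | just _  | nothing | ()
  ... | nothing | just _  | ()
  ... | nothing | nothing | ()

  passes-agrees : ∀ {pre} c → Agrees pre → PlaneOK c → passes pre c ≡ true
  passes-agrees {pre} c ag ok with dots pre (normal c) (parallel c) in eq
  ... | nothing = refl
  ... | just as = every⁺ _ coordinates λ {v} _ → begin
    not (odd (∑ as (λ a → χ (a ≟F v)) + others c) xor sel v (targets c))
      ≡⟨ cong (λ k → not (odd (k + others c) xor sel v (targets c))) (dots-agrees (normal c) (parallel c) ag eq (λ a → χ (a ≟F v))) ⟩
    not (odd (∑ (parallel c) (λ j → χ (dot (normal c) (x j) ≟F v)) + others c) xor sel v (targets c))
      ≡⟨ cong (λ b → not (b xor sel v (targets c))) (ok v) ⟩
    not (sel v (targets c) xor sel v (targets c))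
      ≡⟨ cong not (Bool.xor-same (sel v (targets c))) ⟩
    true ∎
    where open ≡-Reasoning

  -- Follow the branch of the real lines: each of them fits, the plane checks pass, and the final
  -- grid is the slack, which is never 1. So the search had to accept `leaf` on a prefix that agrees
  -- with `x`.
  xsearch-sound : ∀ {slack} leaf → (∀ w → slack w ≢ 1) → ∀ ss pre t → All StepOK ss → Agrees pre →
                  Fits slack (concatMap (lineOf ∘ index) ss) t → xsearch leaf ss pre t ≡ true →
                  ∃ λ pre′ → Agrees pre′ × leaf pre′ ≡ true
  xsearch-sound {slack} leaf slack≢1 [] pre t [] ag fits eq
    rewrite every⁺ (λ w → not (does (get w t ℕ.≟ 1))) points (λ {w} _ → notOne (λ p → slack≢1 w (trans (sym (fits w)) p)))
    = pre , ag , eq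
  xsearch-sound leaf slack≢1 (s ∷ ss) pre t ((c∈ , planes) ∷ oks) ag fits eq =
    let t′ , taken , fits′ = takes-sound (lineOf (index s)) (concatMap (lineOf ∘ index) ss) t fits
        ag′ = refl ∷ ag
        passed = every⁺ (passes ((index s , x (index s)) ∷ pre)) (checks s) (λ {c} c∈ → passes-agrees c ag′ (All.lookup planes c∈))
    in xsearch-sound leaf slack≢1 ss _ t′ oks ag′ fits′
         (trans (sym (xtry-continues leaf ss pre t s (x (index s)) (lineOf (index s)) taken passed))
                (every-∈ (xtry leaf ss pre t s) eq c∈))

  module _ (S : List (V 3)) (Q : Incidences)
           (x-rep : ∀ i → lookup (x i) (pivot i) ≡ 0F)
           (incident : All (λ (i , p) → p ∈ lineOf i) Q)
           (parity : ∀ p v → odd (∑ fins (λ i → if does (p ∥? i) then χ (dot p (x i) ≟F v) else 1))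
                             ≡ odd (∑ S λ s → χ (dot p s ≟F v)))
           where

    planeOK : ∀ p → PlaneOK (planeCheckOf S p)
    planeOK p v = trans (cong odd (sym (∑-filter (p ∥?_) fins λ i → χ (dot p (x i) ≟F v))))
                        (trans (parity p v) (sym (sel-tabulate₃ (λ u → odd (∑ S λ s → χ (dot p s ≟F u))) v)))

    steps-ok : ∀ done order → All StepOK (steps S Q done order)
    steps-ok done []       = []
    steps-ok done (i ∷ is) =
      ( ∈-map⁺ (λ z → z , line (dir i) z) (∈-filter⁺ (meets? Q i)
          (∈-filter⁺ (λ z → lookup z (pivot i) ≟F 0F) (points-complete (x i)) (x-rep i))
          (All.map (λ { p refl → p }) incident))
      , Allₚ.map⁺ (All.universal planeOK (filter (completed done i) directions)) )
      ∷ steps-ok (i ∷ done) is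

    concatMap-steps : ∀ done order w → occ w (concatMap (lineOf ∘ index) (steps S Q done order)) ≡ ∑ order (λ i → occ w (lineOf i))
    concatMap-steps done []       w = refl
    concatMap-steps done (i ∷ is) w = trans (∑-++ (lineOf i) (concatMap (lineOf ∘ index) (steps S Q (i ∷ done) is)) _)
                                            (cong (occ w (lineOf i) +_) (concatMap-steps (i ∷ done) is w))

  module _ (o : YOrder) where
    open YOrder o

    Disjoint : Set
    Disjoint = All (λ a → ¬ Any (a ≡_) (lineOf i₂)) (lineOf i₁)

    record SecondFamily : Set where
      field
        y       : Fin 12 → V 3
        y₁≡𝟘    : y i₁ ≡ 𝟘
        y₂≡𝟘    : y i₂ ≡ 𝟘
        y₃∈half : y i₃ ∈ half
        y-rep   : ∀ i → lookup (y i) (pivot i) ≡ 0F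
        bound₁  : ∀ w → ∑ fins (λ i → occ w (line (dir i) (y i))) ≤ 2
        bound₂  : ∀ w → ∑ fins (λ i → occ w (line (dir i) (x i ⊞′ y i))) ≤ 2
        bound₃  : ∀ w → ∑ fins (λ i → occ w (line (dir i) (x i ⊞′ y i ⊞′ y i))) ≤ 2

    no-second-family : (∀ i → Once (List.map proj₁ (ychoices o)) i) → (x̂ : Fin 12 → V 3) → (∀ i → x̂ i ≡ x i) →
                       SecondFamily → ysearch (yoptions o x̂) full full full ≡ true → ⊥
    no-second-family once x̂ x̂≡x sf = ysearch-sound (yoptions o x̂) chosen (memberships (ychoices o) in-choices) full full full
      (fits proj₁ y (λ _ → refl) bound₁)
      (fits (proj₁ ∘ proj₂) (λ i → x i ⊞′ y i) (λ i → cong (λ u → line (dir i) (u ⊞′ y i)) (x̂≡x i)) bound₂)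
      (fits (proj₂ ∘ proj₂) (λ i → x i ⊞′ y i ⊞′ y i) (λ i → cong (λ u → line (dir i) (u ⊞′ y i ⊞′ y i)) (x̂≡x i)) bound₃)
      where
      open SecondFamily sf
      choose : Fin 12 × List (V 3) → Option
      choose (i , _) = option (dir i) (x̂ i) (y i)
      chosen = List.map choose (ychoices o)
      in-choices : All (λ (i , ys) → y i ∈ ys) (ychoices o)
      in-choices = here y₁≡𝟘 ∷ here y₂≡𝟘 ∷ y₃∈half ∷ Allₚ.map⁺ (All.universal
        (λ i → ∈-filter⁺ (λ z → lookup z (pivot i) ≟F 0F) (points-complete (y i)) (y-rep i)) _)
      memberships : ∀ cs → All (λ (i , ys) → y i ∈ ys) cs →
                    Pointwise _∈_ (List.map choose cs) (List.map (λ (i , ys) → List.map (option (dir i) (x̂ i)) ys) cs)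
      memberships []             []       = []
      memberships ((i , ys) ∷ cs) (m ∷ ms) = ∈-map⁺ (option (dir i) (x̂ i)) m ∷ memberships cs ms
      fits : ∀ (π : Option → List (V 3)) (z : Fin 12 → V 3) →
             (∀ i → π (option (dir i) (x̂ i) (y i)) ≡ line (dir i) (z i)) →
             (∀ w → ∑ fins (λ i → occ w (line (dir i) (z i))) ≤ 2) →
             Fits (λ w → 2 ∸ ∑ fins (λ i → occ w (line (dir i) (z i)))) (concatMap π chosen) full
      fits π z π≡ bd w = begin
        get w full                                           ≡⟨ get-grid (λ _ → 2) w ⟩
        2                                                    ≡⟨ ℕ.m+[n∸m]≡n (bd w) ⟨
        total + (2 ∸ total)                                  ≡⟨ cong (_+ (2 ∸ total)) reindexed ⟩
        occ w (concatMap π chosen) + (2 ∸ total)             ∎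
        where
        open ≡-Reasoning
        through : Fin 12 → ℕ
        through i = occ w (line (dir i) (z i))
        total = ∑ fins through
        reindexed : total ≡ occ w (concatMap π chosen)
        reindexed = begin
          total                                                              ≡⟨ ∑-reindex fins (List.map proj₁ (ychoices o)) through fins-once once ⟩
          ∑ (List.map proj₁ (ychoices o)) (λ i → occ w (line (dir i) (z i)))      ≡⟨ ∑-map proj₁ (ychoices o) through ⟩
          ∑ (ychoices o) (λ c → occ w (line (dir (proj₁ c)) (z (proj₁ c))))  ≡⟨ ∑-cong (ychoices o) (λ c → cong (occ w) (sym (π≡ (proj₁ c)))) ⟩
          ∑ (ychoices o) (λ c → occ w (π (choose c)))                        ≡⟨ ∑-map choose (ychoices o) (λ q → occ w (π q)) ⟨
          ∑ chosen (λ q → occ w (π q))                                       ≡⟨ ∑-concatMap π chosen (λ v → χ (w ≟V v)) ⟨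
          occ w (concatMap π chosen)                                         ∎

    leaf-sound : ∀ pre → Agrees pre → (∀ i → Once (List.map proj₁ (ychoices o)) i) → (Disjoint → SecondFamily) → leaf o pre ≡ true → ⊥
    leaf-sound pre ag once second eq with ∧-true eq
    ... | found , eq₂ with ∧-true eq₂
    ...   | dis , searched = no-second-family once x̂ x̂≡x (second disjoint) searched
      where
      x̂ : Fin 12 → V 3
      x̂ i = fromMaybe 𝟘 (find pre i)
      x̂≡x : ∀ i → x̂ i ≡ x i
      x̂≡x i with find pre i in e | every-∈ (is-just ∘ find pre) found (once⇒∈ fins i (fins-once i))
      ... | just v  | _  = find-agrees ag e
      ... | nothing | ()
      disjoint : Disjoint
      disjoint = subst₂ (λ u v → All (λ a → ¬ Any (a ≡_) (line (dir i₂) v)) (line (dir i₁) u)) (x̂≡x i₁) (x̂≡x i₂)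
        (does⇒ (disjoint? (line (dir i₁) (x̂ i₁)) (line (dir i₂) (x̂ i₂))) dis)

    -- The second family is requested only under disjointness: if the lines `i₁` and `i₂` met in the
    -- first space, their common hyperplane could not serve as an origin elsewhere.
    refute-sound : ∀ order S Q → (∀ i → Once order i) → (∀ i → Once (List.map proj₁ (ychoices o)) i) →
      (∀ i → lookup (x i) (pivot i) ≡ 0F) →
      All (λ (i , p) → p ∈ lineOf i) Q →
      (∀ p v → odd (∑ fins (λ i → if does (p ∥? i) then χ (dot p (x i) ≟F v) else 1)) ≡ odd (∑ S λ s → χ (dot p s ≟F v))) →
      (slack : V 3 → ℕ) → (∀ w → capacity S w ≡ ∑ fins (λ i → occ w (lineOf i)) + slack w) → (∀ w → slack w ≢ 1) →
      (Disjoint → SecondFamily) → refute order o S Q ≡ true → ⊥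
    refute-sound order S Q once once′ x-rep incident parity slack cap slack≢1 second eq =
      let pre , ag , leaf-true = xsearch-sound (leaf o) slack≢1 (steps S Q [] order) [] (grid (capacity S))
                                   (steps-ok S Q x-rep incident parity [] order) [] fits eq
      in leaf-sound pre ag once′ second leaf-true
      where
      fits : Fits slack (concatMap (lineOf ∘ index) (steps S Q [] order)) (grid (capacity S))
      fits w = trans (get-grid (capacity S) w) (trans (cap w) (cong (_+ slack w)
        (trans (∑-reindex fins order (λ i → occ w (lineOf i)) fins-once once) (sym (concatMap-steps S Q x-rep incident parity [] order w)))))

-- Thirteen lines, at most two in a hyperplane: coordinates

killed-⊞ : ∀ {r} {g h : V r} p → Killed g p → Killed h p → Killed (g ⊞ h) p
killed-⊞ {g = g} {h} (a , b) (p , q) (p′ , q′) =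
  trans (dot-⊞ˡ g h a) (cong₂ _⊕_ p p′) , trans (dot-⊞ˡ g h b) (cong₂ _⊕_ q q′)

killed-· : ∀ {r} c {h : V r} p → Killed h p → Killed (c · h) p
killed-· c {h} (a , b) (p , q) =
  trans (dot-·ˡ c h a) (trans (cong (c ⊗_) p) (⊗-zeroʳ c)) , trans (dot-·ˡ c h b) (trans (cong (c ⊗_) q) (⊗-zeroʳ c))

-- A change of coordinates seen from the functionals: `c` takes on the new pair the values that
-- `lincomb c G` takes on the old one.
pull : ∀ {k r} → Vec (V r) k → Pair r → Pair k
pull G (a , b) = map (λ g → dot g a) G , map (λ g → dot g b) G

killed-pull : ∀ {k r} (G : Vec (V r) k) c p → Killed (lincomb c G) p → Killed c (pull G p)
killed-pull G c (a , b) (p , q) = trans (sym (dot-lincomb c G a)) p , trans (sym (dot-lincomb c G b)) q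

killed-pull⁻ : ∀ {k r} (G : Vec (V r) k) c p → Killed c (pull G p) → Killed (lincomb c G) p
killed-pull⁻ G c (a , b) (p , q) = trans (dot-lincomb c G a) p , trans (dot-lincomb c G b) q

κ-pull : ∀ {k r} (G : Vec (V r) k) c p → κ c (pull G p) ≡ κ (lincomb c G) p
κ-pull G c p = χ-cong (killed? c (pull G p)) (killed? (lincomb c G) p) (killed-pull⁻ G c p) (killed-pull G c p)

killedIn-pull : ∀ {k r} (G : Vec (V r) k) (R : List (Pair r)) c → killedIn (List.map (pull G) R) c ≡ killedIn R (lincomb c G)
killedIn-pull G R c = trans (∑-map (pull G) R (κ c)) (∑-cong R (κ-pull G c))

-- Independence with certificates: each vector comes with an `e` on which it is nonzero while all
-- later vectors vanish.
data Triangular {r} : ∀ {k} → Vec (V r) k → Set where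
  []   : Triangular []
  cons : ∀ {k g} {gs : Vec (V r) k} e → dot g e ≢ 0F → VecAll.All (λ g′ → dot e g′ ≡ 0F) gs → Triangular gs → Triangular (g ∷ gs)

private
  ⊗-cancel : ∀ x → x ≢ 0F → ∀ c → c ⊗ x ⊕ 0F ≡ 0F → c ≡ 0F
  ⊗-cancel = from-yes (Fin.all? λ x → ¬? (x Fin.≟ 0F) →-dec Fin.all? λ c → (c ⊗ x ⊕ 0F Fin.≟ 0F) →-dec (c Fin.≟ 0F))

triangular⇒independent : ∀ {r k} {gs : Vec (V r) k} → Triangular gs → ∀ cs → lincomb cs gs ≡ 𝟘 → cs ≡ 𝟘
triangular⇒independent [] [] _ = refl
triangular⇒independent (cons {g = g} {gs} e ge≢0 zeros tri) (c ∷ cs) eq = cong₂ _∷_ c≡0 (triangular⇒independent tri cs rest)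
  where
  c≡0 : c ≡ 0F
  c≡0 = ⊗-cancel (dot g e) ge≢0 c (begin
    c ⊗ dot g e ⊕ 0F                        ≡⟨ cong₂ _⊕_ (dot-·ˡ c g e) (trans (dot-comm (lincomb cs gs) e) (dot-lincomb-zero e cs zeros)) ⟨
    dot (c · g) e ⊕ dot (lincomb cs gs) e   ≡⟨ dot-⊞ˡ (c · g) (lincomb cs gs) e ⟨
    dot (lincomb (c ∷ cs) (g ∷ gs)) e       ≡⟨ cong (λ u → dot u e) eq ⟩
    dot 𝟘 e                                 ≡⟨ dot-𝟘ˡ e ⟩
    0F                                      ∎)
    where open ≡-Reasoning
  rest : lincomb cs gs ≡ 𝟘
  rest = trans (sym (trans (cong (λ d → d · g ⊞ lincomb cs gs) c≡0) (trans (cong (_⊞ lincomb cs gs) (·-zeroˡ g)) (⊞-identityˡ (lincomb cs gs))))) eq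

lincomb-00∷ : ∀ {r k} (w : V k) (g g′ : V r) (ws : Vec (V r) k) → lincomb (0F ∷ 0F ∷ w) (g ∷ g′ ∷ ws) ≡ lincomb w ws
lincomb-00∷ w g g′ ws = trans (cong₂ _⊞_ (·-zeroˡ g) (trans (cong (_⊞ lincomb w ws) (·-zeroˡ g′)) (⊞-identityˡ (lincomb w ws)))) (⊞-identityˡ (lincomb w ws))

-- Twelve lines left after removing one from thirteen, in coordinates (l₁, l₂, w) for which
-- the hyperplanes through the removed line are those with l₁ = l₂ = 0.
record Good (R : List (Pair 5)) : Set where
  field
    size : length R ≡ 12
    off  : ∀ l₁ l₂ w → l₁ ∷ l₂ ∷ [] ≢ 𝟘 → killedIn R (l₁ ∷ l₂ ∷ w) ≤ 2
    on   : ∀ w → w ≢ 𝟘 → killedIn R (0F ∷ 0F ∷ w) ≤ 1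

-- The functionals w₁, w₂, w₃ kill the removed pair, and each vanishes at the coordinates singled
-- out for its predecessors. Common zeros e₁, e₂ of the three then certify two unit functionals that
-- complete a basis.
good-exists : ∀ L → length L ≡ 13 → Bounded 2 L → ∃ Good
good-exists ((a , b) ∷ R) size bd
  with orthogonal-exists (a ∷ b ∷ []) (s≤s (s≤s (s≤s z≤n)))
... | w₁ , w₁≢0 , w₁a ∷ w₁b ∷ [] with ≢𝟘⇒nonzero-entry w₁ w₁≢0
... | i₁ , p₁ with orthogonal-exists (a ∷ b ∷ unit i₁ ∷ []) (s≤s (s≤s (s≤s (s≤s z≤n))))
... | w₂ , w₂≢0 , w₂a ∷ w₂b ∷ w₂i₁ ∷ [] with ≢𝟘⇒nonzero-entry w₂ w₂≢0
... | i₂ , p₂ with orthogonal-exists (a ∷ b ∷ unit i₁ ∷ unit i₂ ∷ []) ℕ.≤-refl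
... | w₃ , w₃≢0 , w₃a ∷ w₃b ∷ w₃i₁ ∷ w₃i₂ ∷ [] with ≢𝟘⇒nonzero-entry w₃ w₃≢0
... | i₃ , p₃ with orthogonal-exists (w₁ ∷ w₂ ∷ w₃ ∷ []) (s≤s (s≤s (s≤s (s≤s z≤n))))
... | e₁ , e₁≢0 , e₁w₁ ∷ e₁w₂ ∷ e₁w₃ ∷ [] with ≢𝟘⇒nonzero-entry e₁ e₁≢0
... | k₁ , q₁ with orthogonal-exists (w₁ ∷ w₂ ∷ w₃ ∷ unit k₁ ∷ []) ℕ.≤-refl
... | e₂ , e₂≢0 , e₂w₁ ∷ e₂w₂ ∷ e₂w₃ ∷ e₂g₁ ∷ [] with ≢𝟘⇒nonzero-entry e₂ e₂≢0
... | k₂ , q₂ = List.map (pull G) R , record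
  { size = trans (Listₚ.length-map (pull G) R) (ℕ.suc-injective size)
  ; off  = λ l₁ l₂ w l≢0 → subst (_≤ 2) (sym (killedIn-pull G R (l₁ ∷ l₂ ∷ w)))
             (ℕ.≤-trans (ℕ.m≤n+m _ (κ (lincomb (l₁ ∷ l₂ ∷ w) G) (a , b))) (bound bd (lincomb (l₁ ∷ l₂ ∷ w) G) (λ eq → l≢0 (cong take₂ (independent (l₁ ∷ l₂ ∷ w) eq)))))
  ; on   = λ w w≢0 → subst (_≤ 1) (sym (killedIn-pull G R (0F ∷ 0F ∷ w)))
             (s≤s⁻¹ (subst (λ k → k + killedIn R (lincomb (0F ∷ 0F ∷ w) G) ≤ 2)
               (χ-yes (killed? (lincomb (0F ∷ 0F ∷ w) G) (a , b)) (through-removed w))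
               (bound bd (lincomb (0F ∷ 0F ∷ w) G) (λ eq → w≢0 (cong (λ v → tail (tail v)) (independent (0F ∷ 0F ∷ w) eq))))))
  }
  where
  G = unit k₂ ∷ unit k₁ ∷ w₁ ∷ w₂ ∷ w₃ ∷ []
  take₂ : V 5 → V 2
  take₂ (x ∷ y ∷ _) = x ∷ y ∷ []
  separates : ∀ {n} (v : V n) i → lookup v i ≢ 0F → dot v (unit i) ≢ 0F
  separates v i p q = p (trans (sym (dot-unit v i)) q)
  separated : ∀ {n} (v : V n) i → lookup v i ≢ 0F → dot (unit i) v ≢ 0F
  separated v i p q = separates v i p (trans (dot-comm v (unit i)) q)
  swap : ∀ {n} {u v : V n} → dot u v ≡ 0F → dot v u ≡ 0F
  swap {u = u} {v} = trans (dot-comm v u)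
  independent : ∀ c → lincomb c G ≡ 𝟘 → c ≡ 𝟘
  independent = triangular⇒independent
    (cons e₂ (separated e₂ k₂ q₂) (e₂g₁ ∷ e₂w₁ ∷ e₂w₂ ∷ e₂w₃ ∷ [])
    (cons e₁ (separated e₁ k₁ q₁) (e₁w₁ ∷ e₁w₂ ∷ e₁w₃ ∷ [])
    (cons (unit i₁) (separates w₁ i₁ p₁) (swap {u = w₂} w₂i₁ ∷ swap {u = w₃} w₃i₁ ∷ [])
    (cons (unit i₂) (separates w₂ i₂ p₂) (swap {u = w₃} w₃i₂ ∷ [])
    (cons (unit i₃) (separates w₃ i₃ p₃) [] [])))))
  through-removed : ∀ w → Killed (lincomb (0F ∷ 0F ∷ w) G) (a , b)
  through-removed w rewrite lincomb-00∷ w (unit k₂) (unit k₁) (w₁ ∷ w₂ ∷ w₃ ∷ []) =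
    swap {u = a} (dot-lincomb-zero a w (swap {u = w₁} w₁a ∷ swap {u = w₂} w₂a ∷ swap {u = w₃} w₃a ∷ [])) ,
    swap {u = b} (dot-lincomb-zero b w (swap {u = w₁} w₁b ∷ swap {u = w₂} w₂b ∷ swap {u = w₃} w₃b ∷ []))

on₃ : V 3 → V 5
on₃ w = 0F ∷ 0F ∷ w

private
  directionsKilling : V 3 → V 3 → ℕ
  directionsKilling c d = ∑ directions λ w → κ w (c , d)

  -- The `w` that kill `c` and `d` form a subspace of positive dimension, with 1, 4 or 13 projective
  -- points.
  killing-cases : ∀ c d → directionsKilling c d ≡ 1 ⊎ 4 ≤ directionsKilling c d
  killing-cases = from-yes (all-vec? 3 λ c → all-vec? 3 λ d →
    (directionsKilling c d ℕ.≟ 1) ⊎-dec (4 ℕ.≤? directionsKilling c d))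

  dot-on₃ : ∀ w x₁ x₂ c → dot (on₃ w) (x₁ ∷ x₂ ∷ c) ≡ dot w c
  dot-on₃ w x₁ x₂ c = trans (cong₂ _⊕_ (⊗-zeroˡ x₁) (trans (cong (_⊕ dot w c) (⊗-zeroˡ x₂)) (⊕-identityˡ (dot w c)))) (⊕-identityˡ (dot w c))

  κ-on₃ : ∀ w x₁ x₂ c y₁ y₂ d → κ (on₃ w) (x₁ ∷ x₂ ∷ c , y₁ ∷ y₂ ∷ d) ≡ κ w (c , d)
  κ-on₃ w x₁ x₂ c y₁ y₂ d rewrite dot-on₃ w x₁ x₂ c | dot-on₃ w y₁ y₂ d = refl

multiplicity : Pair 5 → ℕ
multiplicity p = ∑ directions λ w → κ (on₃ w) p

multiplicity-cases : ∀ p → multiplicity p ≡ 1 ⊎ 4 ≤ multiplicity p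
multiplicity-cases (x₁ ∷ x₂ ∷ c , y₁ ∷ y₂ ∷ d) =
  subst (λ k → k ≡ 1 ⊎ 4 ≤ k) (sym (∑-cong directions λ w → κ-on₃ w x₁ x₂ c y₁ y₂ d)) (killing-cases c d)

directions≢𝟘 : ∀ {w} → w ∈ directions → w ≢ 𝟘
directions≢𝟘 {w} w∈ = All.lookup (from-yes (All.all? (λ w → ¬? (w ≟V 𝟘)) directions)) w∈

module _ {R : List (Pair 5)} (good : Good R) where
  open Good good

  -- Twelve lines with at least one direction each share 13 directions, each of which is used at
  -- most once. The total excess is thus at most 1, while a line with several directions would have
  -- excess at least 3.
  multiplicity≡1 : ∀ {p} → p ∈ R → multiplicity p ≡ 1
  multiplicity≡1 {p} p∈ with multiplicity-cases p
  ... | inj₁ eq = eq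
  ... | inj₂ le = contradiction (ℕ.≤-trans (ℕ.∸-monoˡ-≤ 1 le) (ℕ.≤-trans (term≤∑ (λ q → multiplicity q ∸ 1) p∈) excess)) λ { (s≤s ()) }
    where
    positive : ∀ q → 1 ≤ multiplicity q
    positive q with multiplicity-cases q
    ... | inj₁ eq = ℕ.≤-reflexive (sym eq)
    ... | inj₂ le = ℕ.≤-trans (s≤s z≤n) le
    excess : ∑ R (λ q → multiplicity q ∸ 1) ≤ 1
    excess = ℕ.+-cancelˡ-≤ 12 _ _ (begin
      12 + ∑ R (λ q → multiplicity q ∸ 1)                    ≡⟨ cong (_+ ∑ R (λ q → multiplicity q ∸ 1)) (trans (∑-const 1 R) (trans (ℕ.*-identityʳ _) size)) ⟨
      ∑ R (λ _ → 1) + ∑ R (λ q → multiplicity q ∸ 1)         ≡⟨ ∑-+ R (λ _ → 1) _ ⟨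
      ∑ R (λ q → 1 + (multiplicity q ∸ 1))                   ≡⟨ ∑-cong R (λ q → ℕ.m+[n∸m]≡n (positive q)) ⟩
      ∑ R multiplicity                                       ≡⟨ ∑-swap R directions (λ q w → κ (on₃ w) q) ⟩
      ∑ directions (λ w → killedIn R (on₃ w))                ≤⟨ ∑-mono directions (λ w∈ → on _ (directions≢𝟘 w∈)) ⟩
      ∑ directions (λ _ → 1)                                 ≡⟨⟩
      13                                                     ∎)
      where open ℕ.≤-Reasoning

  ∑-directions : ∑ directions (λ w → killedIn R (on₃ w)) ≡ 12
  ∑-directions = begin
    ∑ directions (λ w → killedIn R (on₃ w))   ≡⟨ ∑-swap directions R (λ w q → κ (on₃ w) q) ⟩
    ∑ R multiplicity                          ≡⟨ ∑-cong-∈ R multiplicity≡1 ⟩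
    ∑ R (λ _ → 1)                             ≡⟨ trans (∑-const 1 R) (trans (ℕ.*-identityʳ _) size) ⟩
    12                                        ∎
    where open ≡-Reasoning

  missing-direction : ∃ λ w → w ≢ 𝟘 × killedIn R (on₃ w) ≡ 0
  missing-direction with ∑<∑⇒∃ directions (λ w → killedIn R (on₃ w)) (λ _ → 1) (ℕ.≤-reflexive (cong suc ∑-directions))
  ... | w , w∈ , lt = w , directions≢𝟘 w∈ , ℕ.n<1⇒n≡0 lt

∑-unique : ∀ {a} {A : Set a} {xs : List A} {x} (g f : A → ℕ) → ∑ xs g ≡ 1 → x ∈ xs → g x ≡ 1 → ∑ xs (λ y → g y * f y) ≡ f x
∑-unique {xs = x ∷ xs} g f total (here refl) gx≡1 rewrite gx≡1 =
  trans (cong₂ _+_ (ℕ.+-identityʳ (f x)) (trans (∑-cong-∈ xs λ y∈ → cong (_* f _) (ℕ.n≤0⇒n≡0 (subst (g _ ≤_) (ℕ.suc-injective total) (term≤∑ g y∈)))) (∑-zero xs)))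
        (ℕ.+-identityʳ (f x))
∑-unique {xs = y ∷ xs} {x} g f total (there x∈) gx≡1 with g y in gy
... | zero  = ∑-unique g f total x∈ gx≡1
... | suc n = contradiction (trans (sym gx≡1) (ℕ.n≤0⇒n≡0 (subst (g x ≤_) (ℕ.m+n≡0⇒n≡0 n (ℕ.suc-injective total)) (term≤∑ g x∈)))) λ ()

abstract
  occ-on-line : ∀ i t z → occ (z ⊞ t · dir i) (line (dir i) z) ≡ 1
  occ-on-line = from-yes (Fin.all? λ i → Fin.all? λ t → all-vec? 3 λ z → occ (z ⊞ t · dir i) (line (dir i) z) ℕ.≟ 1)

private
  abstract
    normalise : ∀ w → w ≢ 𝟘 → ∃ λ t → Any (t · w ≡_) directions
    normalise = from-yes (all-vec? 3 λ w → ¬? (w ≟V 𝟘) →-dec Fin.any? λ t → any? (t · w ≟V_) directions)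

    undo-scaling : ∀ (w : V 3) t → t · w ≢ 𝟘 → t · (t · w) ≡ w
    undo-scaling = from-yes (all-vec? 3 λ w → Fin.all? λ t → ¬? (t · w ≟V 𝟘) →-dec (t · (t · w) ≟V w))

    pivot-determines : ∀ i t → lookup (t · dir i) (pivot i) ≡ 0F → t · dir i ≡ 𝟘
    pivot-determines = from-yes (Fin.all? λ i → Fin.all? λ t → (lookup (t · dir i) (pivot i) Fin.≟ 0F) →-dec (t · dir i ≟V 𝟘))

    square : ∀ x → x ≢ 0F → x ⊗ x ≡ 1F
    square = from-yes (Fin.all? λ x → ¬? (x Fin.≟ 0F) →-dec (x ⊗ x Fin.≟ 1F))

    add-difference : ∀ {n} (w z : V n) → w ≡ z ⊞ (w ⊞ 2F · z)
    add-difference []      []      = refl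
    add-difference (a ∷ w) (b ∷ z) = cong₂ _∷_ (lemma a b) (add-difference w z)
      where
      lemma : ∀ a b → a ≡ b ⊕ (a ⊕ 2F ⊗ b)
      lemma = from-yes (Fin.all? λ a → Fin.all? λ b → a Fin.≟ b ⊕ (a ⊕ 2F ⊗ b))

    triple : ∀ a → a ⊕ 2F ⊗ a ≡ 0F
    triple = from-yes (Fin.all? λ a → a ⊕ 2F ⊗ a Fin.≟ 0F)

⊞-assoc : ∀ {n} (u v w : V n) → (u ⊞ v) ⊞ w ≡ u ⊞ (v ⊞ w)
⊞-assoc []      []      []      = refl
⊞-assoc (a ∷ u) (b ∷ v) (c ∷ w) = cong₂ _∷_ (⊕-assoc a b c) (⊞-assoc u v w)

·-double : ∀ {n} (v : V n) → v ⊞ v ≡ 2F · v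
·-double v = trans (cong₂ _⊞_ (sym (·-identityˡ v)) (sym (·-identityˡ v))) (sym (·-distribʳ v 1F 1F))

∈line : ∀ {d z v} → v ∈ line d z → ∃ λ t → v ≡ z ⊞ t · d
∈line {d} {z} (here refl) = 0F , sym (trans (cong (z ⊞_) (·-zeroˡ d)) (⊞-identityʳ z))
∈line {d} {z} (there (here refl)) = 1F , trans (⊞′≡⊞ z d) (cong (z ⊞_) (sym (·-identityˡ d)))
∈line {d} {z} (there (there (here refl))) = 2F , trans (trans (⊞′≡⊞ (z ⊞′ d) d) (cong (_⊞ d) (⊞′≡⊞ z d)))
                                                       (trans (⊞-assoc z d d) (cong (z ⊞_) (·-double d)))

dir∈directions : ∀ i → dir i ∈ directions
dir∈directions i = there (∈-map⁺ dir {xs = fins} (once⇒∈ fins i (fins-once i)))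

directions-cases : ∀ {u} → u ∈ directions → u ≡ e₃ ⊎ ∃ λ j → u ≡ dir j
directions-cases (here eq)  = inj₁ eq
directions-cases (there u∈) = let j , _ , eq = ∈-map⁻ dir {xs = fins} u∈ in inj₂ (j , eq)

-- One line for each direction other than e₃: its hyperplanes are spanned by
-- (1, 0, x i), (0, 1, y i) and (0, 0, dir i).
record Arrangement (R : List (Pair 5)) : Set where
  field
    r     : Fin 12 → Pair 5
    cover : ∀ h → killedIn R h ≡ ∑ fins λ i → κ h (r i)
    from  : ∀ {p} i h → p ∈ R → Killed (on₃ (dir i)) p → Killed h p → Killed h (r i)
    dir∈  : ∀ i → Killed (on₃ (dir i)) (r i)
    uniq  : ∀ i w → Killed (on₃ w) (r i) → ∃ λ t → w ≡ t · dir i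
    r∈    : ∀ i → r i ∈ R

module _ {R : List (Pair 5)} (good : Good R) (e₃-missing : killedIn R (on₃ e₃) ≡ 0) where
  open Good good

  private
    each-once : ∀ i → killedIn R (on₃ (dir i)) ≡ 1
    each-once i = ∑-squeeze fins {λ i → killedIn R (on₃ (dir i))} {λ _ → 1}
      (λ {j} _ → on (dir j) (directions≢𝟘 {dir j} (dir∈directions j)))
      (ℕ.≤-reflexive (sym total)) (once⇒∈ fins i (fins-once i))
      where
      total : ∑ fins (λ i → killedIn R (on₃ (dir i))) ≡ 12
      total = trans (sym (∑-map dir fins (λ w → killedIn R (on₃ w))))
        (trans (cong (_+ ∑ (List.map dir fins) (λ w → killedIn R (on₃ w))) (sym e₃-missing)) (∑-directions good))

    abstract
      holder : ∀ i → ∃ λ p → p ∈ R × 1 ≤ κ (on₃ (dir i)) p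
      holder i = ∑≥1⇒∃ R _ (ℕ.≤-reflexive (sym (each-once i)))

    r : Fin 12 → Pair 5
    r i = proj₁ (holder i)

    r∈ : ∀ i → r i ∈ R
    r∈ i = proj₁ (proj₂ (holder i))

    dir∈ : ∀ i → Killed (on₃ (dir i)) (r i)
    dir∈ i = χ≥1 (killed? (on₃ (dir i)) (r i)) (proj₂ (proj₂ (holder i)))

    sum-at : ∀ {p} i (f : Pair 5 → ℕ) → p ∈ R → Killed (on₃ (dir i)) p → ∑ R (λ q → κ (on₃ (dir i)) q * f q) ≡ f p
    sum-at {p} i f p∈ k = ∑-unique (κ (on₃ (dir i))) f (each-once i) p∈ (χ-yes (killed? (on₃ (dir i)) p) k)

    e₃-not-killed : ∀ {p} → p ∈ R → κ (on₃ e₃) p ≡ 0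
    e₃-not-killed p∈ = ℕ.n≤0⇒n≡0 (subst (_ ≤_) e₃-missing (term≤∑ (κ (on₃ e₃)) p∈))

    one-direction : ∀ {p} → p ∈ R → ∑ fins (λ i → κ (on₃ (dir i)) p) ≡ 1
    one-direction {p} p∈ = trans (sym (∑-map dir fins (λ w → κ (on₃ w) p)))
      (trans (cong (_+ ∑ (List.map dir fins) (λ w → κ (on₃ w) p)) (sym (e₃-not-killed p∈))) (multiplicity≡1 good p∈))

    cover : ∀ h → killedIn R h ≡ ∑ fins λ i → κ h (r i)
    cover h = begin
      ∑ R (κ h)                                                  ≡⟨ ∑-cong-∈ R (λ {p} p∈ → sym (trans (cong (_* κ h p) (one-direction {p} p∈)) (ℕ.*-identityˡ (κ h p)))) ⟩
      ∑ R (λ p → ∑ fins (λ i → κ (on₃ (dir i)) p) * κ h p)       ≡⟨ ∑-cong R (λ p → sym (∑-*ʳ (κ h p) fins λ i → κ (on₃ (dir i)) p)) ⟩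
      ∑ R (λ p → ∑ fins (λ i → κ (on₃ (dir i)) p * κ h p))       ≡⟨ ∑-swap R fins (λ p i → κ (on₃ (dir i)) p * κ h p) ⟩
      ∑ fins (λ i → ∑ R (λ p → κ (on₃ (dir i)) p * κ h p))       ≡⟨ ∑-cong fins (λ i → sum-at i (κ h) (r∈ i) (dir∈ i)) ⟩
      ∑ fins (λ i → κ h (r i))                                   ∎
      where open ≡-Reasoning

    -- Among the lines of direction `dir i` the sum of `κ h` has a single term; evaluating it at `p`
    -- and at `r i` gives the same number, so the two pairs need not be compared.
    from : ∀ {p} i h → p ∈ R → Killed (on₃ (dir i)) p → Killed h p → Killed h (r i)
    from {p} i h p∈ d k = χ≥1 (killed? h (r i)) (ℕ.≤-reflexive (sym
      (trans (sym (sum-at i (κ h) (r∈ i) (dir∈ i))) (trans (sum-at i (κ h) p∈ d) (χ-yes (killed? h p) k)))))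

    scaled : ∀ i t w → Killed (on₃ w) (r i) → Killed (on₃ (t · w)) (r i)
    scaled i t w k = subst (λ c → Killed (c ∷ c ∷ t · w) (r i)) (⊗-zeroʳ t) (killed-· t (r i) k)

    same-direction : ∀ i j → Killed (on₃ (dir j)) (r i) → i ≡ j
    same-direction i j k with i Fin.≟ j
    ... | yes i≡j = i≡j
    ... | no i≢j = contradiction (ℕ.≤-trans two (ℕ.≤-reflexive (one-direction (r∈ i)))) λ { (s≤s ()) }
      where
      below : ∀ m → χ (i Fin.≟ m) + χ (j Fin.≟ m) ≤ κ (on₃ (dir m)) (r i)
      below m with i Fin.≟ m | j Fin.≟ m
      ... | yes refl | yes refl = contradiction refl i≢j
      ... | yes refl | no _     = ℕ.≤-reflexive (sym (χ-yes (killed? (on₃ (dir i)) (r i)) (dir∈ i)))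
      ... | no _     | yes refl = ℕ.≤-reflexive (sym (χ-yes (killed? (on₃ (dir j)) (r i)) k))
      ... | no _     | no _     = z≤n
      two : 2 ≤ ∑ fins (λ m → κ (on₃ (dir m)) (r i))
      two = begin
        2                                                                     ≡⟨ cong₂ _+_ (fins-once i) (fins-once j) ⟨
        ∑ fins (λ m → χ (i Fin.≟ m)) + ∑ fins (λ m → χ (j Fin.≟ m))           ≡⟨ ∑-+ fins (λ m → χ (i Fin.≟ m)) (λ m → χ (j Fin.≟ m)) ⟨
        ∑ fins (λ m → χ (i Fin.≟ m) + χ (j Fin.≟ m))                          ≤⟨ ∑-mono fins (λ {m} _ → below m) ⟩
        ∑ fins (λ m → κ (on₃ (dir m)) (r i))                                  ∎
        where open ℕ.≤-Reasoning

    -- Scaled into `directions`, a nonzero `w` cannot be `e₃`, which no line has, nor `dir j` for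
    -- another `j`, because every line has a single direction.
    uniq : ∀ i w → Killed (on₃ w) (r i) → ∃ λ t → w ≡ t · dir i
    uniq i w k = by-cases (w ≟V 𝟘)
      where
      by-cases : Dec (w ≡ 𝟘) → ∃ λ t → w ≡ t · dir i
      by-cases (yes w≡0) = 0F , trans w≡0 (sym (·-zeroˡ (dir i)))
      by-cases (no w≢0)  = found (proj₁ (normalise w w≢0)) (proj₂ (normalise w w≢0))
        where
        found : ∀ t → t · w ∈ directions → ∃ λ t → w ≡ t · dir i
        found t tw∈ = by-direction (directions-cases tw∈)
          where
          by-direction : t · w ≡ e₃ ⊎ (∃ λ j → t · w ≡ dir j) → ∃ λ t → w ≡ t · dir i
          by-direction (inj₁ tw≡e₃) = contradiction
            (trans (sym (χ-yes (killed? (on₃ e₃) (r i)) (subst (λ u → Killed (on₃ u) (r i)) tw≡e₃ (scaled i t w k)))) (e₃-not-killed (r∈ i))) λ ()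
          by-direction (inj₂ (j , tw≡dⱼ)) = t , trans (sym (undo-scaling w t (directions≢𝟘 {t · w} tw∈)))
            (cong (t ·_) (trans tw≡dⱼ (cong dir (sym (same-direction i j (subst (λ u → Killed (on₃ u) (r i)) tw≡dⱼ (scaled i t w k)))))))

  arrangement : Arrangement R
  arrangement = record { r = r ; cover = cover ; from = from ; dir∈ = dir∈ ; uniq = uniq ; r∈ = r∈ }

module Lines {R : List (Pair 5)} (arr : Arrangement R) where
  open Arrangement arr

  on-pivot : ∀ i w → Killed (on₃ w) (r i) → lookup w (pivot i) ≡ 0F → w ≡ 𝟘
  on-pivot i w k p with uniq i w k
  ... | t , refl = pivot-determines i t p

  -- The fourth and fifth equation force one of the first two coordinates and the pivot coordinate to vanish.
  private
    solve : ∀ i (j : Fin 5) → ∃ λ h → h ≢ 𝟘 × Killed h (r i) × lookup h j ≡ 0F × lookup h (suc (suc (pivot i))) ≡ 0F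
    solve i j with orthogonal-exists (proj₁ (r i) ∷ proj₂ (r i) ∷ unit j ∷ unit (suc (suc (pivot i))) ∷ []) ℕ.≤-refl
    ... | h , h≢0 , a ∷ b ∷ c ∷ d ∷ [] = h , h≢0 , (a , b) , trans (sym (dot-unit h j)) c ,
            trans (sym (dot-unit h (suc (suc (pivot i))))) d

    scaled-pivot : ∀ c (w : V 3) j → lookup w j ≡ 0F → lookup (c · w) j ≡ 0F
    scaled-pivot c w j p = trans (lookup-· c w j) (trans (cong (c ⊗_) p) (⊗-zeroʳ c))

  -- If l₁ vanished, `w` would be a multiple of `dir i` with pivot coordinate zero, hence zero.
  -- Multiplication by l₁ then makes the first entry its square, which is 1.
  x-exists : ∀ i → ∃ λ x → Killed (1F ∷ 0F ∷ x) (r i) × lookup x (pivot i) ≡ 0F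
  x-exists i with solve i 1F
  ... | l₁ ∷ .0F ∷ w , h≢0 , k , refl , p with l₁ ≟F 0F
  ...   | yes refl = contradiction (cong (λ u → on₃ u) (on-pivot i w k p)) h≢0
  ...   | no l₁≢0  = l₁ · w , subst₂ (λ a b → Killed (a ∷ b ∷ l₁ · w) (r i)) (square l₁ l₁≢0) (⊗-zeroʳ l₁) (killed-· l₁ (r i) k) ,
                     scaled-pivot l₁ w (pivot i) p

  y-exists : ∀ i → ∃ λ y → Killed (0F ∷ 1F ∷ y) (r i) × lookup y (pivot i) ≡ 0F
  y-exists i with solve i 0F
  ... | .0F ∷ l₂ ∷ w , h≢0 , k , refl , p with l₂ ≟F 0F
  ...   | yes refl = contradiction (cong (λ u → on₃ u) (on-pivot i w k p)) h≢0
  ...   | no l₂≢0  = l₂ · w , subst₂ (λ a b → Killed (a ∷ b ∷ l₂ · w) (r i)) (⊗-zeroʳ l₂) (square l₂ l₂≢0) (killed-· l₂ (r i) k) ,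
                     scaled-pivot l₂ w (pivot i) p

  x y : Fin 12 → V 3
  x i = proj₁ (x-exists i)
  y i = proj₁ (y-exists i)

  translate : ∀ i t {l₁ l₂ z} → Killed (l₁ ∷ l₂ ∷ z) (r i) → Killed (l₁ ∷ l₂ ∷ z ⊞ t · dir i) (r i)
  translate i t {l₁} {l₂} {z} k = subst₂ (λ a b → Killed (a ∷ b ∷ z ⊞ t · dir i) (r i)) (add0 l₁) (add0 l₂)
    (killed-⊞ (r i) k (killed-· t (r i) (dir∈ i)))
    where
    add0 : ∀ l → l ⊕ t ⊗ 0F ≡ l
    add0 l = trans (cong (l ⊕_) (⊗-zeroʳ t)) (⊕-identityʳ l)

  same-line : ∀ i {l₁ l₂ z w} → Killed (l₁ ∷ l₂ ∷ z) (r i) → Killed (l₁ ∷ l₂ ∷ w) (r i) → ∃ λ t → w ≡ z ⊞ t · dir i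
  same-line i {l₁} {l₂} {z} {w} kz kw with uniq i (w ⊞ 2F · z)
    (subst₂ (λ a b → Killed (a ∷ b ∷ w ⊞ 2F · z) (r i)) (triple l₁) (triple l₂) (killed-⊞ (r i) kw (killed-· 2F (r i) kz)))
  ... | t , eq = t , trans (add-difference w z) (cong (z ⊞_) eq)

  -- Two functionals that kill `r i` and agree in l₁ and l₂ differ by a multiple of `dir i`, so
  -- within a class they form an affine line.
  occ-line : ∀ i {l₁ l₂ z} → Killed (l₁ ∷ l₂ ∷ z) (r i) → ∀ w → occ w (line (dir i) z) ≡ κ (l₁ ∷ l₂ ∷ w) (r i)
  occ-line i {l₁} {l₂} {z} kz w = by-cases (killed? (l₁ ∷ l₂ ∷ w) (r i))
    where
    meets : 1 ≤ occ w (line (dir i) z) → Killed (l₁ ∷ l₂ ∷ w) (r i)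
    meets le =
      let v , v∈ , w≡v = ∑≥1⇒∃ (line (dir i) z) (λ v → χ (w ≟V v)) le
          t , v≡ = ∈line v∈
      in subst (λ u → Killed (l₁ ∷ l₂ ∷ u) (r i)) (sym (trans (χ≥1 (w ≟V v) w≡v) v≡)) (translate i t kz)
    by-cases : Dec (Killed (l₁ ∷ l₂ ∷ w) (r i)) → occ w (line (dir i) z) ≡ κ (l₁ ∷ l₂ ∷ w) (r i)
    by-cases (yes kw) = trans (let t , eq = same-line i kz kw in subst (λ u → occ u (line (dir i) z) ≡ 1) (sym eq) (occ-on-line i t z))
                              (sym (χ-yes (killed? (l₁ ∷ l₂ ∷ w) (r i)) kw))
    by-cases (no ¬kw) = trans (ℕ.n<1⇒n≡0 (ℕ.≰⇒> λ le → ¬kw (meets le))) (sym (χ-no (killed? (l₁ ∷ l₂ ∷ w) (r i)) ¬kw))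

  count-lines : ∀ {l₁ l₂} (z : Fin 12 → V 3) → (∀ i → Killed (l₁ ∷ l₂ ∷ z i) (r i)) →
                ∀ w → ∑ fins (λ i → occ w (line (dir i) (z i))) ≡ killedIn R (l₁ ∷ l₂ ∷ w)
  count-lines {l₁} {l₂} z kz w = trans (∑-cong fins λ i → occ-line i (kz i) w) (sym (cover (l₁ ∷ l₂ ∷ w)))

  combine : ∀ i l₁ l₂ → Killed (l₁ ∷ l₂ ∷ l₁ · x i ⊞ l₂ · y i) (r i)
  combine i l₁ l₂ = subst₂ (λ a b → Killed (a ∷ b ∷ l₁ · x i ⊞ l₂ · y i) (r i)) (first l₁ l₂) (second l₁ l₂)
    (killed-⊞ (r i) (killed-· l₁ (r i) (proj₁ (proj₂ (x-exists i)))) (killed-· l₂ (r i) (proj₁ (proj₂ (y-exists i)))))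
    where
    first : ∀ a b → a ⊗ 1F ⊕ b ⊗ 0F ≡ a
    first = from-yes (Fin.all? λ a → Fin.all? λ b → a ⊗ 1F ⊕ b ⊗ 0F Fin.≟ a)
    second : ∀ a b → a ⊗ 0F ⊕ b ⊗ 1F ≡ b
    second = from-yes (Fin.all? λ a → Fin.all? λ b → a ⊗ 0F ⊕ b ⊗ 1F Fin.≟ b)

-- Singly covered hyperplanes

classes : List (F × F)
classes = (1F , 0F) ∷ (0F , 1F) ∷ (1F , 1F) ∷ (1F , 2F) ∷ []

abstract
  points-once : ∀ v → ∑ points (λ w → χ (w ≟V v)) ≡ 1
  points-once = from-yes (all-vec? 3 λ v → ∑ points (λ w → χ (w ≟V v)) ℕ.≟ 1)

  parallel⇒≡ : ∀ i j t u → t · dir i ≡ u · dir j → t · dir i ≢ 𝟘 → i ≡ j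
  parallel⇒≡ = from-yes (Fin.all? λ i → Fin.all? λ j → Fin.all? λ t → Fin.all? λ u →
    (t · dir i ≟V u · dir j) →-dec (¬? (t · dir i ≟V 𝟘) →-dec (i Fin.≟ j)))

  to-class : ∀ l₁ l₂ → l₁ ∷ l₂ ∷ [] ≢ 𝟘 → ∃ λ s → Any ((s ⊗ l₁ , s ⊗ l₂) ≡_) classes
  to-class = from-yes (Fin.all? λ l₁ → Fin.all? λ l₂ → ¬? (l₁ ∷ l₂ ∷ [] ≟V 𝟘) →-dec
    Fin.any? λ s → any? (≡-dec Fin._≟_ Fin._≟_ (s ⊗ l₁ , s ⊗ l₂)) classes)

class-nonzero : ∀ {l₁ l₂} → (l₁ , l₂) ∈ classes → l₁ ∷ l₂ ∷ [] ≢ 𝟘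
class-nonzero (here refl)                         ()
class-nonzero (there (here refl))                 ()
class-nonzero (there (there (here refl)))         ()
class-nonzero (there (there (there (here refl)))) ()

∑-occ : ∀ vs → ∑ points (λ w → occ w vs) ≡ length vs
∑-occ vs = trans (∑-swap points vs λ w v → χ (w ≟V v)) (trans (∑-cong vs points-once) (trans (∑-const 1 vs) (ℕ.*-identityʳ _)))

odd-+ : ∀ m n → odd (m + n) ≡ odd m xor odd n
odd-+ zero    n = refl
odd-+ (suc m) n = trans (cong not (odd-+ m n)) (Bool.not-distribˡ-xor (odd m) (odd n))

odd-double : ∀ n → odd (2 * n) ≡ false
odd-double n = trans (cong (λ k → odd (n + k)) (ℕ.+-identityʳ n)) (trans (odd-+ n n) (Bool.xor-same (odd n)))

data Singles (f : V 3 → ℕ) : Set where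
  none : (∀ w → f w ≢ 1) → Singles f
  two  : ∀ s s′ → s ≢ s′ → f s ≡ 1 → f s′ ≡ 1 → (∀ w → f w ≡ 1 → w ≡ s ⊎ w ≡ s′) → Singles f

module _ (f : V 3 → ℕ) where

  numberOfSingles : ℕ
  numberOfSingles = ∑ points λ w → χ (f w ℕ.≟ 1)

  private
    three : ∀ a b c → a ≢ b → a ≢ c → b ≢ c → f a ≡ 1 → f b ≡ 1 → f c ≡ 1 → 3 ≤ numberOfSingles
    three a b c a≢b a≢c b≢c fa fb fc = subst (_≤ numberOfSingles) total (∑-mono points (λ {w} _ → below w))
      where
      total : ∑ points (λ w → χ (w ≟V a) + (χ (w ≟V b) + χ (w ≟V c))) ≡ 3
      total = trans (∑-+ points (λ w → χ (w ≟V a)) (λ w → χ (w ≟V b) + χ (w ≟V c)))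
        (cong₂ _+_ (points-once a) (trans (∑-+ points (λ w → χ (w ≟V b)) (λ w → χ (w ≟V c))) (cong₂ _+_ (points-once b) (points-once c))))
      hit : ∀ w → f w ≡ 1 → 1 ≤ χ (f w ℕ.≟ 1)
      hit w fw = ℕ.≤-reflexive (sym (χ-yes (f w ℕ.≟ 1) fw))
      below : ∀ w → χ (w ≟V a) + (χ (w ≟V b) + χ (w ≟V c)) ≤ χ (f w ℕ.≟ 1)
      below w with w ≟V a | w ≟V b | w ≟V c
      ... | yes refl | yes p    | _        = contradiction p a≢b
      ... | yes refl | no _     | yes p    = contradiction p a≢c
      ... | yes refl | no _     | no _     = hit w fa
      ... | no _     | yes refl | yes p    = contradiction p b≢c
      ... | no _     | yes refl | no _     = hit w fb
      ... | no _     | no _     | yes refl = hit w fc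
      ... | no _     | no _     | no _     = z≤n

  singles : numberOfSingles ≡ 0 ⊎ numberOfSingles ≡ 2 → Singles f
  singles (inj₁ zero′) = none λ w fw → contradiction
    (ℕ.≤-trans (ℕ.≤-reflexive (sym (χ-yes (f w ℕ.≟ 1) fw))) (ℕ.≤-trans (term≤∑ (λ w → χ (f w ℕ.≟ 1)) (points-complete w)) (ℕ.≤-reflexive zero′))) λ ()
  singles (inj₂ two′) = from-first (∑≥1⇒∃ points (λ w → χ (f w ℕ.≟ 1)) (subst (1 ≤_) (sym two′) (s≤s z≤n)))
    where
    from-first : (∃ λ s → s ∈ points × 1 ≤ χ (f s ℕ.≟ 1)) → Singles f
    from-first (s , _ , p) = from-second (∑<∑⇒∃ points (λ w → χ (w ≟V s)) (λ w → χ (f w ℕ.≟ 1))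
                               (subst₂ _<_ (sym (points-once s)) (sym two′) ℕ.≤-refl))
      where
      fs = χ≥1 (f s ℕ.≟ 1) p
      from-second : (∃ λ s′ → s′ ∈ points × χ (s′ ≟V s) < χ (f s′ ℕ.≟ 1)) → Singles f
      from-second (s′ , _ , lt) = two s s′ s≢s′ fs fs′ only
        where
        fs′ = χ≥1 (f s′ ℕ.≟ 1) (ℕ.≤-trans (s≤s z≤n) lt)
        s≢s′ : s ≢ s′
        s≢s′ refl = contradiction (ℕ.≤-trans (subst (_< χ (f s ℕ.≟ 1)) (χ-yes (s ≟V s) refl) lt) (χ≤1 (f s ℕ.≟ 1))) λ { (s≤s ()) }
        only : ∀ w → f w ≡ 1 → w ≡ s ⊎ w ≡ s′
        only w fw with w ≟V s | w ≟V s′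
        ... | yes p | _     = inj₁ p
        ... | _     | yes p = inj₂ p
        ... | no p  | no q  = contradiction (ℕ.≤-trans (three s s′ w s≢s′ (λ eq → p (sym eq)) (λ eq → q (sym eq)) fs fs′ fw) (ℕ.≤-reflexive two′))
                                            λ { (s≤s (s≤s ())) }

module Counting {R : List (Pair 5)} (good : Good R) (arr : Arrangement R) where
  open Good good
  open Arrangement arr
  open Lines arr

  c : F × F → V 3 → ℕ
  c (l₁ , l₂) w = killedIn R (l₁ ∷ l₂ ∷ w)

  κᵢ : F × F → V 3 → Fin 12 → ℕ
  κᵢ (l₁ , l₂) w i = κ (l₁ ∷ l₂ ∷ w) (r i)

  c-cover : ∀ l w → c l w ≡ ∑ fins (κᵢ l w)
  c-cover (l₁ , l₂) w = cover (l₁ ∷ l₂ ∷ w)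

  c≤2 : ∀ {l} → l ∈ classes → ∀ w → c l w ≤ 2
  c≤2 {l₁ , l₂} l∈ w = off l₁ l₂ w (class-nonzero l∈)

  three-points : ∀ l i → ∑ points (λ w → κᵢ l w i) ≡ 3
  three-points (l₁ , l₂) i = trans (∑-cong points λ w → sym (occ-line i (combine i l₁ l₂) w))
                                   (∑-occ (line (dir i) (l₁ · x i ⊞ l₂ · y i)))

  ∑-c : ∀ l → ∑ points (c l) ≡ 36
  ∑-c l = trans (∑-cong points (c-cover l)) (trans (∑-swap points fins (κᵢ l)) (∑-cong fins (three-points l)))

  meet : Fin 12 → Fin 12 → F × F → ℕ
  meet i j l = ∑ points λ w → κᵢ l w i * κᵢ l w j

  ∑-c² : ∀ l → ∑ points (λ w → c l w * c l w) ≡ ∑ fins (λ i → ∑ fins (λ j → meet i j l))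
  ∑-c² l = begin
    ∑ points (λ w → c l w * c l w)                                         ≡⟨ ∑-cong points expand ⟩
    ∑ points (λ w → ∑ fins (λ i → ∑ fins (λ j → κᵢ l w i * κᵢ l w j)))     ≡⟨ ∑-swap points fins (λ w i → ∑ fins (λ j → κᵢ l w i * κᵢ l w j)) ⟩
    ∑ fins (λ i → ∑ points (λ w → ∑ fins (λ j → κᵢ l w i * κᵢ l w j)))     ≡⟨ ∑-cong fins (λ i → ∑-swap points fins (λ w j → κᵢ l w i * κᵢ l w j)) ⟩
    ∑ fins (λ i → ∑ fins (λ j → meet i j l))                               ∎
    where
    open ≡-Reasoning
    expand : ∀ w → c l w * c l w ≡ ∑ fins (λ i → ∑ fins (λ j → κᵢ l w i * κᵢ l w j))
    expand w = trans (cong₂ _*_ (c-cover l w) (c-cover l w))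
      (trans (sym (∑-*ʳ (∑ fins (κᵢ l w)) fins (κᵢ l w))) (∑-cong fins λ i → sym (∑-*ˡ (κᵢ l w i) fins (κᵢ l w))))

  -- Two lines span at most four dimensions, so some functional kills both. It cannot have l₁ = l₂ =
  -- 0, since the two directions differ, and scaling moves it into one of the four classes.
  shared : ∀ i j → i ≢ j → ∃ λ l₁ → ∃ λ l₂ → (l₁ , l₂) ∈ classes × ∃ λ w → Killed (l₁ ∷ l₂ ∷ w) (r i) × Killed (l₁ ∷ l₂ ∷ w) (r j)
  shared i j i≢j with orthogonal-exists (proj₁ (r i) ∷ proj₂ (r i) ∷ proj₁ (r j) ∷ proj₂ (r j) ∷ []) ℕ.≤-refl
  ... | l₁ ∷ l₂ ∷ w , h≢0 , a ∷ b ∷ a′ ∷ b′ ∷ [] = by-cases (l₁ ∷ l₂ ∷ [] ≟V 𝟘)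
    where
    Shared : Set
    Shared = ∃ λ l₁ → ∃ λ l₂ → (l₁ , l₂) ∈ classes × ∃ λ w → Killed (l₁ ∷ l₂ ∷ w) (r i) × Killed (l₁ ∷ l₂ ∷ w) (r j)
    kᵢ : Killed (l₁ ∷ l₂ ∷ w) (r i)
    kᵢ = a , b
    kⱼ : Killed (l₁ ∷ l₂ ∷ w) (r j)
    kⱼ = a′ , b′
    by-cases : Dec (l₁ ∷ l₂ ∷ [] ≡ 𝟘) → Shared
    by-cases (no l≢0) = let s , s∈ = to-class l₁ l₂ l≢0 in
      s ⊗ l₁ , s ⊗ l₂ , s∈ , s · w , killed-· s (r i) kᵢ , killed-· s (r j) kⱼ
    by-cases (yes l≡0) = contradiction (parallel⇒≡ i j t u (trans (sym w≡tdᵢ) w≡udⱼ) (λ eq → h≢0 (cong₂ _∷_ (cong head l≡0) (cong₂ _∷_ (cong (λ v → head (tail v)) l≡0) (trans w≡tdᵢ eq))))) i≢j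
      where
      on-W : ∀ {p} → Killed (l₁ ∷ l₂ ∷ w) p → Killed (on₃ w) p
      on-W {p} = subst₂ (λ a b → Killed (a ∷ b ∷ w) p) (cong head l≡0) (cong (λ v → head (tail v)) l≡0)
      t = proj₁ (uniq i w (on-W kᵢ))
      u = proj₁ (uniq j w (on-W kⱼ))
      w≡tdᵢ : w ≡ t · dir i
      w≡tdᵢ = proj₂ (uniq i w (on-W kᵢ))
      w≡udⱼ : w ≡ u · dir j
      w≡udⱼ = proj₂ (uniq j w (on-W kⱼ))

  private
    least-meet : Fin 12 → Fin 12 → ℕ
    least-meet i j = if does (i Fin.≟ j) then 12 else 1

    idem : ∀ {a} {A : Set a} (d : Dec A) → χ d * χ d ≡ χ d
    idem (yes _) = refl
    idem (no _)  = refl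

    meets : ∀ i j → least-meet i j ≤ ∑ classes (meet i j)
    meets i j = by-cases (i Fin.≟ j)
      where
      self : ∀ l → meet i i l ≡ 3
      self l@(l₁ , l₂) = trans (∑-cong points λ w → idem (killed? (l₁ ∷ l₂ ∷ w) (r i))) (three-points l i)
      by-cases : (d : Dec (i ≡ j)) → (if does d then 12 else 1) ≤ ∑ classes (meet i j)
      by-cases (yes refl) = ℕ.≤-reflexive (sym (∑-cong classes self))
      by-cases (no i≢j) = let l₁ , l₂ , l∈ , w , kᵢ , kⱼ = shared i j i≢j in
        ℕ.≤-trans (ℕ.≤-trans (ℕ.≤-reflexive (sym (cong₂ _*_ (χ-yes (killed? (l₁ ∷ l₂ ∷ w) (r i)) kᵢ) (χ-yes (killed? (l₁ ∷ l₂ ∷ w) (r j)) kⱼ))))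
                             (term≤∑ (λ w → κᵢ (l₁ , l₂) w i * κᵢ (l₁ , l₂) w j) (points-complete w)))
                  (term≤∑ (meet i j) l∈)

    -- The squares count ordered pairs of lines by common hyperplanes: 4 · 3 for a line with itself
    -- and at least 1 for two different ones, which gives 12 · 12 + 12 · 11 = 276.
    squares : 276 ≤ ∑ classes (λ l → ∑ points (λ w → c l w * c l w))
    squares = begin
      276                                                              ≡⟨⟩
      ∑ fins (λ i → ∑ fins (λ j → least-meet i j))                     ≤⟨ ∑-mono fins (λ {i} _ → ∑-mono fins (λ {j} _ → meets i j)) ⟩
      ∑ fins (λ i → ∑ fins (λ j → ∑ classes (meet i j)))               ≡⟨ ∑-cong fins (λ i → ∑-swap fins classes (λ j l → meet i j l)) ⟩
      ∑ fins (λ i → ∑ classes (λ l → ∑ fins (λ j → meet i j l)))       ≡⟨ ∑-swap fins classes (λ i l → ∑ fins (λ j → meet i j l)) ⟩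
      ∑ classes (λ l → ∑ fins (λ i → ∑ fins (λ j → meet i j l)))       ≡⟨ ∑-cong classes (λ l → sym (∑-c² l)) ⟩
      ∑ classes (λ l → ∑ points (λ w → c l w * c l w))                 ∎
      where open ℕ.≤-Reasoning

    -- Summed over all points this expresses the number of singles as 2 ∑ c - ∑ c². With 36
    -- incidences in each of four spaces it is at most 288 - 276 = 12.
    single+square : ∀ n → n ≤ 2 → χ (n ℕ.≟ 1) + n * n ≡ 2 * n
    single+square 0 _ = refl
    single+square 1 _ = refl
    single+square 2 _ = refl
    single+square (suc (suc (suc _))) (s≤s (s≤s ()))

    single+pair : ∀ n → n ≤ 2 → χ (n ℕ.≟ 1) + 2 * χ (n ℕ.≟ 2) ≡ n
    single+pair 0 _ = refl
    single+pair 1 _ = refl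
    single+pair 2 _ = refl
    single+pair (suc (suc (suc _))) (s≤s (s≤s ()))

    few : ∑ classes (λ l → numberOfSingles (c l)) ≤ 12
    few = ℕ.+-cancelʳ-≤ 276 _ 12 (begin
      ∑ classes (λ l → numberOfSingles (c l)) + 276                    ≤⟨ ℕ.+-monoʳ-≤ (∑ classes (λ l → numberOfSingles (c l))) squares ⟩
      ∑ classes (λ l → numberOfSingles (c l)) + ∑ classes (λ l → ∑ points (λ w → c l w * c l w))
        ≡⟨ ∑-+ classes (λ l → numberOfSingles (c l)) (λ l → ∑ points (λ w → c l w * c l w)) ⟨
      ∑ classes (λ l → numberOfSingles (c l) + ∑ points (λ w → c l w * c l w))
        ≡⟨ ∑-cong-∈ classes (λ {l} l∈ → total l∈) ⟩
      ∑ classes (λ l → 72)                                             ≡⟨⟩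
      288                                                              ∎)
      where
      open ℕ.≤-Reasoning
      total : ∀ {l} → l ∈ classes → numberOfSingles (c l) + ∑ points (λ w → c l w * c l w) ≡ 72
      total {l} l∈ = trans (sym (∑-+ points (λ w → χ (c l w ℕ.≟ 1)) (λ w → c l w * c l w)))
        (trans (∑-cong points λ w → single+square (c l w) (c≤2 l∈ w)) (trans (∑-*ˡ 2 points (c l)) (cong (2 *_) (∑-c l))))

    even : ∀ {l} → l ∈ classes → odd (numberOfSingles (c l)) ≡ false
    even {l} l∈ = trans (sym (Bool.xor-identityʳ _)) (trans (cong (odd (numberOfSingles (c l)) xor_) (sym (odd-double pairs)))
      (trans (sym (odd-+ (numberOfSingles (c l)) (2 * pairs))) (cong odd total)))
      where
      pairs = ∑ points λ w → χ (c l w ℕ.≟ 2)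
      total : numberOfSingles (c l) + 2 * pairs ≡ 36
      total = trans (cong (numberOfSingles (c l) +_) (sym (∑-*ˡ 2 points λ w → χ (c l w ℕ.≟ 2))))
        (trans (sym (∑-+ points (λ w → χ (c l w ℕ.≟ 1)) (λ w → 2 * χ (c l w ℕ.≟ 2))))
          (trans (∑-cong points λ w → single+pair (c l w) (c≤2 l∈ w)) (∑-c l)))

    zero-or-two : ∀ n → n < 4 → odd n ≡ false → n ≡ 0 ⊎ n ≡ 2
    zero-or-two 0 _ _ = inj₁ refl
    zero-or-two 1 _ ()
    zero-or-two 2 _ _ = inj₂ refl
    zero-or-two 3 _ ()
    zero-or-two (suc (suc (suc (suc _)))) (s≤s (s≤s (s≤s (s≤s ())))) _

  -- Every line has 12 hyperplanes outside the removed one, and meets each of the other 11 in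
  -- exactly one of them; so there are only 12 singly covered hyperplanes in four classes.
  few-singles : ∃ λ l → l ∈ classes × Singles (c l)
  few-singles =
    let l , l∈ , lt = ∑<∑⇒∃ classes (λ l → numberOfSingles (c l)) (λ _ → 4) (s≤s (ℕ.≤-trans few (ℕ.m≤m+n 12 3)))
    in l , l∈ , singles (c l) (zero-or-two (numberOfSingles (c l)) lt (even l∈))

-- The directions besides `e₁` in the plane w₂ = 0, whose fourth direction is the missing `e₃`. The
-- shears used for normalising fix this plane pointwise, so its directions and its points are
-- enumerated.
horizontal : List (Fin 12)
horizontal = 7F ∷ # 10 ∷ []

verticalPlane : List (V 3)
verticalPlane = List.filter (λ s → ¬? (s ≟V 𝟘) ×-dec (lookup s 1F ≟F 0F)) points

-- Wrapping the equation keeps the type checker from unfolding symbolic searches.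
data Refuted (order : List (Fin 12)) (o : YOrder) (S : List (V 3)) (Q : Incidences) : Set where
  refuted-by : refute order o S Q ≡ true → Refuted order o S Q

every⇒All : ∀ {a p} {A : Set a} {P : A → Set p} (q : A → Bool) (xs : List A) → every q xs ≡ true → (∀ x → q x ≡ true → P x) → All P xs
every⇒All q []       eq f = []
every⇒All q (x ∷ xs) eq f = f x (proj₁ (∧-true eq)) ∷ every⇒All q xs (proj₂ (∧-true eq)) f

abstract
  -- No singles: a second line passes through the origin, either sheared to direction `e₂` or, in
  -- `run₂`, with a direction in the fixed plane.
  run₁ : Refuted order₁ yorder₁ [] ((0F , 𝟘) ∷ (1F , 𝟘) ∷ [])
  run₁ = refuted-by refl

  run₂ : All (λ i → Refuted order₂ yorder₁ [] ((0F , 𝟘) ∷ (i , 𝟘) ∷ [])) horizontal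
  run₂ = every⇒All (λ i → refute order₂ yorder₁ [] ((0F , 𝟘) ∷ (i , 𝟘) ∷ [])) horizontal refl (λ _ eq → refuted-by eq)

  -- Two singles, the second one outside the fixed plane and therefore sheared to `e₂`.
  run₃ : Refuted order₁ yorder₂ (𝟘 ∷ e₂ ∷ []) ((0F , 𝟘) ∷ [])
  run₃ = refuted-by refl

  -- Two singles in the fixed plane. The line through the second one leaves the plane and is sheared
  -- to direction `e₂`; in `run₅` its direction is in the plane but not `e₁`, and in `run₆` it is
  -- the line with direction `e₁`.
  run₄ : All (λ s → Refuted order₁ yorder₁ (𝟘 ∷ s ∷ []) ((0F , 𝟘) ∷ (1F , s) ∷ [])) verticalPlane
  run₄ = every⇒All (λ s → refute order₁ yorder₁ (𝟘 ∷ s ∷ []) ((0F , 𝟘) ∷ (1F , s) ∷ [])) verticalPlane refl (λ _ eq → refuted-by eq)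

  run₅ : All (λ s → All (λ i → Refuted order₂ yorder₁ (𝟘 ∷ s ∷ []) ((0F , 𝟘) ∷ (i , s) ∷ [])) horizontal) verticalPlane
  run₅ = every⇒All (λ s → every (λ i → refute order₂ yorder₁ (𝟘 ∷ s ∷ []) ((0F , 𝟘) ∷ (i , s) ∷ [])) horizontal) verticalPlane refl
    (λ s eq → every⇒All (λ i → refute order₂ yorder₁ (𝟘 ∷ s ∷ []) ((0F , 𝟘) ∷ (i , s) ∷ [])) horizontal eq (λ _ eq′ → refuted-by eq′))

  run₆ : All (λ s → Refuted order₁ yorder₁ (𝟘 ∷ s ∷ []) ((0F , 𝟘) ∷ (0F , s) ∷ [])) verticalPlane
  run₆ = every⇒All (λ s → refute order₁ yorder₁ (𝟘 ∷ s ∷ []) ((0F , 𝟘) ∷ (0F , s) ∷ [])) verticalPlane refl (λ _ eq → refuted-by eq)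

-- Reduction to the search

-- Formulated with members of `R` because each change of coordinates produces a new arrangement with
-- its own choice of the lines `r i`; the field `from` translates back.
Meets : List (Pair 5) → V 3 → V 3 → Set
Meets R d w = ∃ λ p → p ∈ R × Killed (on₃ d) p × Killed (1F ∷ 0F ∷ w) p

cover₁ : List (Pair 5) → V 3 → ℕ
cover₁ R w = killedIn R (1F ∷ 0F ∷ w)

record ListsSingles (R : List (Pair 5)) (S : List (V 3)) : Set where
  field
    sound    : ∀ {s} → s ∈ S → cover₁ R s ≡ 1
    complete : ∀ w → cover₁ R w ≡ 1 → w ∈ S
    unique   : ∀ {s} → s ∈ S → ∑ S (λ u → χ (s ≟V u)) ≡ 1

private
  abstract
    rep-shift : ∀ i v → ∃ λ t → lookup (v ⊞ t · dir i) (pivot i) ≡ 0F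
    rep-shift = from-yes (Fin.all? λ i → all-vec? 3 λ v → Fin.any? λ t → lookup (v ⊞ t · dir i) (pivot i) Fin.≟ 0F)

    half-up-to-sign : ∀ (v : V 3) → lookup v 0F ≡ 0F → Any (v ≡_) half ⊎ Any (2F · v ≡_) half
    half-up-to-sign = from-yes (all-vec? 3 λ v → (lookup v 0F Fin.≟ 0F) →-dec (any? (v ≟V_) half ⊎-dec any? (2F · v ≟V_) half))

    line-parity : ∀ a b v → odd (χ (a ≟F v) + (χ (a ⊕ b ≟F v) + (χ (a ⊕ b ⊕ b ≟F v) + 0))) ≡ odd (if does (b ≟F 0F) then χ (a ≟F v) else 1)
    line-parity = from-yes (Fin.all? λ a → Fin.all? λ b → Fin.all? λ v →
      odd (χ (a ≟F v) + (χ (a ⊕ b ≟F v) + (χ (a ⊕ b ⊕ b ≟F v) + 0))) Bool.≟ odd (if does (b ≟F 0F) then χ (a ≟F v) else 1))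

    difference : ∀ a b → (a ⊕ b) ⊕ 2F ⊗ a ≡ b
    difference = from-yes (Fin.all? λ a → Fin.all? λ b → (a ⊕ b) ⊕ 2F ⊗ a Fin.≟ b)

    restore : ∀ a b c → a ⊕ ((b ⊕ 2F ⊗ a) ⊕ c) ≡ b ⊕ c
    restore = from-yes (Fin.all? λ a → Fin.all? λ b → Fin.all? λ c → a ⊕ ((b ⊕ 2F ⊗ a) ⊕ c) Fin.≟ b ⊕ c)

    regroup : ∀ a b x y w c → (a ⊗ x ⊕ b ⊗ (w ⊕ y)) ⊕ c ≡ ((a ⊗ x ⊕ b ⊗ y) ⊕ c) ⊕ b ⊗ w
    regroup = from-yes (Fin.all? λ a → Fin.all? λ b → Fin.all? λ x → Fin.all? λ y → Fin.all? λ w → Fin.all? λ c →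
      (a ⊗ x ⊕ b ⊗ (w ⊕ y)) ⊕ c Fin.≟ ((a ⊗ x ⊕ b ⊗ y) ⊕ c) ⊕ b ⊗ w)

    second-nonzero : ∀ a b l → b ≢ 0F → l ≢ 0F → a ⊗ 0F ⊕ b ⊗ l ≢ 0F
    second-nonzero = from-yes (Fin.all? λ a → Fin.all? λ b → Fin.all? λ l →
      ¬? (b Fin.≟ 0F) →-dec (¬? (l Fin.≟ 0F) →-dec ¬? (a ⊗ 0F ⊕ b ⊗ l Fin.≟ 0F)))

  difference-V : ∀ {n} (w y : V n) → (w ⊞ y) ⊞ 2F · w ≡ y
  difference-V []      []      = refl
  difference-V (a ∷ w) (b ∷ y) = cong₂ _∷_ (difference a b) (difference-V w y)

  restore-V : ∀ {n} (w z c : V n) → w ⊞ ((z ⊞ 2F · w) ⊞ c) ≡ z ⊞ c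
  restore-V []      []      []      = refl
  restore-V (a ∷ w) (b ∷ z) (c ∷ d) = cong₂ _∷_ (restore a b c) (restore-V w z d)

  regroup-V : ∀ {n} a b (x y w c : V n) → (a · x ⊞ b · (w ⊞ y)) ⊞ c ≡ ((a · x ⊞ b · y) ⊞ c) ⊞ b · w
  regroup-V a b []      []      []      []      = refl
  regroup-V a b (x ∷ xs) (y ∷ ys) (w ∷ ws) (c ∷ cs) = cong₂ _∷_ (regroup a b x y w c) (regroup-V a b xs ys ws cs)

  odd-∑ : ∀ {a} {A : Set a} (xs : List A) (f g : A → ℕ) → (∀ x → odd (f x) ≡ odd (g x)) → odd (∑ xs f) ≡ odd (∑ xs g)
  odd-∑ []       f g eq = refl
  odd-∑ (x ∷ xs) f g eq = trans (odd-+ (f x) (∑ xs f)) (trans (cong₂ _xor_ (eq x) (odd-∑ xs f g eq)) (sym (odd-+ (g x) (∑ xs g))))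

  odd-* : ∀ {A : Set} (d : Dec A) m n → odd m ≡ odd n → odd (χ d * m) ≡ odd (χ d * n)
  odd-* (yes _) m n eq = trans (cong odd (ℕ.+-identityʳ m)) (trans eq (cong odd (sym (ℕ.+-identityʳ n))))
  odd-* (no _)  m n eq = refl

  ∑-at : ∀ (g : V 3 → ℕ) v → ∑ points (λ w → g w * χ (w ≟V v)) ≡ g v
  ∑-at g v = trans (∑-cong points replace) (trans (∑-*ˡ (g v) points (λ w → χ (w ≟V v))) (trans (cong (g v *_) (points-once v)) (ℕ.*-identityʳ (g v))))
    where
    replace : ∀ w → g w * χ (w ≟V v) ≡ g v * χ (w ≟V v)
    replace w with w ≟V v
    ... | yes refl = refl
    ... | no _     = trans (ℕ.*-zeroʳ (g w)) (sym (ℕ.*-zeroʳ (g v)))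

  ∑-occ-weighted : ∀ (g : V 3 → ℕ) vs → ∑ points (λ w → g w * occ w vs) ≡ ∑ vs g
  ∑-occ-weighted g vs = trans (∑-cong points λ w → sym (∑-*ˡ (g w) vs λ v → χ (w ≟V v)))
    (trans (∑-swap points vs λ w v → g w * χ (w ≟V v)) (∑-cong vs (∑-at g)))

record Usable (order : List (Fin 12)) (o : YOrder) : Set where
  open YOrder o
  field
    once   : ∀ i → Once order i
    once′  : ∀ i → Once (List.map proj₁ (ychoices o)) i
    i₁≢i₂  : i₁ ≢ i₂
    pivot₃ : pivot i₃ ≡ 0F

module _ {R : List (Pair 5)} (good : Good R) (e₃-missing : killedIn R (on₃ e₃) ≡ 0) where
  open Good good
  private
    arr : Arrangement R
    arr = arrangement good e₃-missing
  open Arrangement arr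
  open Lines arr
  open Counting good arr using (shared)

  private
    x-killed : ∀ i → Killed (1F ∷ 0F ∷ x i) (r i)
    x-killed i = proj₁ (proj₂ (x-exists i))

    open Real x

    on-line : ∀ i w → Killed (1F ∷ 0F ∷ w) (r i) → w ∈ lineOf i
    on-line i w k = let v , v∈ , w≡v = ∑≥1⇒∃ (lineOf i) (λ v → χ (w ≟V v))
                                         (ℕ.≤-reflexive (sym (trans (occ-line i (x-killed i) w) (χ-yes (killed? (1F ∷ 0F ∷ w) (r i)) k))))
                    in subst (_∈ lineOf i) (sym (χ≥1 (w ≟V v) w≡v)) v∈

    cover₁-lines : ∀ w → ∑ fins (λ i → occ w (lineOf i)) ≡ cover₁ R w
    cover₁-lines = count-lines x x-killed

    line-sum : ∀ p v i → odd (∑ (lineOf i) (λ u → χ (dot p u ≟F v))) ≡ odd (if does (p ∥? i) then χ (dot p (x i) ≟F v) else 1)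
    line-sum p v i rewrite ⊞′≡⊞ (x i ⊞′ dir i) (dir i) | ⊞′≡⊞ (x i) (dir i)
      | dot-⊞ʳ p (x i ⊞ dir i) (dir i) | dot-⊞ʳ p (x i) (dir i) = line-parity (dot p (x i)) (dot p (dir i)) v

  module _ (S : List (V 3)) (ls : ListsSingles R S) where
    open ListsSingles ls

    private
      cover₁≤2 : ∀ w → cover₁ R w ≤ 2
      cover₁≤2 w = off 1F 0F w λ ()

      multiplicity-in-S : ∀ w → Dec (w ∈ S) → odd (cover₁ R w) ≡ odd (∑ S (λ s → χ (w ≟V s)))
      multiplicity-in-S w (yes w∈) = trans (cong odd (sound w∈)) (cong odd (sym (unique w∈)))
      multiplicity-in-S w (no w∉)  = trans (even (cover₁ R w) (cover₁≤2 w) (λ eq → w∉ (complete w eq)))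
        (cong odd (sym (trans (∑-cong-∈ S (λ {s} s∈ → χ-no (w ≟V s) λ { refl → w∉ s∈ })) (∑-zero S))))
        where
        even : ∀ n → n ≤ 2 → n ≢ 1 → odd n ≡ false
        even 0 _ _ = refl
        even 1 _ p = contradiction refl p
        even 2 _ _ = refl
        even (suc (suc (suc _))) (s≤s (s≤s ())) _

      -- Count the incidences in the plane by lines and by points. By lines it is one point or, for
      -- a parallel line, three or none; by points the covering numbers agree modulo 2 with the
      -- indicator of `S`.
      parity : ∀ p v → odd (∑ fins (λ i → if does (p ∥? i) then χ (dot p (x i) ≟F v) else 1)) ≡ odd (∑ S λ s → χ (dot p s ≟F v))
      parity p v = begin
        odd (∑ fins (λ i → if does (p ∥? i) then χ (dot p (x i) ≟F v) else 1))   ≡⟨ odd-∑ fins (λ i → ∑ (lineOf i) g) (λ i → if does (p ∥? i) then χ (dot p (x i) ≟F v) else 1) (line-sum p v) ⟨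
        odd (∑ fins (λ i → ∑ (lineOf i) g))                                      ≡⟨ cong odd (∑-cong fins λ i → sym (∑-occ-weighted g (lineOf i))) ⟩
        odd (∑ fins (λ i → ∑ points (λ w → g w * occ w (lineOf i))))             ≡⟨ cong odd (∑-swap fins points (λ i w → g w * occ w (lineOf i))) ⟩
        odd (∑ points (λ w → ∑ fins (λ i → g w * occ w (lineOf i))))
          ≡⟨ cong odd (∑-cong points λ w → trans (∑-*ˡ (g w) fins λ i → occ w (lineOf i)) (cong (g w *_) (cover₁-lines w))) ⟩
        odd (∑ points (λ w → g w * cover₁ R w))
          ≡⟨ odd-∑ points (λ w → g w * cover₁ R w) (λ w → g w * occ w S)
               (λ w → odd-* (dot p w ≟F v) (cover₁ R w) (occ w S) (multiplicity-in-S w (any? (w ≟V_) S))) ⟩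
        odd (∑ points (λ w → g w * occ w S))                                     ≡⟨ cong odd (∑-occ-weighted g S) ⟩
        odd (∑ S g)                                                              ∎
        where
        open ≡-Reasoning
        g : V 3 → ℕ
        g w = χ (dot p w ≟F v)

      slack : V 3 → ℕ
      slack w = capacity S w ∸ cover₁ R w

      capacity-in : ∀ {w} → w ∈ S → capacity S w ≡ 1
      capacity-in {w} w∈ = cong (λ b → if b then 1 else 2) (dec-true (any? (w ≟V_) S) w∈)

      capacity-out : ∀ {w} → ¬ w ∈ S → capacity S w ≡ 2
      capacity-out {w} w∉ = cong (λ b → if b then 1 else 2) (dec-false (any? (w ≟V_) S) w∉)

      enough : ∀ w → cover₁ R w ≤ capacity S w
      enough w = by-cases (any? (w ≟V_) S)
        where
        by-cases : Dec (w ∈ S) → cover₁ R w ≤ capacity S w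
        by-cases (yes w∈) = ℕ.≤-reflexive (trans (sound w∈) (sym (capacity-in w∈)))
        by-cases (no w∉)  = subst (cover₁ R w ≤_) (sym (capacity-out w∉)) (cover₁≤2 w)

      slack≢1 : ∀ w → slack w ≢ 1
      slack≢1 w = by-cases (any? (w ≟V_) S)
        where
        not-one : ∀ n → n ≢ 1 → 2 ∸ n ≢ 1
        not-one 1 p _ = p refl
        not-one 0 _ ()
        not-one (suc (suc n)) _ eq = contradiction (trans (sym (ℕ.0∸n≡0 n)) eq) λ ()
        by-cases : Dec (w ∈ S) → slack w ≢ 1
        by-cases (yes w∈) eq = contradiction (trans (sym (cong₂ _∸_ (capacity-in w∈) (sound w∈))) eq) λ ()
        by-cases (no w∉)  eq = not-one (cover₁ R w) (λ one → w∉ (complete w one)) (trans (cong (_∸ cover₁ R w) (sym (capacity-out w∉))) eq)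

      module _ (o : YOrder) (i₁≢i₂ : YOrder.i₁ o ≢ YOrder.i₂ o) (pivot₃ : pivot (YOrder.i₃ o) ≡ 0F) where
        open YOrder o

        -- The hyperplane (l₁, l₂, w) shared by two lines that are disjoint in the first family
        -- becomes the origin of the second family.
        module Second (l₁ l₂ : F) (l₂≢0 : l₂ ≢ 0F) (w : V 3)
                      (k₁ : Killed (l₁ ∷ l₂ ∷ w) (r i₁)) (k₂ : Killed (l₁ ∷ l₂ ∷ w) (r i₂)) where

          u : Fin 12 → V 3
          u i = (l₁ · x i ⊞ l₂ · y i) ⊞ 2F · w

          y′ : Fin 12 → V 3
          y′ i = u i ⊞ proj₁ (rep-shift i (u i)) · dir i

          y′-killed : ∀ i → Killed (l₁ ∷ l₂ ∷ w ⊞ y′ i) (r i)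
          y′-killed i = subst (λ v → Killed (l₁ ∷ l₂ ∷ v) (r i)) (sym (restore-V w (l₁ · x i ⊞ l₂ · y i) _))
                          (translate i (proj₁ (rep-shift i (u i))) (combine i l₁ l₂))

          y′-rep : ∀ i → lookup (y′ i) (pivot i) ≡ 0F
          y′-rep i = proj₂ (rep-shift i (u i))

          y′≡𝟘 : ∀ i → Killed (l₁ ∷ l₂ ∷ w) (r i) → y′ i ≡ 𝟘
          y′≡𝟘 i k = on-pivot i (y′ i) (subst (λ v → Killed (on₃ v) (r i)) (difference-V w (y′ i))
            (subst₂ (λ a b → Killed (a ∷ b ∷ (w ⊞ y′ i) ⊞ 2F · w) (r i)) (cancel l₁) (cancel l₂)
              (killed-⊞ (r i) (y′-killed i) (killed-· 2F (r i) k)))) (y′-rep i)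
            where
            cancel : ∀ a → a ⊕ 2F ⊗ a ≡ 0F
            cancel = from-yes (Fin.all? λ a → a ⊕ 2F ⊗ a Fin.≟ 0F)

          -- The family consists of lines of the class a (1, 0) + b (l₁, l₂), translated by `b · w`.
          -- That class has a nonzero second entry, so at most two of its lines pass through any
          -- point.
          family-bound : ∀ a b → b ≢ 0F → (z : Fin 12 → V 3) → (∀ i → z i ≡ a · x i ⊞ b · y′ i) →
                         ∀ v → ∑ fins (λ i → occ v (line (dir i) (z i))) ≤ 2
          family-bound a b b≢0 z z≡ v = begin
            ∑ fins (λ i → occ v (line (dir i) (z i)))              ≤⟨ ∑-mono fins (λ {i} _ → below i) ⟩
            ∑ fins (λ i → κ (L₁ ∷ L₂ ∷ v ⊞ b · w) (r i))           ≡⟨ cover (L₁ ∷ L₂ ∷ v ⊞ b · w) ⟨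
            killedIn R (L₁ ∷ L₂ ∷ v ⊞ b · w)                       ≤⟨ off L₁ L₂ (v ⊞ b · w) (λ eq → second-nonzero a b l₂ b≢0 l₂≢0 (cong (λ q → head (tail q)) eq)) ⟩
            2                                                      ∎
            where
            open ℕ.≤-Reasoning
            L₁ = a ⊗ 1F ⊕ b ⊗ l₁
            L₂ = a ⊗ 0F ⊕ b ⊗ l₂
            killed : ∀ i t → Killed (L₁ ∷ L₂ ∷ (z i ⊞ t · dir i) ⊞ b · w) (r i)
            killed i t = subst (λ q → Killed (L₁ ∷ L₂ ∷ q) (r i))
              (trans (regroup-V a b (x i) (y′ i) w (t · dir i)) (cong (λ q → (q ⊞ t · dir i) ⊞ b · w) (sym (z≡ i))))
              (translate i t (killed-⊞ (r i) (killed-· a (r i) (x-killed i)) (killed-· b (r i) (y′-killed i))))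
            below : ∀ i → occ v (line (dir i) (z i)) ≤ κ (L₁ ∷ L₂ ∷ v ⊞ b · w) (r i)
            below i = by-cases (1 ℕ.≤? occ v (line (dir i) (z i)))
              where
              by-cases : Dec (1 ≤ occ v (line (dir i) (z i))) → occ v (line (dir i) (z i)) ≤ κ (L₁ ∷ L₂ ∷ v ⊞ b · w) (r i)
              by-cases (no ¬le) = ℕ.≤-trans (s≤s⁻¹ (ℕ.≰⇒> ¬le)) z≤n
              by-cases (yes le) =
                let u , u∈ , v≡u = ∑≥1⇒∃ (line (dir i) (z i)) (λ u → χ (v ≟V u)) le
                    t , u≡ = ∈line u∈
                    v≡ = trans (χ≥1 (v ≟V u) v≡u) u≡
                in ℕ.≤-reflexive (trans (subst (λ q → occ q (line (dir i) (z i)) ≡ 1) (sym v≡) (occ-on-line i t (z i)))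
                     (sym (χ-yes (killed? (L₁ ∷ L₂ ∷ v ⊞ b · w) (r i)) (subst (λ q → Killed (L₁ ∷ L₂ ∷ q ⊞ b · w) (r i)) (sym v≡) (killed i t)))))

          -- Replacing y by 2y reflects its own space and interchanges those of x + y and x + 2y,
          -- which leaves the three bounds intact and frees the sign of the third line.
          family : ∀ e → e ≢ 0F → (e · y′ i₃) ∈ half → SecondFamily o
          family e e≢0 in-half = record
            { y       = λ i → e · y′ i
            ; y₁≡𝟘    = trans (cong (e ·_) (y′≡𝟘 i₁ k₁)) (·-𝟘 e)
            ; y₂≡𝟘    = trans (cong (e ·_) (y′≡𝟘 i₂ k₂)) (·-𝟘 e)
            ; y₃∈half = in-half
            ; y-rep   = λ i → trans (lookup-· e (y′ i) (pivot i)) (trans (cong (e ⊗_) (y′-rep i)) (⊗-zeroʳ e))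
            ; bound₁  = family-bound 0F e e≢0 (λ i → e · y′ i) (λ i → sym (trans (cong (_⊞ e · y′ i) (·-zeroˡ (x i))) (⊞-identityˡ (e · y′ i))))
            ; bound₂  = family-bound 1F e e≢0 (λ i → x i ⊞′ e · y′ i)
                          (λ i → trans (⊞′≡⊞ (x i) (e · y′ i)) (cong (_⊞ e · y′ i) (sym (·-identityˡ (x i)))))
            ; bound₃  = family-bound 1F (2F ⊗ e) (doubled e e≢0) (λ i → x i ⊞′ e · y′ i ⊞′ e · y′ i) (λ i → begin
                x i ⊞′ e · y′ i ⊞′ e · y′ i        ≡⟨ trans (⊞′≡⊞ (x i ⊞′ e · y′ i) (e · y′ i)) (cong (_⊞ e · y′ i) (⊞′≡⊞ (x i) (e · y′ i))) ⟩
                (x i ⊞ e · y′ i) ⊞ e · y′ i        ≡⟨ ⊞-assoc (x i) (e · y′ i) (e · y′ i) ⟩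
                x i ⊞ (e · y′ i ⊞ e · y′ i)        ≡⟨ cong₂ _⊞_ (sym (·-identityˡ (x i))) (trans (·-double (e · y′ i)) (sym (·-assoc 2F e (y′ i)))) ⟩
                1F · x i ⊞ (2F ⊗ e) · y′ i         ∎)
            }
            where
            open ≡-Reasoning
            doubled : ∀ e → e ≢ 0F → 2F ⊗ e ≢ 0F
            doubled = from-yes (Fin.all? λ e → ¬? (e Fin.≟ 0F) →-dec ¬? (2F ⊗ e Fin.≟ 0F))

          second : SecondFamily o
          second = by-cases (half-up-to-sign (y′ i₃) (subst (λ j → lookup (y′ i₃) j ≡ 0F) pivot₃ (y′-rep i₃)))
            where
            by-cases : Any (y′ i₃ ≡_) half ⊎ Any (2F · y′ i₃ ≡_) half → SecondFamily o
            by-cases (inj₁ in-half) = family 1F (λ ()) (subst (_∈ half) (sym (·-identityˡ (y′ i₃))) in-half)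
            by-cases (inj₂ in-half) = family 2F (λ ()) in-half

        second-family : Disjoint o → SecondFamily o
        second-family disjoint = from-shared (shared i₁ i₂ i₁≢i₂)
          where
          from-shared : (∃ λ l₁ → ∃ λ l₂ → (l₁ , l₂) ∈ classes × ∃ λ w → Killed (l₁ ∷ l₂ ∷ w) (r i₁) × Killed (l₁ ∷ l₂ ∷ w) (r i₂)) →
                        SecondFamily o
          from-shared (_ , _ , here refl , w , k₁ , k₂) = contradiction (on-line i₂ w k₂) (All.lookup disjoint (on-line i₁ w k₁))
          from-shared (l₁ , l₂ , there (here refl) , w , k₁ , k₂) = Second.second l₁ l₂ (λ ()) w k₁ k₂
          from-shared (l₁ , l₂ , there (there (here refl)) , w , k₁ , k₂) = Second.second l₁ l₂ (λ ()) w k₁ k₂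
          from-shared (l₁ , l₂ , there (there (there (here refl))) , w , k₁ , k₂) = Second.second l₁ l₂ (λ ()) w k₁ k₂

    refuted : ∀ order o Q → Usable order o → All (λ (i , p) → Meets R (dir i) p) Q → Refuted order o S Q → ⊥
    refuted order o Q us meets (refuted-by eq) = refute-sound o order S Q once once′ (λ i → proj₂ (proj₂ (x-exists i)))
      (All.map (λ { {i , w} (p , p∈ , d , k) → on-line i w (from i (1F ∷ 0F ∷ w) p∈ d k) }) meets)
      parity slack (λ w → trans (sym (ℕ.m+[n∸m]≡n (enough w))) (cong (_+ slack w) (sym (cover₁-lines w)))) slack≢1
      (second-family o i₁≢i₂ pivot₃) eq
      where open Usable us

-- Normal forms

lincomb-on₃ : ∀ {k} (γ : V k) (B : Vec (V 3) k) → lincomb γ (map on₃ B) ≡ on₃ (lincomb γ B)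
lincomb-on₃ []      []      = refl
lincomb-on₃ (c ∷ γ) (b ∷ B) rewrite lincomb-on₃ γ B | ⊗-zeroʳ c = refl

Injective : Vec (V 3) 3 → Set
Injective B = ∀ γ → lincomb γ B ≡ 𝟘 → γ ≡ 𝟘

injective : ∀ {B} → Injective B → ∀ γ δ → lincomb γ B ≡ lincomb δ B → γ ≡ δ
injective {B} inj γ δ eq = equal γ δ (inj (γ ⊞ 2F · δ) (begin
  lincomb (γ ⊞ 2F · δ) B              ≡⟨ lincomb-⊞ γ (2F · δ) B ⟩
  lincomb γ B ⊞ lincomb (2F · δ) B    ≡⟨ cong₂ _⊞_ eq (lincomb-· 2F δ B) ⟩
  lincomb δ B ⊞ 2F · lincomb δ B      ≡⟨ cancel (lincomb δ B) ⟩
  𝟘                                   ∎))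
  where
  open ≡-Reasoning
  cancel₁ : ∀ a → a ⊕ 2F ⊗ a ≡ 0F
  cancel₁ = from-yes (Fin.all? λ a → a ⊕ 2F ⊗ a Fin.≟ 0F)
  cancel : ∀ {n} (v : V n) → v ⊞ 2F · v ≡ 𝟘
  cancel []      = refl
  cancel (a ∷ v) = cong₂ _∷_ (cancel₁ a) (cancel v)
  equal₁ : ∀ a b → a ⊕ 2F ⊗ b ≡ 0F → a ≡ b
  equal₁ = from-yes (Fin.all? λ a → Fin.all? λ b → (a ⊕ 2F ⊗ b Fin.≟ 0F) →-dec (a Fin.≟ b))
  equal : ∀ {n} (u v : V n) → u ⊞ 2F · v ≡ 𝟘 → u ≡ v
  equal []      []      _  = refl
  equal (a ∷ u) (b ∷ v) eq = cong₂ _∷_ (equal₁ a b (cong head eq)) (equal u v (cong tail eq))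

-- New coordinates in which (1, 0, 𝟘), (0, 1, 𝟘) and (0, 0, γ) stand for (l₁, l₂, s), (m₁, m₂, 𝟘) and (0, 0, γB).
module Substitution (R : List (Pair 5)) (l₁ l₂ m₁ m₂ : F) (s : V 3) (B : Vec (V 3) 3)
                    (lm-injective : ∀ a b → a ⊗ l₁ ⊕ b ⊗ m₁ ≡ 0F → a ⊗ l₂ ⊕ b ⊗ m₂ ≡ 0F → a ∷ b ∷ [] ≡ 𝟘)
                    (B-injective : Injective B) where

  G : Vec (V 5) 5
  G = (l₁ ∷ l₂ ∷ s) ∷ (m₁ ∷ m₂ ∷ 𝟘) ∷ map on₃ B

  expand : ∀ a b γ → lincomb (a ∷ b ∷ γ) G ≡ (a ⊗ l₁ ⊕ b ⊗ m₁) ∷ (a ⊗ l₂ ⊕ b ⊗ m₂) ∷ (a · s ⊞ lincomb γ B)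
  expand a b γ rewrite lincomb-on₃ γ B | ⊕-identityʳ (b ⊗ m₁) | ⊕-identityʳ (b ⊗ m₂) | ·-𝟘 {3} b | ⊞-identityˡ (lincomb γ B) = refl

  on-W : ∀ γ → lincomb (on₃ γ) G ≡ on₃ (lincomb γ B)
  on-W γ = trans (lincomb-00∷ γ (l₁ ∷ l₂ ∷ s) (m₁ ∷ m₂ ∷ 𝟘) (map on₃ B)) (lincomb-on₃ γ B)

  first : ∀ γ → lincomb (1F ∷ 0F ∷ γ) G ≡ l₁ ∷ l₂ ∷ s ⊞ lincomb γ B
  first γ = trans (expand 1F 0F γ) (cong₂ _∷_ (simplify l₁ m₁) (cong₂ _∷_ (simplify l₂ m₂) (cong (_⊞ lincomb γ B) (·-identityˡ s))))
    where
    simplify : ∀ l m → 1F ⊗ l ⊕ 0F ⊗ m ≡ l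
    simplify l m = trans (cong₂ _⊕_ (⊗-identityˡ l) (⊗-zeroˡ m)) (⊕-identityʳ l)

  R′ : List (Pair 5)
  R′ = List.map (pull G) R

  cover-W : ∀ γ → killedIn R′ (on₃ γ) ≡ killedIn R (on₃ (lincomb γ B))
  cover-W γ = trans (killedIn-pull G R (on₃ γ)) (cong (killedIn R) (on-W γ))

  cover-first : ∀ γ → cover₁ R′ γ ≡ killedIn R (l₁ ∷ l₂ ∷ s ⊞ lincomb γ B)
  cover-first γ = trans (killedIn-pull G R (1F ∷ 0F ∷ γ)) (cong (killedIn R) (first γ))

  meets : ∀ {p} δ γ → p ∈ R → Killed (on₃ (lincomb δ B)) p → Killed (l₁ ∷ l₂ ∷ s ⊞ lincomb γ B) p → Meets R′ δ γ
  meets {p} δ γ p∈ d k = pull G p , ∈-map⁺ (pull G) p∈ ,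
    killed-pull G (on₃ δ) p (subst (λ h → Killed h p) (sym (on-W δ)) d) ,
    killed-pull G (1F ∷ 0F ∷ γ) p (subst (λ h → Killed h p) (sym (first γ)) k)

  good′ : Good R → Good R′
  good′ good = record
    { size = trans (Listₚ.length-map (pull G) R) size
    ; off  = λ a b γ ab≢0 → subst (_≤ 2) (sym (trans (killedIn-pull G R (a ∷ b ∷ γ)) (cong (killedIn R) (expand a b γ))))
               (off _ _ _ λ eq → ab≢0 (lm-injective a b (cong head eq) (cong (λ v → head (tail v)) eq)))
    ; on   = λ γ γ≢0 → subst (_≤ 1) (sym (cover-W γ)) (on _ λ eq → γ≢0 (B-injective γ eq))
    }
    where open Good good

private
  identity-injective : ∀ a b → a ⊗ 1F ⊕ b ⊗ 0F ≡ 0F → a ⊗ 0F ⊕ b ⊗ 1F ≡ 0F → a ∷ b ∷ [] ≡ 𝟘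
  identity-injective = from-yes (Fin.all? λ a → Fin.all? λ b →
    (a ⊗ 1F ⊕ b ⊗ 0F Fin.≟ 0F) →-dec ((a ⊗ 0F ⊕ b ⊗ 1F Fin.≟ 0F) →-dec (a ∷ b ∷ [] ≟V 𝟘)))

module OnW (R : List (Pair 5)) (B : Vec (V 3) 3) (B-injective : Injective B) where
  open Substitution R 1F 0F 0F 1F 𝟘 B identity-injective B-injective public

-- Three changes of basis, used in this order: `complement` turns the missing direction into `e₃`,
-- `frame` gives a line through the origin the direction `e₁`, and `shear` keeps these two and
-- brings a vector outside their plane to `e₂`.
complement : V 3 → Vec (V 3) 3
complement w@(a ∷ b ∷ c ∷ []) =
  if does (c ≟F 0F) then (if does (b ≟F 0F) then e₂ ∷ e₃ ∷ w ∷ [] else e₁ ∷ e₃ ∷ w ∷ []) else e₁ ∷ e₂ ∷ w ∷ []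

frame : Fin 12 → Vec (V 3) 3
frame j = dir j ∷ (if does (lookup (dir j) 0F ≟F 0F) then e₁ else e₂) ∷ e₃ ∷ []

shear : V 3 → Vec (V 3) 3
shear v = e₁ ∷ v ∷ e₃ ∷ []

second-class : F × F → F × F
second-class (1F , 0F) = 0F , 1F
second-class _         = 1F , 0F

private
  abstract
    complement-injective : ∀ w → w ≢ 𝟘 → Injective (complement w)
    complement-injective = from-yes (all-vec? 3 λ w → ¬? (w ≟V 𝟘) →-dec all-vec? 3 λ γ → (lincomb γ (complement w) ≟V 𝟘) →-dec (γ ≟V 𝟘))

    complement-e₃ : ∀ w → lincomb e₃ (complement w) ≡ w
    complement-e₃ = from-yes (all-vec? 3 λ w → lincomb e₃ (complement w) ≟V w)

    frame-injective : ∀ j → Injective (frame j)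
    frame-injective = from-yes (Fin.all? λ j → all-vec? 3 λ γ → (lincomb γ (frame j) ≟V 𝟘) →-dec (γ ≟V 𝟘))

    frame-surjective : ∀ j v → ∃ λ γ → lincomb γ (frame j) ≡ v
    frame-surjective = from-yes (Fin.all? λ j → all-vec? 3 λ v → ∃-vec? 3 λ γ → lincomb γ (frame j) ≟V v)

    frame-e₁ : ∀ j → lincomb e₁ (frame j) ≡ dir j
    frame-e₁ = from-yes (Fin.all? λ j → lincomb e₁ (frame j) ≟V dir j)

    frame-e₃ : ∀ j → lincomb e₃ (frame j) ≡ e₃
    frame-e₃ = from-yes (Fin.all? λ j → lincomb e₃ (frame j) ≟V e₃)

    shear-injective : ∀ v → lookup v 1F ≢ 0F → Injective (shear v)
    shear-injective = from-yes (all-vec? 3 λ v → ¬? (lookup v 1F Fin.≟ 0F) →-dec all-vec? 3 λ γ → (lincomb γ (shear v) ≟V 𝟘) →-dec (γ ≟V 𝟘))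

    shear-fixes : ∀ v γ → lookup γ 1F ≡ 0F → lincomb γ (shear v) ≡ γ
    shear-fixes = from-yes (all-vec? 3 λ v → all-vec? 3 λ γ → (lookup γ 1F Fin.≟ 0F) →-dec (lincomb γ (shear v) ≟V γ))

    shear-e₂ : ∀ v → lincomb e₂ (shear v) ≡ v
    shear-e₂ = from-yes (all-vec? 3 λ v → lincomb e₂ (shear v) ≟V v)

    class-injective : All (λ l → ∀ a b → a ⊗ proj₁ l ⊕ b ⊗ proj₁ (second-class l) ≡ 0F →
                                         a ⊗ proj₂ l ⊕ b ⊗ proj₂ (second-class l) ≡ 0F → a ∷ b ∷ [] ≡ 𝟘) classes
    class-injective = from-yes (All.all? (λ l → Fin.all? λ a → Fin.all? λ b →
      (a ⊗ proj₁ l ⊕ b ⊗ proj₁ (second-class l) Fin.≟ 0F) →-dec ((a ⊗ proj₂ l ⊕ b ⊗ proj₂ (second-class l) Fin.≟ 0F) →-dec (a ∷ b ∷ [] ≟V 𝟘))) classes)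

    horizontal-dir : ∀ i → lookup (dir i) 1F ≡ 0F → i ≢ 0F → i ∈ horizontal
    horizontal-dir = from-yes (Fin.all? λ i → (lookup (dir i) 1F Fin.≟ 0F) →-dec (¬? (i Fin.≟ 0F) →-dec any? (i Fin.≟_) horizontal))

    vertical-complete : ∀ s → s ≢ 𝟘 → lookup s 1F ≡ 0F → s ∈ verticalPlane
    vertical-complete = from-yes (all-vec? 3 λ s → ¬? (s ≟V 𝟘) →-dec ((lookup s 1F Fin.≟ 0F) →-dec any? (s ≟V_) verticalPlane))

    usable₁₁ : Usable order₁ yorder₁
    usable₁₁ = record { once = from-yes (Once? order₁) ; once′ = from-yes (Once? (List.map proj₁ (ychoices yorder₁))) ; i₁≢i₂ = λ () ; pivot₃ = refl }

    usable₁₂ : Usable order₁ yorder₂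
    usable₁₂ = record { once = from-yes (Once? order₁) ; once′ = from-yes (Once? (List.map proj₁ (ychoices yorder₂))) ; i₁≢i₂ = λ () ; pivot₃ = refl }

    usable₂₁ : Usable order₂ yorder₁
    usable₂₁ = record { once = from-yes (Once? order₂) ; once′ = from-yes (Once? (List.map proj₁ (ychoices yorder₁))) ; i₁≢i₂ = λ () ; pivot₃ = refl }

  add-back : ∀ {n} (s s′ : V n) → s ⊞ (s′ ⊞ 2F · s) ≡ s′
  add-back []      []      = refl
  add-back (a ∷ s) (b ∷ s′) = cong₂ _∷_ (lemma a b) (add-back s s′)
    where
    lemma : ∀ a b → a ⊕ (b ⊕ 2F ⊗ a) ≡ b
    lemma = from-yes (Fin.all? λ a → Fin.all? λ b → a ⊕ (b ⊕ 2F ⊗ a) Fin.≟ b)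

TwoSingles : (V 3 → ℕ) → V 3 → Set
TwoSingles f s = s ≢ 𝟘 × f 𝟘 ≡ 1 × f s ≡ 1 × (∀ w → f w ≡ 1 → w ≡ 𝟘 ⊎ w ≡ s)

lists-none : ∀ {R} → (∀ w → cover₁ R w ≢ 1) → ListsSingles R []
lists-none no-single = record { sound = λ () ; complete = λ w eq → contradiction eq (no-single w) ; unique = λ () }

lists-two : ∀ {R s} → TwoSingles (cover₁ R) s → ListsSingles R (𝟘 ∷ s ∷ [])
lists-two {R} {s} (s≢0 , f0 , fs , only) = record
  { sound    = λ { (here refl) → f0 ; (there (here refl)) → fs }
  ; complete = λ w eq → in-list (only w eq)
  ; unique   = λ { (here refl) → sum₁₀ (χ (𝟘 {3} ≟V 𝟘)) (χ (𝟘 ≟V s)) (χ-yes (𝟘 {3} ≟V 𝟘) refl) (χ-no (𝟘 ≟V s) (λ eq → s≢0 (sym eq)))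
                 ; (there (here refl)) → sum₀₁ (χ (s ≟V 𝟘)) (χ (s ≟V s)) (χ-no (s ≟V 𝟘) s≢0) (χ-yes (s ≟V s) refl) } }
  where
  sum₁₀ : ∀ a b → a ≡ 1 → b ≡ 0 → a + (b + 0) ≡ 1
  sum₁₀ _ _ refl refl = refl
  sum₀₁ : ∀ a b → a ≡ 0 → b ≡ 1 → a + (b + 0) ≡ 1
  sum₀₁ _ _ refl refl = refl
  in-list : ∀ {w} → w ≡ 𝟘 ⊎ w ≡ s → w ∈ 𝟘 ∷ s ∷ []
  in-list (inj₁ eq) = here eq
  in-list (inj₂ eq) = there (here eq)

two-transfer : ∀ {f f′ : V 3 → ℕ} {s} {B} γ₀ → Injective B → (∀ γ → f′ γ ≡ f (lincomb γ B)) → lincomb γ₀ B ≡ s →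
               TwoSingles f s → TwoSingles f′ γ₀
two-transfer {f} {f′} {s} {B} γ₀ inj f′≡ γ₀B≡s (s≢0 , f0 , fs , only) =
  (λ eq → s≢0 (trans (sym γ₀B≡s) (trans (cong (λ γ → lincomb γ B) eq) (lincomb-𝟘 B)))) ,
  trans (f′≡ 𝟘) (trans (cong f (lincomb-𝟘 B)) f0) ,
  trans (f′≡ γ₀) (trans (cong f γ₀B≡s) fs) ,
  λ γ eq → back γ (only (lincomb γ B) (trans (sym (f′≡ γ)) eq))
  where
  back : ∀ γ → lincomb γ B ≡ 𝟘 ⊎ lincomb γ B ≡ s → γ ≡ 𝟘 ⊎ γ ≡ γ₀
  back γ (inj₁ eq) = inj₁ (inj γ eq)
  back γ (inj₂ eq) = inj₂ (injective inj γ γ₀ (trans eq (sym γ₀B≡s)))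

module Final {R : List (Pair 5)} (good : Good R) (e₃-missing : killedIn R (on₃ e₃) ≡ 0) (through : Meets R e₁ 𝟘) where
  private
    arr : Arrangement R
    arr = arrangement good e₃-missing
  open Arrangement arr

  private
    k₀ : Killed (1F ∷ 0F ∷ 𝟘) (r 0F)
    k₀ = let p , p∈ , d , k = through in from 0F (1F ∷ 0F ∷ 𝟘) p∈ d k

    another : cover₁ R 𝟘 ≢ 1 → ∃ λ i → i ≢ 0F × Killed (1F ∷ 0F ∷ 𝟘) (r i)
    another ≢1 =
      let i , _ , lt = ∑<∑⇒∃ fins (λ i → χ (0F Fin.≟ i)) (λ i → κ (1F ∷ 0F ∷ 𝟘) (r i)) more
      in i , distinct i lt ,
         χ≥1 (killed? (1F ∷ 0F ∷ 𝟘) (r i)) (ℕ.≤-trans (s≤s z≤n) lt)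
      where
      distinct : ∀ i → χ (0F Fin.≟ i) < κ (1F ∷ 0F ∷ 𝟘) (r i) → i ≢ 0F
      distinct .0F lt refl = contradiction (ℕ.≤-trans lt (χ≤1 (killed? (1F ∷ 0F ∷ 𝟘) (r 0F)))) λ { (s≤s ()) }
      total = ∑ fins λ i → κ (1F ∷ 0F ∷ 𝟘) (r i)
      at-least : 1 ≤ total
      at-least = ℕ.≤-trans (ℕ.≤-reflexive (sym (χ-yes (killed? (1F ∷ 0F ∷ 𝟘) (r 0F)) k₀)))
                           (term≤∑ (λ i → κ (1F ∷ 0F ∷ 𝟘) (r i)) (once⇒∈ fins 0F (fins-once 0F)))
      more : ∑ fins (λ i → χ (0F Fin.≟ i)) < total
      more = subst (_< total) (sym (fins-once 0F)) (ℕ.≤∧≢⇒< at-least λ eq → ≢1 (trans (cover (1F ∷ 0F ∷ 𝟘)) (sym eq)))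

    some : ∀ w → cover₁ R w ≡ 1 → ∃ λ i → Killed (1F ∷ 0F ∷ w) (r i)
    some w eq = let i , _ , le = ∑≥1⇒∃ fins (λ i → κ (1F ∷ 0F ∷ w) (r i)) (ℕ.≤-reflexive (sym (trans (sym (cover (1F ∷ 0F ∷ w))) eq)))
                in i , χ≥1 (killed? (1F ∷ 0F ∷ w) (r i)) le

    meetsᵢ : ∀ i {w} → Killed (1F ∷ 0F ∷ w) (r i) → Meets R (dir i) w
    meetsᵢ i k = r i , r∈ i , dir∈ i , k

    module Sheared (v : V 3) (v₂≢0 : lookup v 1F ≢ 0F) where
      open OnW R (shear v) (shear-injective v v₂≢0)

      R″ : List (Pair 5)
      R″ = R′

      good″ : Good R″
      good″ = good′ good

      missing″ : killedIn R″ (on₃ e₃) ≡ 0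
      missing″ = trans (cover-W e₃) (trans (cong (λ w → killedIn R (on₃ w)) (shear-fixes v e₃ refl)) e₃-missing)

      cover″ : ∀ γ → cover₁ R″ γ ≡ cover₁ R (lincomb γ (shear v))
      cover″ γ = trans (cover-first γ) (cong (cover₁ R) (⊞-identityˡ (lincomb γ (shear v))))

      move : ∀ {d w} δ γ → lincomb δ (shear v) ≡ d → lincomb γ (shear v) ≡ w → Meets R d w → Meets R″ δ γ
      move {d} {w} δ γ refl refl (p , p∈ , kd , k) = meets δ γ p∈ kd (subst (λ u → Killed (1F ∷ 0F ∷ u) p) (sym (⊞-identityˡ w)) k)

      through″ : Meets R″ e₁ 𝟘
      through″ = move e₁ 𝟘 (shear-fixes v e₁ refl) (lincomb-𝟘 (shear v)) through

  no-singles : (∀ w → cover₁ R w ≢ 1) → ⊥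
  no-singles all≢1 = from-another (another (all≢1 𝟘))
    where
    from-another : (∃ λ i → i ≢ 0F × Killed (1F ∷ 0F ∷ 𝟘) (r i)) → ⊥
    from-another (i , i≢0 , k) = by-cases (lookup (dir i) 1F ≟F 0F)
      where
      by-cases : Dec (lookup (dir i) 1F ≡ 0F) → ⊥
      by-cases (yes flat) = refuted good e₃-missing [] (lists-none all≢1) order₂ yorder₁ _ usable₂₁ (through ∷ meetsᵢ i k ∷ [])
        (All.lookup run₂ (horizontal-dir i flat i≢0))
      by-cases (no steep) = refuted good″ missing″ [] (lists-none λ γ eq → all≢1 (lincomb γ (shear (dir i))) (trans (sym (cover″ γ)) eq)) order₁ yorder₁ _ usable₁₁
        (through″ ∷ move e₂ 𝟘 (shear-e₂ (dir i)) (lincomb-𝟘 (shear (dir i))) (meetsᵢ i k) ∷ []) run₁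
        where open Sheared (dir i) steep

  two-singles : ∀ s → TwoSingles (cover₁ R) s → ⊥
  two-singles s ts@(s≢0 , f0 , fs , only) = by-cases (lookup s 1F ≟F 0F)
    where
    by-line : lookup s 1F ≡ 0F → (∃ λ i → Killed (1F ∷ 0F ∷ s) (r i)) → ⊥
    by-line s-flat (i , k) = line-cases (lookup (dir i) 1F ≟F 0F) (i Fin.≟ 0F)
      where
      s∈ : s ∈ verticalPlane
      s∈ = vertical-complete s s≢0 s-flat
      line-cases : Dec (lookup (dir i) 1F ≡ 0F) → Dec (i ≡ 0F) → ⊥
      line-cases _ (yes refl) = refuted good e₃-missing _ (lists-two ts) order₁ yorder₁ _ usable₁₁ (through ∷ meetsᵢ 0F k ∷ [])
        (All.lookup run₆ s∈)
      line-cases (yes flat) (no i≢0) = refuted good e₃-missing _ (lists-two ts) order₂ yorder₁ _ usable₂₁ (through ∷ meetsᵢ i k ∷ [])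
        (All.lookup (All.lookup run₅ s∈) (horizontal-dir i flat i≢0))
      line-cases (no steep) _ = refuted good″ missing″ _
        (lists-two (two-transfer s (shear-injective (dir i) steep) cover″ (shear-fixes (dir i) s s-flat) ts)) order₁ yorder₁ _ usable₁₁
        (through″ ∷ move e₂ s (shear-e₂ (dir i)) (shear-fixes (dir i) s s-flat) (meetsᵢ i k) ∷ [])
        (All.lookup run₄ s∈)
        where open Sheared (dir i) steep
    by-cases : Dec (lookup s 1F ≡ 0F) → ⊥
    by-cases (yes s-flat) = by-line s-flat (some s fs)
    by-cases (no steep) = refuted good″ missing″ _
      (lists-two (two-transfer e₂ (shear-injective s steep) cover″ (shear-e₂ s) ts)) order₁ yorder₂ _ usable₁₂ (through″ ∷ []) run₃
      where open Sheared s steep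

module Framed {R : List (Pair 5)} (good : Good R) (e₃-missing : killedIn R (on₃ e₃) ≡ 0) where
  private
    arr : Arrangement R
    arr = arrangement good e₃-missing
  open Arrangement arr
  open Lines arr using (combine)
  open Counting good arr using (c; c-cover; few-singles)

  module _ (l : F × F) (l∈ : l ∈ classes) (s : V 3) (j : Fin 12) (k : Killed (proj₁ l ∷ proj₂ l ∷ s) (r j)) where
    open Substitution R (proj₁ l) (proj₂ l) (proj₁ (second-class l)) (proj₂ (second-class l)) s (frame j)
      (All.lookup class-injective l∈) (frame-injective j)

    private
      missing′ : killedIn R′ (on₃ e₃) ≡ 0
      missing′ = trans (cover-W e₃) (trans (cong (λ w → killedIn R (on₃ w)) (frame-e₃ j)) e₃-missing)

      origin : s ⊞ lincomb 𝟘 (frame j) ≡ s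
      origin = trans (cong (s ⊞_) (lincomb-𝟘 (frame j))) (⊞-identityʳ s)

      through : Meets R′ e₁ 𝟘
      through = meets e₁ 𝟘 (r∈ j) (subst (λ d → Killed (on₃ d) (r j)) (sym (frame-e₁ j)) (dir∈ j))
                  (subst (λ u → Killed (proj₁ l ∷ proj₂ l ∷ u) (r j)) (sym origin) k)

    open Final (good′ good) missing′ through

    none-impossible : (∀ w → c l w ≢ 1) → ⊥
    none-impossible all≢1 = no-singles λ γ eq → all≢1 (s ⊞ lincomb γ (frame j)) (trans (sym (cover-first γ)) eq)

    two-impossible : ∀ s′ → s ≢ s′ → c l s ≡ 1 → c l s′ ≡ 1 → (∀ w → c l w ≡ 1 → w ≡ s ⊎ w ≡ s′) → ⊥
    two-impossible s′ s≢s′ fs fs′ only = two-singles γ′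
      ( (λ eq → s≢s′ (trans (sym origin) (trans (cong (λ γ → s ⊞ lincomb γ (frame j)) (sym eq)) at-γ′)))
      , trans (cover-first 𝟘) (trans (cong (c l) origin) fs)
      , trans (cover-first γ′) (trans (cong (c l) at-γ′) fs′)
      , λ γ eq → back γ (only (s ⊞ lincomb γ (frame j)) (trans (sym (cover-first γ)) eq)) )
      where
      preimage = frame-surjective j (s′ ⊞ 2F · s)
      γ′ = proj₁ preimage
      at-γ′ : s ⊞ lincomb γ′ (frame j) ≡ s′
      at-γ′ = trans (cong (s ⊞_) (proj₂ preimage)) (add-back s s′)
      cancel : ∀ γ δ → s ⊞ lincomb γ (frame j) ≡ s ⊞ lincomb δ (frame j) → γ ≡ δ
      cancel γ δ eq = injective (frame-injective j) γ δ (⊞-cancelˡ s _ _ eq)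
        where
        cancel₁ : ∀ a b c → a ⊕ b ≡ a ⊕ c → b ≡ c
        cancel₁ = from-yes (Fin.all? λ a → Fin.all? λ b → Fin.all? λ c → (a ⊕ b Fin.≟ a ⊕ c) →-dec (b Fin.≟ c))
        ⊞-cancelˡ : ∀ {n} (u v w : V n) → u ⊞ v ≡ u ⊞ w → v ≡ w
        ⊞-cancelˡ []      []      []      _  = refl
        ⊞-cancelˡ (a ∷ u) (b ∷ v) (c ∷ w) eq = cong₂ _∷_ (cancel₁ a b c (cong head eq)) (⊞-cancelˡ u v w (cong tail eq))
      back : ∀ γ → s ⊞ lincomb γ (frame j) ≡ s ⊎ s ⊞ lincomb γ (frame j) ≡ s′ → γ ≡ 𝟘 ⊎ γ ≡ γ′
      back γ (inj₁ eq) = inj₁ (cancel γ 𝟘 (trans eq (sym origin)))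
      back γ (inj₂ eq) = inj₂ (cancel γ γ′ (trans eq (sym at-γ′)))

  impossible : ⊥
  impossible = by-singles few-singles
    where
    by-singles : (∃ λ l → l ∈ classes × Singles (c l)) → ⊥
    -- Without singles there is no distinguished origin; any point on the line with index `0F` will
    -- do.
    by-singles (l@(l₁ , l₂) , l∈ , none no-single) = none-impossible l l∈ _ 0F (combine 0F l₁ l₂) no-single
    by-singles (l@(l₁ , l₂) , l∈ , two s s′ s≢s′ fs fs′ only) =
      let j , _ , le = ∑≥1⇒∃ fins (λ i → κ (l₁ ∷ l₂ ∷ s) (r i)) (ℕ.≤-reflexive (sym (trans (sym (c-cover l s)) fs)))
      in two-impossible l l∈ s j (χ≥1 (killed? (l₁ ∷ l₂ ∷ s) (r j)) le) s′ s≢s′ fs fs′ only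

no-thirteen : ∀ (L : List (Pair 5)) → length L ≡ 13 → Bounded 2 L → ⊥
no-thirteen L size bd = from-good (good-exists L size bd)
  where
  from-good : ∃ Good → ⊥
  from-good (R , good) = from-missing (missing-direction good)
    where
    from-missing : (∃ λ w → w ≢ 𝟘 × killedIn R (on₃ w) ≡ 0) → ⊥
    from-missing (w , w≢0 , missing) = Framed.impossible (good′ good)
      (trans (cover-W e₃) (trans (cong (λ u → killedIn R (on₃ u)) (complement-e₃ w)) missing))
      where open OnW R (complement w) (complement-injective w w≢0)

-- The theorem

c₁ : Construction 1 1
c₁ = construction (p ∷ []) refl (from-yes (independent? p) ∷ [])
       (λ h _ → ℕ.≤-trans (ℕ.≤-reflexive (ℕ.+-identityʳ (κ h p))) (χ≤1 (killed? h p))) refl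
  where
  p : Pair 5
  p = unit 0F , unit 1F

-- N + 1 lines violate the inequality by which the last three Griesmer terms are at most 4s. Both
-- conditions are decided by evaluation, so every row supplies them as `_`.
GriesmerTight : ℕ → ℕ → Set
GriesmerTight s N = let D = suc N ∸ s in
  True (s ℕ.≤? N) × True (4 * s ℕ.<? ⌈ D /3⌉ + (⌈ ⌈ D /3⌉ /3⌉ + ⌈ ⌈ ⌈ D /3⌉ /3⌉ /3⌉))

max-size : ∀ t {s N} → Construction s N → GriesmerTight s N → IsMaxSize 𝔽₃ 5 2 (13 * t + s) (121 * t + N)
max-size t {s} {N} c (s≤N , tight) = exists (periodic t c) , λ n sys →
  let L , len , bd = system⇒pairs sys
  in subst (_≤ 121 * t + N) len (griesmer-upper t s N (toWitness s≤N) (toWitness tight) L bd)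

∸-period : ∀ m k i t → i ≤ m * k → m * t + (m * k ∸ i) ≡ m * (k + t) ∸ i
∸-period m k i t i≤ = trans (sym (ℕ.+-∸-assoc (m * t) i≤)) (cong (_∸ i) (trans (sym (ℕ.*-distribˡ-+ m t k)) (cong (m *_) (ℕ.+-comm t k))))

row : ∀ k i j → {True (i ℕ.≤? 13 * k)} → {True (j ℕ.≤? 121 * k)} →
      Construction (13 * k ∸ i) (121 * k ∸ j) → GriesmerTight (13 * k ∸ i) (121 * k ∸ j) →
      ∀ t → k ≤ t → IsMaxSize 𝔽₃ 5 2 (13 * t ∸ i) (121 * t ∸ j)
row k i j {i≤} {j≤} c tight t k≤t = subst (λ t → IsMaxSize 𝔽₃ 5 2 (13 * t ∸ i) (121 * t ∸ j)) (ℕ.m+[n∸m]≡n k≤t)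
  (subst₂ (IsMaxSize 𝔽₃ 5 2) (∸-period 13 k i (t ∸ k) (toWitness i≤)) (∸-period 121 k j (t ∸ k) (toWitness j≤))
    (max-size (t ∸ k) c tight))

at-most-one : ∀ (L : List (Pair 5)) → Bounded 1 L → length L ≤ 1
at-most-one []      _ = z≤n
at-most-one (_ ∷ []) _ = ℕ.≤-refl
at-most-one ((a , b) ∷ (a′ , b′) ∷ L) bd with orthogonal-exists (a ∷ b ∷ a′ ∷ b′ ∷ []) ℕ.≤-refl
... | h , h≢0 , p ∷ q ∷ p′ ∷ q′ ∷ [] = contradiction (ℕ.≤-trans both (bound bd h h≢0)) λ { (s≤s ()) }
  where
  both : 2 ≤ killedIn ((a , b) ∷ (a′ , b′) ∷ L) h
  both = ℕ.+-mono-≤ (ℕ.≤-reflexive (sym (χ-yes (killed? h (a , b)) (p , q))))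
          (ℕ.≤-trans (ℕ.≤-reflexive (sym (χ-yes (killed? h (a′ , b′)) (p′ , q′)))) (ℕ.m≤m+n _ _))

at-most-twelve : ∀ (L : List (Pair 5)) → Bounded 2 L → length L ≤ 12
at-most-twelve L bd with length L ℕ.≤? 12
... | yes le = le
... | no ¬le = ⊥-elim (no-thirteen (List.take 13 L)
  (trans (Listₚ.length-take 13 L) (ℕ.m≤n⇒m⊓n≡m (ℕ.≰⇒> ¬le)))
  (bounded λ h h≢0 → ℕ.≤-trans (ℕ.≤-trans (ℕ.m≤m+n _ _) (ℕ.≤-reflexive (trans (sym (∑-++ (List.take 13 L) (List.drop 13 L) (κ h)))
    (cong (λ M → killedIn M h) (Listₚ.take++drop≡id 13 L))))) (bound bd h h≢0)))

theorem5 :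
      ((t : ℕ) → 1 ≤ t → IsMaxSize 𝔽₃ 5 2 (13 * t) (121 * t))
    × ((t : ℕ) → 1 ≤ t → IsMaxSize 𝔽₃ 5 2 (13 * t ∸ 1) (121 * t ∸ 10))
    × ((t : ℕ) → 1 ≤ t → IsMaxSize 𝔽₃ 5 2 (13 * t ∸ 2) (121 * t ∸ 20))
    × ((t : ℕ) → 1 ≤ t → IsMaxSize 𝔽₃ 5 2 (13 * t ∸ 3) (121 * t ∸ 30))
    × ((t : ℕ) → 1 ≤ t → IsMaxSize 𝔽₃ 5 2 (13 * t ∸ 4) (121 * t ∸ 40))
    × ((t : ℕ) → 1 ≤ t → IsMaxSize 𝔽₃ 5 2 (13 * t ∸ 5) (121 * t ∸ 50))
    × ((t : ℕ) → 1 ≤ t → IsMaxSize 𝔽₃ 5 2 (13 * t ∸ 6) (121 * t ∸ 60))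
    × ((t : ℕ) → 1 ≤ t → IsMaxSize 𝔽₃ 5 2 (13 * t ∸ 7) (121 * t ∸ 67))
    × ((t : ℕ) → 1 ≤ t → IsMaxSize 𝔽₃ 5 2 (13 * t ∸ 8) (121 * t ∸ 77))
    × ((t : ℕ) → 1 ≤ t → IsMaxSize 𝔽₃ 5 2 (13 * t ∸ 9) (121 * t ∸ 87))
    × ((t : ℕ) → 1 ≤ t → IsMaxSize 𝔽₃ 5 2 (13 * t ∸ 10) (121 * t ∸ 94))
    × ((t : ℕ) → 2 ≤ t → IsMaxSize 𝔽₃ 5 2 (13 * t ∸ 11) (121 * t ∸ 104))
    × IsMaxSize 𝔽₃ 5 2 2 12
    × ((t : ℕ) → 2 ≤ t → IsMaxSize 𝔽₃ 5 2 (13 * t ∸ 12) (121 * t ∸ 114))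
    × IsMaxSize 𝔽₃ 5 2 1 1
theorem5 =
    row 1 0 0 c₁₃ _
  , row 1 1 10 c₁₂ _
  , row 1 2 20 c₁₁ _
  , row 1 3 30 c₁₀ _
  , row 1 4 40 (c₃ ⊎ᶜ c₃ ⊎ᶜ c₃) _
  , row 1 5 50 (c₃ ⊎ᶜ c₅) _
  , row 1 6 60 (c₃ ⊎ᶜ c₄) _
  , row 1 7 67 (c₃ ⊎ᶜ c₃) _
  , row 1 8 77 c₅ _
  , row 1 9 87 c₄ _
  , row 1 10 94 c₃ _
  -- The base is t = 2, where 111 + 27 = 138 lines have at most 12 + 3 = 15 in a hyperplane.
  , row 2 11 104 (c₁₂ ⊎ᶜ c₃) _
  , (exists c₂ , λ n sys → let L , len , bd = system⇒pairs sys in subst (_≤ 12) len (at-most-twelve L bd))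
  , row 2 12 114 (c₁₁ ⊎ᶜ c₃) _
  , (exists c₁ , λ n sys → let L , len , bd = system⇒pairs sys in subst (_≤ 1) len (at-most-one L bd))
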